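{- The problem Robust Submodular Minimizer is fixed-parameter tractable when parameterized by $(k,d)$. That is, there are a computable function $g$ and an algorithm that solves every instance $I=(V,f_1,\dots,f_k,d)$ of Robust Submodular Minimizer in $g(k,d)\,|I|^{O(1)}$ time.
   Context: Here $\mathbb{N}$ contains $0$, $[k]=\{1,\dots,k\}$, and $\triangle$ denotes symmetric difference. A function $f:2^V\to\mathbb{R}$ is submodular if $f(X)+f(Y)\ge f(X\cup Y)+f(X\cap Y)$ for all $X,Y\subseteq V$; $\arg\min f=\{Y\subseteq V: f(Y)\le f(Y')\ \forall Y'\subseteq V\}$ is its set of minimizers. Robust Submodular Minimizer: the input is a finite set $V$, submodular functions $f_1,\dots,f_k:2^V\to\mathbb{R}$, and $d\in\mathbb{N}$; the task is to find a set $X\subseteq V$ such that for each $i\in[k]$ there exists $Y_i\in\arg\min f_i$ with $|X\triangle Y_i|\le d$, or detect that no such set exists. $|I|$ denotes the length of the input. Each $f_i$ is given via a compact representation of the distributive lattice $\mathcal{L}_i=\arg\min f_i$. A compact representation of a distributive lattice $\mathcal{L}\subseteq 2^V$ (a family closed under union and intersection) consists of a partition of $V$ into $U_0,U_1,\dots,U_b,U_\infty$ (with $U_0,U_\infty$ possibly empty) such that every set in $\mathcal{L}$ contains $U_0$, is disjoint from $U_\infty$, and is of the form $U_0\cup\bigcup_{j\in J}U_j$ for some $J\subseteq[b]$, together with a directed acyclic graph $G(\mathcal{L})$ with vertex set $\{U_0,\dots,U_b\}$ whose unique sink (vertex of out-degree zero) is $U_0$ and such that a non-empty set $Z$ of vertices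 of $G(\mathcal{L})$ has no out-going edge if and only if $\bigcup_{U_j\in Z}U_j\in\mathcal{L}$. -}

module Defs where

open import Data.Bool using (Bool; true; false; T; _xor_)
open import Data.Fin using (Fin; zero; suc; toℕ)
open import Data.Fin.Subset using (Subset; outside; _∈_; _⊆_; _∪_; _∩_; ⁅_⁆; ∣_∣; Empty)
open import Data.List using (List; []; _∷_)
open import Data.Maybe using (Maybe; just; nothing; maybe)
open import Data.Nat using (ℕ; zero; suc; _+_; _≤_; _⊔_)
open import Data.Nat.Binary using (ℕᵇ; 2[1+_]; 1+[2_]; fromℕ) renaming (zero to 0ᵇ)
import Data.Nat.Properties as ℕ
open import Data.Product using (∃; ∃-syntax; _×_; _,_)
open import Data.Rational as ℚ using (ℚ; 0ℚ; ½)
import Data.Rational.Properties as ℚ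
open import Data.Rational.Solver using (module +-*-Solver)
open import Data.Vec using (Vec; []; _∷_; lookup; tabulate; toList; zipWith)
open import Function.Bundles using (_⇔_)
open import Relation.Binary.Construct.Closure.Transitive using (TransClosure)
open import Relation.Binary.PropositionalEquality
  using (_≡_; refl; sym; trans; cong; subst)
open import Relation.Nullary using (¬_)

------------------------------------------------------------------------
-- Real numbers, as Cauchy sequences of rationals.  Only the order and
-- addition are needed; equality of reals is _≤ᴿ_ in both directions.

record ℝ : Set where
  field
    seq    : ℕ → ℚ
    cauchy : ∀ ε → 0ℚ ℚ.< ε →
             ∃[ N ] (∀ m n → N ≤ m → N ≤ n → ℚ.∣ seq m ℚ.- seq n ∣ ℚ.≤ ε)

open ℝ

infix  4 _≤ᴿ_
infixl 6 _+ᴿ_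

_≤ᴿ_ : ℝ → ℝ → Set
x ≤ᴿ y = ∀ ε → 0ℚ ℚ.< ε → ∃[ N ] (∀ n → N ≤ n → seq x n ℚ.≤ seq y n ℚ.+ ε)

private
  0<½* : ∀ ε → 0ℚ ℚ.< ε → 0ℚ ℚ.< ½ ℚ.* ε
  0<½* ε 0<ε = subst (ℚ._< ½ ℚ.* ε) (ℚ.*-zeroʳ ½) (ℚ.*-monoʳ-<-pos ½ 0<ε)

  ½+½ : ∀ ε → ½ ℚ.* ε ℚ.+ ½ ℚ.* ε ≡ ε
  ½+½ ε = trans (sym (ℚ.*-distribʳ-+ ε ½ ½)) (ℚ.*-identityˡ ε)

  rearrange : ∀ a b c d → (a ℚ.+ b) ℚ.- (c ℚ.+ d) ≡ (a ℚ.- c) ℚ.+ (b ℚ.- d)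
  rearrange = solve 4 (λ a b c d → (a :+ b) :- (c :+ d) := (a :- c) :+ (b :- d)) refl
    where open +-*-Solver

_+ᴿ_ : ℝ → ℝ → ℝ
seq (x +ᴿ y) n = seq x n ℚ.+ seq y n
cauchy (x +ᴿ y) ε 0<ε
  with cauchy x (½ ℚ.* ε) (0<½* ε 0<ε) | cauchy y (½ ℚ.* ε) (0<½* ε 0<ε)
... | M , p | N , q = M ⊔ N , λ m n m≥ n≥ → begin
  ℚ.∣ (seq x m ℚ.+ seq y m) ℚ.- (seq x n ℚ.+ seq y n) ∣
    ≡⟨ cong ℚ.∣_∣ (rearrange (seq x m) (seq y m) (seq x n) (seq y n)) ⟩
  ℚ.∣ (seq x m ℚ.- seq x n) ℚ.+ (seq y m ℚ.- seq y n) ∣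
    ≤⟨ ℚ.∣p+q∣≤∣p∣+∣q∣ (seq x m ℚ.- seq x n) (seq y m ℚ.- seq y n) ⟩
  ℚ.∣ seq x m ℚ.- seq x n ∣ ℚ.+ ℚ.∣ seq y m ℚ.- seq y n ∣
    ≤⟨ ℚ.+-mono-≤ (p m n (ℕ.m⊔n≤o⇒m≤o M N m≥) (ℕ.m⊔n≤o⇒m≤o M N n≥))
                  (q m n (ℕ.m⊔n≤o⇒n≤o M N m≥) (ℕ.m⊔n≤o⇒n≤o M N n≥)) ⟩
  ½ ℚ.* ε ℚ.+ ½ ℚ.* ε
    ≡⟨ ½+½ ε ⟩
  ε ∎
  where open ℚ.≤-Reasoning

------------------------------------------------------------------------
-- Submodular functions on the subsets of V = Fin n, and their minimizers

Submodular : ∀ {n} → (Subset n → ℝ) → Set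
Submodular f = ∀ X Y → f (X ∪ Y) +ᴿ f (X ∩ Y) ≤ᴿ f X +ᴿ f Y

argmin : ∀ {n} → (Subset n → ℝ) → Subset n → Set
argmin f Y = ∀ Y′ → f Y ≤ᴿ f Y′

infixl 6 _△_

_△_ : ∀ {n} → Subset n → Subset n → Subset n
_△_ = zipWith _xor_

------------------------------------------------------------------------
-- Compact representations of distributive lattices

-- The partition is given by the function sending v ∈ V to the index of
-- its part: just j for U_j (0 ≤ j ≤ b) and nothing for U_∞.  The vertex
-- U_j of the digraph is likewise represented by its index j.

module _ {n b : ℕ} (part : Fin n → Maybe (Fin (suc b))) where

  ⋃ᵁ : Subset (suc b) → Subset n
  ⋃ᵁ Z = tabulate λ v → maybe (lookup Z) outside (part v)

  U∞ : Subset n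
  U∞ = tabulate λ v → maybe (λ _ → false) true (part v)

NoOutgoingEdge : ∀ {m} → (Fin m → Fin m → Bool) → Subset m → Set
NoOutgoingEdge edge Z = ∀ i j → i ∈ Z → T (edge i j) → j ∈ Z

record CompactRepresentation {n : ℕ} (𝓛 : Subset n → Set) : Set where
  field
    b        : ℕ
    part     : Fin n → Maybe (Fin (suc b))
    edge     : Fin (suc b) → Fin (suc b) → Bool
    -- only U_0 and U_∞ may be empty
    nonempty : ∀ (j : Fin b) → ∃[ v ] part v ≡ just (suc j)

    contains-U₀ : ∀ X → 𝓛 X → ⋃ᵁ part ⁅ zero ⁆ ⊆ X
    avoids-U∞   : ∀ X → 𝓛 X → Empty (X ∩ U∞ part)
    generated   : ∀ X → 𝓛 X → ∃[ J ] X ≡ ⋃ᵁ part ⁅ zero ⁆ ∪ ⋃ᵁ part (outside ∷ J)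

    acyclic     : ∀ i → ¬ TransClosure (λ i j → T (edge i j)) i i
    U₀-sink     : ∀ j → ¬ T (edge zero j)
    unique-sink : ∀ i → (∀ j → ¬ T (edge i j)) → i ≡ zero

    -- The usual wording has "non-empty Z" in place of "Z ∋ U_0".  When
    -- U_0 ≠ ∅ the two agree: following edges from any vertex of an acyclic
    -- digraph leads to a sink, so a non-empty Z without U_0 has an out-going
    -- edge, and its union misses U_0, hence is not in 𝓛.  When U_0 = ∅,
    -- however, Z and Z ∪ {U_0} have the same union, and read literally the
    -- non-empty version could hold only for b = 0.  The condition below is
    -- implied by the literal one, and also admits U_0 = ∅.
    closed⇔∈𝓛 : ∀ Z → zero ∈ Z → NoOutgoingEdge edge Z ⇔ 𝓛 (⋃ᵁ part Z)

------------------------------------------------------------------------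
-- Robust Submodular Minimizer

record Instance : Set where
  field
    n          : ℕ
    k          : ℕ
    d          : ℕ
    f          : Fin k → Subset n → ℝ
    submodular : ∀ i → Submodular (f i)
    compact    : ∀ i → CompactRepresentation (argmin (f i))

Robust : (I : Instance) → Subset (Instance.n I) → Set
Robust I X = ∀ i → ∃[ Y ] argmin (f i) Y × ∣ X △ Y ∣ ≤ d
  where open Instance I

Answer : Instance → Set
Answer I = Maybe (Subset (Instance.n I))

Correct : (I : Instance) → Answer I → Set
Correct I (just X) = Robust I X
Correct I nothing  = ¬ ∃ (Robust I)

------------------------------------------------------------------------
-- Model of computation: first-order, call-by-value recursive programs on
-- binary trees.

data Tree : Set where
  nil  : Tree
  cons : Tree → Tree → Tree

size : Tree → ℕ
size nil        = 1
size (cons x y) = suc (size x + size y)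

-- Expressions over m mutually recursive unary functions with v variables in
-- scope (de Bruijn indices).  case binds the two subtrees, the left one
-- being variable 0; bind e e′ is "let 0 = e in e′".
data Exp (m v : ℕ) : Set where
  var  : Fin v → Exp m v
  nil  : Exp m v
  cons : Exp m v → Exp m v → Exp m v
  case : Exp m v → Exp m v → Exp m (2 + v) → Exp m v
  bind : Exp m v → Exp m (suc v) → Exp m v
  call : Fin m → Exp m v → Exp m v

-- A program consists of the bodies of its functions; function zero is
-- the main function.
record Program : Set where
  field
    functions : ℕ
    body      : Vec (Exp (suc functions) 1) (suc functions)

-- ρ ⊢ e ⇓ x ∥ t: in environment ρ, e evaluates to x in time t, where each
-- rule application costs one unit.  This is a realistic time measure: trees
-- are never compared and can be shared, so on a pointer machine or RAM each
-- rule takes a number of elementary steps bounded by a constant depending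
-- only on the program.  Conversely Turing machines are simulated with
-- constant-factor overhead (each half-tape being a list).  Hence time bounds
-- agree with the usual ones up to a polynomial.
module Evaluation {m : ℕ} (body : Vec (Exp m 1) m) where

  infix 3 _⊢_⇓_∥_

  data _⊢_⇓_∥_ {v : ℕ} (ρ : Vec Tree v) : Exp m v → Tree → ℕ → Set where
    var       : ∀ i → ρ ⊢ var i ⇓ lookup ρ i ∥ 1
    nil       : ρ ⊢ nil ⇓ nil ∥ 1
    cons      : ∀ {e e′ x x′ t t′} →
                ρ ⊢ e ⇓ x ∥ t → ρ ⊢ e′ ⇓ x′ ∥ t′ →
                ρ ⊢ cons e e′ ⇓ cons x x′ ∥ suc (t + t′)
    case-nil  : ∀ {e e₀ e₁ x t t′} →
                ρ ⊢ e ⇓ nil ∥ t → ρ ⊢ e₀ ⇓ x ∥ t′ →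
                ρ ⊢ case e e₀ e₁ ⇓ x ∥ suc (t + t′)
    case-cons : ∀ {e e₀ e₁ y z x t t′} →
                ρ ⊢ e ⇓ cons y z ∥ t → (y ∷ z ∷ ρ) ⊢ e₁ ⇓ x ∥ t′ →
                ρ ⊢ case e e₀ e₁ ⇓ x ∥ suc (t + t′)
    bind      : ∀ {e e′ y x t t′} →
                ρ ⊢ e ⇓ y ∥ t → (y ∷ ρ) ⊢ e′ ⇓ x ∥ t′ →
                ρ ⊢ bind e e′ ⇓ x ∥ suc (t + t′)
    call      : ∀ {h e y x t t′} →
                ρ ⊢ e ⇓ y ∥ t → (y ∷ []) ⊢ lookup body h ⇓ x ∥ t′ →
                ρ ⊢ call h e ⇓ x ∥ suc (t + t′)

infix 3 _⟨_⟩⇓_∥_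

-- Program P halts on input x with output y after exactly t steps.
_⟨_⟩⇓_∥_ : Program → Tree → Tree → ℕ → Set
P ⟨ x ⟩⇓ y ∥ t = (x ∷ []) ⊢ lookup body zero ⇓ y ∥ t
  where open Program P
        open Evaluation body

------------------------------------------------------------------------
-- Encodings

encodeℕ : ℕ → Tree
encodeℕ zero    = nil
encodeℕ (suc n) = cons nil (encodeℕ n)

encodeBool : Bool → Tree
encodeBool false = nil
encodeBool true  = cons nil nil

-- binary numerals, least significant digit (1 or 2) first
encodeℕᵇ : ℕᵇ → Tree
encodeℕᵇ 0ᵇ       = nil
encodeℕᵇ 1+[2 x ] = cons (encodeBool false) (encodeℕᵇ x)
encodeℕᵇ 2[1+ x ] = cons (encodeBool true) (encodeℕᵇ x)

encodeMaybe : ∀ {A : Set} → (A → Tree) → Maybe A → Tree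
encodeMaybe enc nothing  = nil
encodeMaybe enc (just x) = cons (enc x) nil

encodeList : ∀ {A : Set} → (A → Tree) → List A → Tree
encodeList enc []       = nil
encodeList enc (x ∷ xs) = cons (enc x) (encodeList enc xs)

encodeFun : ∀ {A : Set} {n} → (A → Tree) → (Fin n → A) → Tree
encodeFun enc h = encodeList enc (toList (tabulate h))

encodeCompact : ∀ {n} {𝓛 : Subset n → Set} → CompactRepresentation 𝓛 → Tree
encodeCompact R =
  cons (encodeℕ b)
    (cons (encodeFun (encodeMaybe (λ j → encodeℕ (toℕ j))) part)
          (encodeFun (encodeFun encodeBool) edge))
  where open CompactRepresentation R

-- The functions f i enter the input only through their compact
-- representations.  The distance d is written in binary; the unary numerals
-- for n, b and the indices of the parts change the length only polynomially,
-- since the elements of V are listed anyway and b ≤ n.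
encodeInstance : Instance → Tree
encodeInstance I =
  cons (encodeℕ n)
    (cons (encodeℕᵇ (fromℕ d))
          (encodeFun (λ i → encodeCompact (compact i)) λ i → i))
  where open Instance I

encodeAnswer : (I : Instance) → Answer I → Tree
encodeAnswer I = encodeMaybe (λ X → encodeList encodeBool (toList X))

length : Instance → ℕ
length I = size (encodeInstance I)

Computable : (ℕ → ℕ → ℕ) → Set
Computable g = ∃[ P ] (∀ k d → ∃[ t ]
  (P ⟨ cons (encodeℕ k) (encodeℕ d) ⟩⇓ encodeℕ (g k d) ∥ t))

{-# OPTIONS --safe #-}
module Submission where

-- A set X with |X △ Yᵢ| ≤ d for minimizers Yᵢ is the source side of a cut in the
-- following graph.  Its vertices are the elements of V and the parts of every
-- lattice; the edges of the digraphs G(𝓛ᵢ) are undeletable arcs, and v ∈ V and its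
-- part in 𝓛ᵢ are joined in both directions by deletable arcs of colour i.  The
-- source leads to the parts U₀, and the parts U_∞ are sinks.  At most d arcs of
-- each colour may be cut.
--
-- There are kd tokens, d of each colour; a token is a set of arcs, at most one of
-- which is to be cut, and arcs in no token are undeletable.  Given disjoint paths
-- from the source to sinks, guess for every token and every path whether the arc
-- that the token stands for lies on the path, and shrink the token accordingly.
-- If the paths cannot be augmented now, then the vertices reached by the search
-- for an augmenting path form a cut with at most one arc on each path; as the cut
-- arcs of a token are on a common path, this is at most one arc per token, and the
-- cut respects all budgets.  Otherwise there is one more path, which can happen at
-- most kd times, since for the guesses made by a solution each of the paths
-- contains one of its cut arcs.  So polynomially many (in k and d) guess bits
-- suffice, and all of them are tried.
--
-- The search for an augmenting path keeps, for every vertex z that it visits, a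
-- rerouted system of paths together with a partial path from the source to z.

open import Defs
open import Data.Bool using (Bool; true; false; T; _xor_; _∨_; if_then_else_)
open import Data.Empty using (⊥; ⊥-elim)
open import Data.Fin using (Fin; zero; suc; toℕ; punchOut; _↑ˡ_; _↑ʳ_)
open import Data.Fin.Properties using (toℕ-injective; toℕ<n; any?; punchOut-injective)
  renaming (suc-injective to Fin-suc-injective)
open import Data.Fin.Subset using (Subset; inside; outside; ∣_∣; ⁅_⁆; _∪_) renaming (_∈_ to _∈ˢ_)
open import Data.Fin.Subset.Properties using (_∈?_)
open import Data.Maybe using (Maybe; just; nothing; maybe)
open import Data.Nat using (ℕ; zero; suc; _+_; _*_; _∸_; _^_; _≤_; _<_; z≤n; s≤s; NonZero; >-nonZero)
open import Data.Nat.Binary using (2[1+_]; 1+[2_]; fromℕ) renaming (zero to 0ᵇ; toℕ to toℕᵇ)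
import Data.Nat.Binary.Properties as ℕᵇ
open import Data.Nat.Properties
open import Data.Product using (∃-syntax; _×_; _,_; proj₁; proj₂)
open import Data.Sum using (_⊎_; inj₁; inj₂; [_,_]; map₂)
open import Data.Vec using (Vec; []; _∷_; _++_; lookup; tabulate; toList; here; there)
open import Data.Vec.Properties
  using (lookup-++ˡ; lookup-++ʳ; lookup∘tabulate; []=⇒lookup; lookup⇒[]=; lookup-zipWith; lookup-replicate)
open import Function using (_∘_; id)
open import Function.Bundles using (Equivalence)
open import Relation.Nullary using (¬_; Dec; yes; no)
open import Relation.Nullary.Decidable using (_⊎-dec_; _×-dec_; map′)
open import Relation.Binary.PropositionalEquality hiding ([_]; J)

-- A cut arc of colour `i` corresponds to one element of the symmetric difference of `X` and `Yᵢ`,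
-- because only one of the two arcs between an element and its part can leave the source side. A
-- minimum cut would not respect `k` separate budgets. Tokens replace the budgets by the condition
-- of one cut arc per token, and aligning every token with every path reduces this to one cut arc
-- per path, which the closure of the search supplies. Undeletable arcs have unbounded capacity;
-- hence paths record deletable arcs only and may share all others. The program is assembled from
-- combinators whose `PolyTime` records pair a code with polynomial bounds on its time and on the
-- size of its value. Two stages lie outside this class: writing `d` in unary and listing all
-- guesses. On an instance `I` both are polynomial in `length I + 2 ^ bits k d`, and a power of this
-- sum is at most a function of `k` and `d` times a power of the length.

hd tl : Tree → Tree
hd nil        = nil
hd (cons x y) = x
tl nil        = nil
tl (cons x y) = y

pattern tt = cons nil nil

ifᵗ : Tree → Tree → Tree → Tree
ifᵗ nil        x y = y
ifᵗ (cons _ _) x y = x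

eqᵗ : Tree → Tree → Tree
eqᵗ nil          nil          = tt
eqᵗ nil          (cons _ _)   = nil
eqᵗ (cons _ _)   nil          = nil
eqᵗ (cons x₁ x₂) (cons y₁ y₂) = ifᵗ (eqᵗ x₁ y₁) (eqᵗ x₂ y₂) nil

-- Trees double as lists: nil is the empty list, cons x l the list with head x.
para : (Tree → Tree → Tree → Tree) → Tree → Tree → Tree
para s b nil        = b
para s b (cons h t) = s h t (para s b t)

-- The programming language

-- A point-free language; multiple arguments and local variables are packed
-- into one list.
data Code : Set where
  idC nilC headC tailC : Code
  consC _∘C_ eqC       : Code → Code → Code
  ifC paraC            : Code → Code → Code → Code

⟦_⟧ : Code → Tree → Tree
⟦ idC ⟧         x = x
⟦ nilC ⟧        x = nil
⟦ headC ⟧       x = hd x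
⟦ tailC ⟧       x = tl x
⟦ consC c d ⟧   x = cons (⟦ c ⟧ x) (⟦ d ⟧ x)
⟦ c ∘C d ⟧      x = ⟦ c ⟧ (⟦ d ⟧ x)
⟦ eqC c d ⟧     x = eqᵗ (⟦ c ⟧ x) (⟦ d ⟧ x)
⟦ ifC c d e ⟧   x = ifᵗ (⟦ c ⟧ x) (⟦ d ⟧ x) (⟦ e ⟧ x)
⟦ paraC l b s ⟧ x =
  para (λ h t a → ⟦ s ⟧ (cons h (cons t (cons a x)))) (⟦ b ⟧ x) (⟦ l ⟧ x)

-- The constants count the rule applications in the compiled code below.
eqTime : Tree → Tree → ℕ
eqTime nil          nil        = 9
eqTime nil          (cons _ _) = 7
eqTime (cons _ _)   nil        = 7
eqTime (cons x₁ x₂) (cons y₁ y₂) with eqᵗ x₁ y₁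
... | nil      = 11 + (eqTime x₁ y₁ + 1)
... | cons _ _ = 11 + (eqTime x₁ y₁ + (4 + eqTime x₂ y₂))

branch : Tree → ℕ → ℕ → ℕ
branch nil        m n = n
branch (cons _ _) m n = m

paraTime : (Tree → Tree → Tree → Tree) → (Tree → Tree → Tree → ℕ) → Tree → ℕ → Tree → ℕ
paraTime s ts b tb nil        = 6 + tb
paraTime s ts b tb (cons h t) = 14 + ((paraTime s ts b tb t + 1) + ts h t (para s b t))

time : Code → Tree → ℕ
time idC           x = 1
time nilC          x = 1
time headC         x = 3
time tailC         x = 3
time (consC c d)   x = suc (time c x + time d x)
time (c ∘C d)      x = suc (time d x + time c (⟦ d ⟧ x))
time (eqC c d)     x = suc (suc (time c x + time d x) + eqTime (⟦ c ⟧ x) (⟦ d ⟧ x))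
time (ifC c d e)   x = suc (time c x + branch (⟦ c ⟧ x) (2 + time d x) (time e x))
time (paraC l b s) x = suc (suc (time l x + 1) +
  paraTime (λ h t a → ⟦ s ⟧ (cons h (cons t (cons a x))))
           (λ h t a → time s (cons h (cons t (cons a x))))
           (⟦ b ⟧ x) (time b x) (⟦ l ⟧ x))

#paras : Code → ℕ
#paras idC           = 0
#paras nilC          = 0
#paras headC         = 0
#paras tailC         = 0
#paras (consC c d)   = #paras c + #paras d
#paras (c ∘C d)      = #paras c + #paras d
#paras (eqC c d)     = #paras c + #paras d
#paras (ifC c d e)   = #paras c + (#paras d + #paras e)
#paras (paraC l b s) = suc (#paras l + (#paras b + #paras s))

v0 : ∀ {n m} → Exp m (1 + n)
v0 = var zero

v1 : ∀ {n m} → Exp m (2 + n)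
v1 = var (suc zero)

v2 : ∀ {n m} → Exp m (3 + n)
v2 = var (suc (suc zero))

v3 : ∀ {n m} → Exp m (4 + n)
v3 = var (suc (suc (suc zero)))

v5 : ∀ {n m} → Exp m (6 + n)
v5 = var (suc (suc (suc (suc (suc zero)))))

-- q is the name of the equality function, ι those of the functions compiled
-- from the occurrences of paraC; variable 0 holds the argument.
compile : ∀ (c : Code) {m w} → Fin m → (Fin (#paras c) → Fin m) → Exp m (suc w)
compile idC           q ι = v0
compile nilC          q ι = nil
compile headC         q ι = case v0 nil v0
compile tailC         q ι = case v0 nil v1
compile (consC c d)   q ι = cons (compile c q (ι ∘ (_↑ˡ _))) (compile d q (ι ∘ (_ ↑ʳ_)))
compile (c ∘C d)      q ι = bind (compile d q (ι ∘ (_ ↑ʳ_))) (compile c q (ι ∘ (_↑ˡ _)))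
compile (eqC c d)     q ι =
  call q (cons (compile c q (ι ∘ (_↑ˡ _))) (compile d q (ι ∘ (_ ↑ʳ_))))
compile (ifC c d e)   q ι =
  case (compile c q (ι ∘ (_↑ˡ _)))
       (compile e q (ι ∘ (#paras c ↑ʳ_) ∘ (#paras d ↑ʳ_)))
       -- `case` has put two subtrees in front, so the argument is copied back to variable 0.
       (bind v2 (compile d q (ι ∘ (#paras c ↑ʳ_) ∘ (_↑ˡ _))))
compile (paraC l b s) q ι =
  call (ι zero) (cons (compile l q (ι ∘ suc ∘ (_↑ˡ _))) v0)

eqBody : ∀ {m} → Fin m → Exp m 1
eqBody q =
  case v0 nil
    (case v0
      (case v1 (cons nil nil) nil)
      (case v3 nil
        -- The innermost variables are `y₁ y₂ x₁ x₂`; the result of the first comparison puts two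
        -- more in front of them.
        (case (call q (cons v2 v0)) nil (call q (cons v5 v3)))))

-- Every occurrence of `paraC` becomes one recursive function, which receives the rest of the list
-- paired with the fixed argument.
bodies : ∀ (c : Code) {m} → Fin m → (Fin (#paras c) → Fin m) → Vec (Exp m 1) (#paras c)
bodies idC           q ι = []
bodies nilC          q ι = []
bodies headC         q ι = []
bodies tailC         q ι = []
bodies (consC c d)   q ι = bodies c q (ι ∘ (_↑ˡ _)) ++ bodies d q (ι ∘ (_ ↑ʳ_))
bodies (c ∘C d)      q ι = bodies c q (ι ∘ (_↑ˡ _)) ++ bodies d q (ι ∘ (_ ↑ʳ_))
bodies (eqC c d)     q ι = bodies c q (ι ∘ (_↑ˡ _)) ++ bodies d q (ι ∘ (_ ↑ʳ_))
bodies (ifC c d e)   q ι =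
  bodies c q (ι ∘ (_↑ˡ _)) ++
  (bodies d q (ι ∘ (#paras c ↑ʳ_) ∘ (_↑ˡ _)) ++
   bodies e q (ι ∘ (#paras c ↑ʳ_) ∘ (#paras d ↑ʳ_)))
bodies (paraC l b s) q ι =
  case v0 nil
    (case v0
      (bind v1 (compile b q (ι ∘ suc ∘ (#paras l ↑ʳ_) ∘ (_↑ˡ _))))
      (bind (cons v0 (cons v1 (cons (call (ι zero) (cons v1 v3)) v3)))
            (compile s q (ι ∘ suc ∘ (#paras l ↑ʳ_) ∘ (#paras b ↑ʳ_))))) ∷
  (bodies l q (ι ∘ suc ∘ (_↑ˡ _)) ++
   (bodies b q (ι ∘ suc ∘ (#paras l ↑ʳ_) ∘ (_↑ˡ _)) ++
    bodies s q (ι ∘ suc ∘ (#paras l ↑ʳ_) ∘ (#paras b ↑ʳ_))))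

module Compilation {m} (body : Vec (Exp m 1) m) (q : Fin m) (q-eq : lookup body q ≡ eqBody q) where

  open Evaluation body

  Implements : ∀ {n} → (Fin n → Fin m) → Vec (Exp m 1) n → Set
  Implements ι es = ∀ i → lookup body (ι i) ≡ lookup es i

  implementsˡ : ∀ {n n′} {ι : Fin (n + n′) → Fin m} (es : Vec _ n) (es′ : Vec _ n′) →
                Implements ι (es ++ es′) → Implements (ι ∘ (_↑ˡ n′)) es
  implementsˡ es es′ h i = trans (h _) (lookup-++ˡ es es′ i)

  implementsʳ : ∀ {n n′} {ι : Fin (n + n′) → Fin m} (es : Vec _ n) (es′ : Vec _ n′) →
                Implements ι (es ++ es′) → Implements (ι ∘ (n ↑ʳ_)) es′
  implementsʳ es es′ h i = trans (h _) (lookup-++ʳ es es′ i)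

  eqCall : ∀ {v} {ρ : Vec Tree v} i j {x t} →
           (cons (lookup ρ i) (lookup ρ j) ∷ []) ⊢ eqBody q ⇓ x ∥ t →
           ρ ⊢ call q (cons (var i) (var j)) ⇓ x ∥ 4 + t
  eqCall i j r =
    call (cons (var i) (var j)) (subst (λ e → (_ ∷ []) ⊢ e ⇓ _ ∥ _) (sym q-eq) r)

  eqBody-correct : ∀ x y → (cons x y ∷ []) ⊢ eqBody q ⇓ eqᵗ x y ∥ eqTime x y
  eqBody-correct nil nil =
    case-cons (var _) (case-nil (var _) (case-nil (var _) (cons nil nil)))
  eqBody-correct nil (cons _ _) =
    case-cons (var _) (case-nil (var _) (case-cons (var _) nil))
  eqBody-correct (cons _ _) nil =
    case-cons (var _) (case-cons (var _) (case-nil (var _) nil))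
  eqBody-correct (cons x₁ x₂) (cons y₁ y₂) with eqᵗ x₁ y₁ | eqBody-correct x₁ y₁
  ... | nil      | r =
    case-cons (var _) (case-cons (var _) (case-cons (var _)
      (case-nil (eqCall (suc (suc zero)) zero r) nil)))
  ... | cons _ _ | r =
    case-cons (var _) (case-cons (var _) (case-cons (var _)
      (case-cons (eqCall (suc (suc zero)) zero r)
        (eqCall (suc (suc (suc (suc (suc zero))))) (suc (suc (suc zero)))
          (eqBody-correct x₂ y₂)))))

  -- Compiled code reads nothing but its argument in variable 0, so `ρ` is arbitrary; this absorbs
  -- the older values that `bind` and `case` leave behind. The proof is mutual with `para-correct`,
  -- which also recurses on the list.
  compile-correct : ∀ c (ι : Fin (#paras c) → Fin m) → Implements ι (bodies c q ι) →
                    ∀ {w} (ρ : Vec Tree w) x → (x ∷ ρ) ⊢ compile c q ι ⇓ ⟦ c ⟧ x ∥ time c x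

  para-correct : ∀ l b s (ι : Fin (#paras (paraC l b s)) → Fin m) →
    Implements ι (bodies (paraC l b s) q ι) → ∀ x y →
    (cons y x ∷ []) ⊢ lookup body (ι zero)
      ⇓ para (λ h t a → ⟦ s ⟧ (cons h (cons t (cons a x)))) (⟦ b ⟧ x) y
      ∥ paraTime (λ h t a → ⟦ s ⟧ (cons h (cons t (cons a x))))
                 (λ h t a → time s (cons h (cons t (cons a x)))) (⟦ b ⟧ x) (time b x) y
  para-correct l b s ι im x y rewrite im zero = go y
    where
    im′ = implementsʳ (bodies l q (ι ∘ suc ∘ (_↑ˡ _))) _ (im ∘ suc)
    go : ∀ y → (cons y x ∷ []) ⊢ lookup (bodies (paraC l b s) q ι) zero
      ⇓ para (λ h t a → ⟦ s ⟧ (cons h (cons t (cons a x)))) (⟦ b ⟧ x) y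
      ∥ paraTime (λ h t a → ⟦ s ⟧ (cons h (cons t (cons a x))))
                 (λ h t a → time s (cons h (cons t (cons a x)))) (⟦ b ⟧ x) (time b x) y
    go nil = case-cons (var _) (case-nil (var _) (bind (var _)
      (compile-correct b _ (implementsˡ (bodies b q _) _ im′) _ x)))
    go (cons h t) = case-cons (var _) (case-cons (var _) (bind
      (cons (var _) (cons (var _) (cons
        (call (cons (var _) (var _))
              (subst (λ e → (cons t x ∷ []) ⊢ e ⇓ _ ∥ _) (sym (im zero)) (go t)))
        (var _))))
      (compile-correct s _ (implementsʳ (bodies b q _) _ im′) _ _)))

  compile-correct idC   ι im ρ x = var zero
  compile-correct nilC  ι im ρ x = nil
  compile-correct headC ι im ρ nil        = case-nil (var zero) nil
  compile-correct headC ι im ρ (cons _ _) = case-cons (var zero) (var zero)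
  compile-correct tailC ι im ρ nil        = case-nil (var zero) nil
  compile-correct tailC ι im ρ (cons _ _) = case-cons (var zero) (var (suc zero))
  compile-correct (consC c d) ι im ρ x =
    cons (compile-correct c _ (implementsˡ (bodies c q _) _ im) ρ x)
         (compile-correct d _ (implementsʳ (bodies c q _) _ im) ρ x)
  compile-correct (c ∘C d) ι im ρ x =
    bind (compile-correct d _ (implementsʳ (bodies c q _) _ im) ρ x)
         (compile-correct c _ (implementsˡ (bodies c q _) _ im) (x ∷ ρ) (⟦ d ⟧ x))
  compile-correct (eqC c d) ι im ρ x =
    call (cons (compile-correct c _ (implementsˡ (bodies c q _) _ im) ρ x)
               (compile-correct d _ (implementsʳ (bodies c q _) _ im) ρ x))
         (subst (λ e → (cons (⟦ c ⟧ x) (⟦ d ⟧ x) ∷ []) ⊢ e ⇓ _ ∥ _) (sym q-eq)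
                (eqBody-correct (⟦ c ⟧ x) (⟦ d ⟧ x)))
  compile-correct (ifC c d e) ι im ρ x
    with ⟦ c ⟧ x | compile-correct c _ (implementsˡ (bodies c q _) _ im) ρ x
  ... | nil      | r = case-nil r
    (compile-correct e _ (implementsʳ (bodies d q _) _ (implementsʳ (bodies c q _) _ im)) ρ x)
  ... | cons _ _ | r = case-cons r (bind (var _)
    (compile-correct d _ (implementsˡ (bodies d q _) _ (implementsʳ (bodies c q _) _ im)) _ x))
  compile-correct (paraC l b s) ι im ρ x =
    call (cons (compile-correct l _ (implementsˡ (bodies l q _) _ (im ∘ suc)) ρ x) (var zero))
         (para-correct l b s ι im x (⟦ l ⟧ x))

shift² : ∀ {n} → Fin n → Fin (2 + n)
shift² i = suc (suc i)

program : Code → Program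
program c = record
  { functions = suc (#paras c)
  ; body      = compile c (suc zero) shift² ∷ eqBody (suc zero) ∷ bodies c (suc zero) shift²
  }

program-correct : ∀ c x → program c ⟨ x ⟩⇓ ⟦ c ⟧ x ∥ time c x
program-correct c x =
  compile-correct c shift² (λ _ → refl) [] x
  where open Compilation (Program.body (program c)) (suc zero) refl

1≤size : ∀ x → 1 ≤ size x
1≤size nil        = s≤s z≤n
1≤size (cons _ _) = s≤s z≤n

n≤2^n : ∀ n → n ≤ 2 ^ n
n≤2^n zero    = z≤n
n≤2^n (suc n) = begin
  1 + n  ≤⟨ +-mono-≤ (m^n>0 2 n) (n≤2^n n) ⟩
  2 ^ n + 2 ^ n  ≡⟨ cong (2 ^ n +_) (+-identityʳ (2 ^ n)) ⟨
  2 ^ n + (2 ^ n + 0) ∎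
  where open ≤-Reasoning

-- Polynomial time

PolyBounded : {A : Set} → (A → ℕ) → (A → ℕ) → Set
PolyBounded β φ = ∃[ e ] (∀ i → φ i ≤ β i ^ e)

-- Powers without coefficients suffice over a base of at least 2: a constant `c` is at most `2 ^ c`,
-- and a sum costs one more factor of the base. The base is a parameter because it is `suc ∘ size`
-- for the combinators but includes the number of guesses for the whole program.
module PolyBounds {A : Set} {β : A → ℕ} (2≤β : ∀ i → 2 ≤ β i) where

  β-nonZero : ∀ i → NonZero (β i)
  β-nonZero i = >-nonZero (≤-trans (s≤s z≤n) (2≤β i))

  ^-monoʳ : ∀ i {m n} → m ≤ n → β i ^ m ≤ β i ^ n
  ^-monoʳ i = ^-monoʳ-≤ (β i) {{β-nonZero i}}

  pb-≤ : {φ ψ : A → ℕ} → (∀ i → φ i ≤ ψ i) → PolyBounded β ψ → PolyBounded β φ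
  pb-≤ φ≤ψ (e , h) = e , λ i → ≤-trans (φ≤ψ i) (h i)

  pb-base : PolyBounded β β
  pb-base = 1 , λ i → ≤-reflexive (sym (*-identityʳ (β i)))

  pb-const : ∀ c → PolyBounded β (λ _ → c)
  pb-const c = c , λ i → ≤-trans (n≤2^n c) (^-monoˡ-≤ c (2≤β i))

  pb-* : {φ ψ : A → ℕ} → PolyBounded β φ → PolyBounded β ψ → PolyBounded β (λ i → φ i * ψ i)
  pb-* (e , h) (e′ , h′) = e + e′ , λ i →
    ≤-trans (*-mono-≤ (h i) (h′ i)) (≤-reflexive (sym (^-distribˡ-+-* (β i) e e′)))

  pb-+ : {φ ψ : A → ℕ} → PolyBounded β φ → PolyBounded β ψ → PolyBounded β (λ i → φ i + ψ i)
  pb-+ {φ} {ψ} (e , h) (e′ , h′) = suc (e + e′) , λ i → begin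
    φ i + ψ i  ≤⟨ +-mono-≤ (≤-trans (h i) (^-monoʳ i (m≤m+n e e′)))
                                                  (≤-trans (h′ i) (^-monoʳ i (m≤n+m e′ e))) ⟩
    β i ^ (e + e′) + β i ^ (e + e′)  ≡⟨ cong (β i ^ (e + e′) +_) (+-identityʳ _) ⟨
    2 * β i ^ (e + e′)  ≤⟨ *-monoˡ-≤ (β i ^ (e + e′)) (2≤β i) ⟩
    β i * β i ^ (e + e′)  ∎
    where open ≤-Reasoning

  pb-suc : {φ : A → ℕ} → PolyBounded β φ → PolyBounded β (λ i → suc (φ i))
  pb-suc = pb-+ (pb-const 1)

  pb-^ : {φ : A → ℕ} → PolyBounded β φ → ∀ c → PolyBounded β (λ i → φ i ^ c)
  pb-^ {φ} (e , h) c = e * c , λ i →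
    ≤-trans (^-monoˡ-≤ c (h i)) (≤-reflexive (^-*-assoc (β i) e c))

  pb-∘ : {φ : Tree → ℕ} → PolyBounded (suc ∘ size) φ →
         {y : A → Tree} → PolyBounded β (size ∘ y) → PolyBounded β (φ ∘ y)
  pb-∘ (e , h) {y} p = pb-≤ (λ i → h (y i)) (pb-^ (pb-suc p) e)

-- The size of the value is bounded too, since in a composition the time of the outer function is
-- measured in the size of the inner value.
record PolyTime (f : Tree → Tree) : Set where
  field
    code      : Code
    computes  : ∀ x → ⟦ code ⟧ x ≡ f x
    timeBound : PolyBounded (suc ∘ size) (time code)
    sizeBound : PolyBounded (suc ∘ size) (size ∘ f)

open PolyTime

2≤1+size : ∀ x → 2 ≤ suc (size x)
2≤1+size x = s≤s (1≤size x)

open PolyBounds 2≤1+size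

eqᵗ-size : ∀ x y → size (eqᵗ x y) ≤ 3
eqᵗ-size nil          nil          = ≤-refl
eqᵗ-size nil          (cons _ _)   = s≤s z≤n
eqᵗ-size (cons _ _)   nil          = s≤s z≤n
eqᵗ-size (cons x₁ x₂) (cons y₁ y₂) with eqᵗ x₁ y₁
... | nil      = s≤s z≤n
... | cons _ _ = eqᵗ-size x₂ y₂

-- The comparison descends both trees in parallel and stops at a difference, so the left argument
-- alone bounds it.
eqTime-bound : ∀ x y → eqTime x y ≤ 20 * size x
eqTime-bound nil nil        = m≤m+n 9 11
eqTime-bound nil (cons _ _) = m≤m+n 7 13
eqTime-bound (cons x₁ x₂) nil =
  ≤-trans (m≤m+n 7 13) (≤-trans (m≤m+n 20 _) (≤-reflexive (sym (*-suc 20 (size x₁ + size x₂)))))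
eqTime-bound (cons x₁ x₂) (cons y₁ y₂) with eqᵗ x₁ y₁
... | nil = begin
  11 + (eqTime x₁ y₁ + 1)  ≤⟨ +-mono-≤ (m≤m+n 11 8) (+-monoˡ-≤ 1 (eqTime-bound x₁ y₁)) ⟩
  19 + (20 * size x₁ + 1)  ≡⟨ cong (19 +_) (+-comm _ 1) ⟩
  20 + 20 * size x₁  ≤⟨ +-monoʳ-≤ 20 (*-monoʳ-≤ 20 (m≤m+n (size x₁) (size x₂))) ⟩
  20 + 20 * (size x₁ + size x₂)  ≡⟨ *-suc 20 _ ⟨
  20 * suc (size x₁ + size x₂)  ∎
  where open ≤-Reasoning
... | cons _ _ = begin
  11 + (eqTime x₁ y₁ + (4 + eqTime x₂ y₂))  ≤⟨ +-monoʳ-≤ 11 (+-mono-≤ (eqTime-bound x₁ y₁)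
                                                 (+-mono-≤ (m≤m+n 4 5) (eqTime-bound x₂ y₂))) ⟩
  11 + (20 * size x₁ + (9 + 20 * size x₂))  ≡⟨ cong (11 +_) (+-comm (20 * size x₁) _) ⟩
  20 + (20 * size x₂ + 20 * size x₁)  ≡⟨ cong (20 +_) (+-comm (20 * size x₂) _) ⟩
  20 + (20 * size x₁ + 20 * size x₂)  ≡⟨ cong (20 +_) (*-distribˡ-+ 20 (size x₁) _) ⟨
  20 + 20 * (size x₁ + size x₂)  ≡⟨ *-suc 20 _ ⟨
  20 * suc (size x₁ + size x₂)  ∎
  where open ≤-Reasoning

hd-size : ∀ x → size (hd x) ≤ size x
hd-size nil        = ≤-refl
hd-size (cons x y) = m≤n⇒m≤1+n (m≤m+n (size x) (size y))

tl-size : ∀ x → size (tl x) ≤ size x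
tl-size nil        = ≤-refl
tl-size (cons x y) = m≤n⇒m≤1+n (m≤n+m (size y) (size x))

ifᵗ-size : ∀ x y z → size (ifᵗ x y z) ≤ size y + size z
ifᵗ-size nil        y z = m≤n+m _ _
ifᵗ-size (cons _ _) y z = m≤m+n _ _

branch-≤ : ∀ x m n → branch x m n ≤ m + n
branch-≤ nil        m n = m≤n+m _ _
branch-≤ (cons _ _) m n = m≤m+n _ _

private
  pb-size : PolyBounded (suc ∘ size) size
  pb-size = pb-≤ (λ x → n≤1+n (size x)) pb-base

idP : PolyTime (λ x → x)
idP = record { code = idC ; computes = λ _ → refl ; timeBound = pb-const 1 ; sizeBound = pb-size }

nilP : PolyTime (λ _ → nil)
nilP = record { code = nilC ; computes = λ _ → refl ; timeBound = pb-const 1 ; sizeBound = pb-const 1 }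

consP : ∀ {f g} → PolyTime f → PolyTime g → PolyTime (λ x → cons (f x) (g x))
consP p q = record
  { code      = consC (code p) (code q)
  ; computes  = λ x → cong₂ cons (computes p x) (computes q x)
  ; timeBound = pb-suc (pb-+ (timeBound p) (timeBound q))
  ; sizeBound = pb-suc (pb-+ (sizeBound p) (sizeBound q))
  }

compP : ∀ {f g} → PolyTime f → PolyTime g → PolyTime (λ x → f (g x))
compP {f} {g} p q = record
  { code      = code p ∘C code q
  ; computes  = λ x → trans (cong ⟦ code p ⟧ (computes q x)) (computes p (g x))
  ; timeBound = pb-≤ (λ x → s≤s (+-monoʳ-≤ _ (≤-reflexive (cong (time (code p)) (computes q x)))))
                     (pb-suc (pb-+ (timeBound q) (pb-∘ (timeBound p) (sizeBound q))))
  ; sizeBound = pb-∘ (sizeBound p) (sizeBound q)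
  }

hdP : ∀ {f} → PolyTime f → PolyTime (λ x → hd (f x))
hdP p = compP (record { code = headC ; computes = λ _ → refl ; timeBound = pb-const 3
                      ; sizeBound = pb-≤ hd-size pb-size }) p

tlP : ∀ {f} → PolyTime f → PolyTime (λ x → tl (f x))
tlP p = compP (record { code = tailC ; computes = λ _ → refl ; timeBound = pb-const 3
                      ; sizeBound = pb-≤ tl-size pb-size }) p

eqP : ∀ {f g} → PolyTime f → PolyTime g → PolyTime (λ x → eqᵗ (f x) (g x))
eqP {f} {g} p q = record
  { code      = eqC (code p) (code q)
  ; computes  = λ x → cong₂ eqᵗ (computes p x) (computes q x)
  ; timeBound = pb-≤ (λ x → s≤s (s≤s (+-monoʳ-≤ _ (≤-trans (eqTime-bound (⟦ code p ⟧ x) (⟦ code q ⟧ x))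
                       (≤-reflexive (cong (λ y → 20 * size y) (computes p x)))))))
                     (pb-suc (pb-suc (pb-+ (pb-+ (timeBound p) (timeBound q))
                       (pb-* (pb-const 20) (sizeBound p)))))
  ; sizeBound = pb-≤ (λ x → eqᵗ-size (f x) (g x)) (pb-const 3)
  }

ifP : ∀ {f g h} → PolyTime f → PolyTime g → PolyTime h → PolyTime (λ x → ifᵗ (f x) (g x) (h x))
ifP {f} {g} {h} p q r = record
  { code      = ifC (code p) (code q) (code r)
  ; computes  = λ x → trans (cong (λ y → ifᵗ y _ _) (computes p x))
                            (cong₂ (ifᵗ (f x)) (computes q x) (computes r x))
  ; timeBound = pb-≤ (λ x → s≤s (+-monoʳ-≤ _ (branch-≤ (⟦ code p ⟧ x) _ _)))
                     (pb-suc (pb-+ (timeBound p) (pb-+ (pb-+ (pb-const 2) (timeBound q)) (timeBound r))))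
  ; sizeBound = pb-≤ (λ x → ifᵗ-size (f x) _ _) (pb-+ (sizeBound q) (sizeBound r))
  }

letP : ∀ {f g} → PolyTime f → PolyTime g → PolyTime (λ x → g (cons (f x) x))
letP p q = compP q (consP p idP)

module _ {s s′ : Tree → Tree → Tree → Tree} (s≗s′ : ∀ h t a → s h t a ≡ s′ h t a) where

  para-cong : ∀ b l → para s b l ≡ para s′ b l
  para-cong b nil        = refl
  para-cong b (cons h t) = trans (cong (s h t) (para-cong b t)) (s≗s′ h t _)

paraTime-bound : ∀ {s ts b tb L S T} →
  (∀ l → size l ≤ L → size (para s b l) ≤ S) →
  (∀ h t a → size h ≤ L → size t ≤ L → size a ≤ S → ts h t a ≤ T) →
  ∀ l → size l ≤ L → paraTime s ts b tb l ≤ (6 + tb) + size l * (15 + T)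
paraTime-bound hS hT nil _ = m≤m+n _ _
paraTime-bound {s} {ts} {b} {tb} {T = T} hS hT (cons h t) l≤ = begin
  14 + ((paraTime s ts b tb t + 1) + ts h t (para s b t))
    ≤⟨ +-monoʳ-≤ 14 (+-mono-≤ (+-monoˡ-≤ 1 (paraTime-bound {s} {ts} hS hT t t≤))
                              (hT h t _ h≤ t≤ (hS t t≤))) ⟩
  14 + (((6 + tb) + size t * (15 + T) + 1) + T)
    ≡⟨ rearrange (6 + tb) (size t * (15 + T)) T ⟩
  (6 + tb) + (15 + T + size t * (15 + T))
    ≤⟨ +-monoʳ-≤ (6 + tb) (*-monoˡ-≤ (15 + T) (s≤s (m≤n+m (size t) (size h)))) ⟩
  (6 + tb) + size (cons h t) * (15 + T) ∎
  where
  open ≤-Reasoning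
  h≤ = ≤-trans (hd-size (cons h t)) l≤
  t≤ = ≤-trans (tl-size (cons h t)) l≤
  rearrange : ∀ a b T → 14 + ((a + b + 1) + T) ≡ a + (15 + T + b)
  rearrange = solve 3 (λ a b T → con 14 :+ ((a :+ b :+ con 1) :+ T) := a :+ (con 15 :+ T :+ b)) refl
    where open import Data.Nat.Solver using (module +-*-Solver)
          open +-*-Solver

step : (Tree → Tree) → Tree → Tree → Tree → Tree → Tree
step s x h t a = s (cons h (cons t (cons a x)))

module _ {l b s : Tree → Tree} (L : PolyTime l) (I : PolyTime b) (N : PolyTime s) where

  paraCode : Code
  paraCode = paraC (code L) (code I) (code N)

  paraCode-computes : ∀ x → ⟦ paraCode ⟧ x ≡ para (step s x) (b x) (l x)
  paraCode-computes x =
    trans (para-cong (λ h t a → computes N (cons h (cons t (cons a x)))) (⟦ code I ⟧ x) (⟦ code L ⟧ x))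
          (cong₂ (para (step s x)) (computes I x) (computes L x))

  -- The family of inputs and the base are arbitrary because `toUnary` and `allWords` have
  -- exponentially large values: they are bounded only on the inputs that come from an instance,
  -- with the number of guesses in the base.
  paraCode-timeBound : {A : Set} {β : A → ℕ} (2≤β : ∀ i → 2 ≤ β i) {y : A → Tree} →
    PolyBounded β (size ∘ y) → {S : A → ℕ} → PolyBounded β S →
    (∀ i l′ → size l′ ≤ size (l (y i)) → size (para (step s (y i)) (b (y i)) l′) ≤ S i) →
    PolyBounded β (λ i → time paraCode (y i))
  paraCode-timeBound 2≤β {y} yB {S} SB hS =
    PB.pb-≤ (λ i → s≤s (+-monoʳ-≤ _ (paraTime-bound
        -- The time bound of a step on `cons h (cons t (cons a x))` at the largest admissible `h`,
        -- `t` and `a`.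
        {T = suc (suc (size (⟦ code L ⟧ (y i)) + suc (size (⟦ code L ⟧ (y i)) + suc (S i + size (y i))))) ^ proj₁ (timeBound N)}
        (λ l′ l≤ → ≤-trans (≤-reflexive (cong size
            (trans (para-cong (λ h t a → computes N (cons h (cons t (cons a (y i))))) (⟦ code I ⟧ (y i)) l′)
                   (cong (λ z → para (step s (y i)) z l′) (computes I (y i))))))
          (hS i l′ (≤-trans l≤ (≤-reflexive (cong size (computes L (y i)))))))
        (λ h t a h≤ t≤ a≤ → ≤-trans (proj₂ (timeBound N) _)
          (^-monoˡ-≤ (proj₁ (timeBound N))
            (s≤s (s≤s (+-mono-≤ h≤ (s≤s (+-mono-≤ t≤ (s≤s (+-monoˡ-≤ _ a≤)))))))))
        (⟦ code L ⟧ (y i)) ≤-refl)))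
      (PB.pb-suc (PB.pb-+ (PB.pb-suc (PB.pb-+ (PB.pb-∘ (timeBound L) yB) (PB.pb-const 1)))
        (PB.pb-+ (PB.pb-+ (PB.pb-const 6) (PB.pb-∘ (timeBound I) yB))
                 (PB.pb-* lB (PB.pb-+ (PB.pb-const 15)
                   (PB.pb-^ (PB.pb-suc (PB.pb-suc (PB.pb-+ lB (PB.pb-suc (PB.pb-+ lB (PB.pb-suc
                     (PB.pb-+ SB yB))))))) (proj₁ (timeBound N))))))))
    where
    module PB = PolyBounds 2≤β
    lB : PolyBounded _ (λ i → size (⟦ code L ⟧ (y i)))
    lB = PB.pb-≤ (λ i → ≤-reflexive (cong size (computes L (y i)))) (PB.pb-∘ (sizeBound L) yB)

  paraP : {S : Tree → ℕ} → PolyBounded (suc ∘ size) S →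
    (∀ x l′ → size l′ ≤ size (l x) → size (para (step s x) (b x) l′) ≤ S x) →
    PolyTime (λ x → para (step s x) (b x) (l x))
  paraP SB hS = record
    { code      = paraCode
    ; computes  = paraCode-computes
    ; timeBound = paraCode-timeBound 2≤1+size pb-size SB hS
    ; sizeBound = pb-≤ (λ x → hS x (l x) ≤-refl) SB
    }

  -- A fold may double its accumulator in every step. If a step adds an amount that depends on `h`,
  -- `t` and `x` but not on the accumulator, then the total is at most the size of the list times
  -- the largest such amount, which is polynomial.
  additiveP : {q : Tree → ℕ} → PolyBounded (suc ∘ size) q →
    (∀ x h t a → size (step s x h t a) ≤ size a + q (cons h (cons t x))) →
    PolyTime (λ x → para (step s x) (b x) (l x))
  additiveP {q} (e , qB) hq = paraP
    {S = λ x → size (b x) + size (l x) * Q x}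
    (pb-+ (sizeBound I) (pb-* (sizeBound L)
      (pb-^ (pb-suc (pb-suc (pb-+ (sizeBound L) (pb-suc (pb-+ (sizeBound L) pb-size))))) e)))
    (λ x l′ l≤ → ≤-trans (go x l′ l≤) (+-monoʳ-≤ (size (b x)) (*-monoˡ-≤ (Q x) l≤)))
    where
    Q : Tree → ℕ
    Q x = suc (suc (size (l x) + suc (size (l x) + size x))) ^ e
    go : ∀ x l′ → size l′ ≤ size (l x) →
         size (para (step s x) (b x) l′) ≤ size (b x) + size l′ * Q x
    go x nil        _  = m≤m+n _ _
    go x (cons h t) l≤ = begin
      size (step s x h t (para (step s x) (b x) t))
        ≤⟨ hq x h t _ ⟩
      size (para (step s x) (b x) t) + q (cons h (cons t x))
        ≤⟨ +-mono-≤ (go x t t≤) (≤-trans (qB _) (^-monoˡ-≤ e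
             (s≤s (s≤s (+-mono-≤ h≤ (s≤s (+-monoˡ-≤ _ t≤))))))) ⟩
      size (b x) + size t * Q x + Q x
        ≡⟨ +-assoc (size (b x)) _ _ ⟩
      size (b x) + (size t * Q x + Q x)
        ≡⟨ cong (size (b x) +_) (+-comm (size t * Q x) (Q x)) ⟩
      size (b x) + suc (size t) * Q x
        ≤⟨ +-monoʳ-≤ (size (b x)) (*-monoˡ-≤ (Q x) (s≤s (m≤n+m (size t) (size h)))) ⟩
      size (b x) + size (cons h t) * Q x ∎
      where
      open ≤-Reasoning
      h≤ = ≤-trans (hd-size (cons h t)) l≤
      t≤ = ≤-trans (tl-size (cons h t)) l≤

-- Access to arguments, and list operations

arg0 : PolyTime hd
arg0 = hdP idP

arg1 : PolyTime (λ x → hd (tl x))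
arg1 = hdP (tlP idP)

arg2 : PolyTime (λ x → hd (tl (tl x)))
arg2 = hdP (tlP (tlP idP))

arg3 : PolyTime (λ x → hd (tl (tl (tl x))))
arg3 = hdP (tlP (tlP (tlP idP)))

arg4 : PolyTime (λ x → hd (tl (tl (tl (tl x)))))
arg4 = hdP (tlP (tlP (tlP (tlP idP))))

arg5 : PolyTime (λ x → hd (tl (tl (tl (tl (tl x))))))
arg5 = hdP (tlP (tlP (tlP (tlP (tlP idP)))))

ttP : PolyTime (λ _ → tt)
ttP = consP nilP nilP

append : Tree → Tree → Tree
append l m = para (λ h _ a → cons h a) m l

mapT : (Tree → Tree → Tree) → Tree → Tree
mapT F l = para (λ h t a → cons (F h t) a) nil l

filterT : (Tree → Tree) → Tree → Tree
filterT F l = para (λ h _ a → ifᵗ (F h) (cons h a) a) nil l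

concatMapT : (Tree → Tree → Tree) → Tree → Tree
concatMapT F l = para (λ h t a → append (F h t) a) nil l

firstT : (Tree → Tree) → Tree → Tree
firstT F l = para (λ h _ a → ifᵗ (F h) (F h) a) nil l

append-size : ∀ l m → size (append l m) ≤ size l + size m
append-size nil        m = n≤1+n _
append-size (cons h t) m = s≤s (≤-trans (+-monoʳ-≤ (size h) (append-size t m))
                                        (≤-reflexive (sym (+-assoc (size h) _ _))))

appendP : ∀ {l m} → PolyTime l → PolyTime m → PolyTime (λ x → append (l x) (m x))
appendP L M = additiveP L M (consP arg0 arg2) {q = λ e → suc (size (hd e))}
  (pb-suc (sizeBound arg0))
  (λ x h t a → ≤-reflexive (trans (cong suc (+-comm (size h) (size a))) (sym (+-suc (size a) (size h)))))

private
  dropAcc : ∀ {F} → PolyTime F → PolyTime (λ e → F (cons (hd e) (cons (hd (tl e)) (tl (tl (tl e))))))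
  dropAcc p = compP p (consP arg0 (consP arg1 (tlP (tlP (tlP idP)))))

mapP : ∀ {F l} → PolyTime F → PolyTime l → PolyTime (λ x → mapT (λ h t → F (cons h (cons t x))) (l x))
mapP {F} p L = additiveP L nilP (consP (dropAcc p) arg2)
  (pb-suc (sizeBound p))
  (λ x h t a → ≤-reflexive (trans (cong suc (+-comm (size (F (cons h (cons t x)))) (size a)))
                                  (sym (+-suc (size a) _))))

filterP : ∀ {F l} → PolyTime F → PolyTime l → PolyTime (λ x → filterT (λ h → F (cons h x)) (l x))
filterP {F} p L = additiveP L nilP
  (ifP (compP p (consP arg0 (tlP (tlP (tlP idP))))) (consP arg0 arg2) arg2) {q = λ e → suc (size (hd e))}
  (pb-suc (sizeBound arg0))
  bound
  where
  bound : ∀ x h t a → size (ifᵗ (F (cons h x)) (cons h a) a) ≤ size a + suc (size h)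
  bound x h t a with F (cons h x)
  ... | nil      = m≤m+n _ _
  ... | cons _ _ = ≤-reflexive (trans (cong suc (+-comm (size h) (size a))) (sym (+-suc (size a) (size h))))

concatMapP : ∀ {F l} → PolyTime F → PolyTime l →
             PolyTime (λ x → concatMapT (λ h t → F (cons h (cons t x))) (l x))
concatMapP {F} p L = additiveP L nilP (appendP (dropAcc p) arg2) (sizeBound p)
  (λ x h t a → ≤-trans (append-size (F (cons h (cons t x))) a)
                       (≤-reflexive (+-comm (size (F (cons h (cons t x)))) (size a))))

firstP : ∀ {F l} → PolyTime F → PolyTime l → PolyTime (λ x → firstT (λ h → F (cons h x)) (l x))
firstP {F} p L = additiveP L nilP
  -- The value of `F` is computed once and put in front, so the accumulator becomes argument 3.
  (letP (compP p (consP arg0 (tlP (tlP (tlP idP))))) (ifP arg0 arg0 arg3))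
  {q = λ e → size (F (cons (hd e) (tl (tl e))))}
  (sizeBound (compP p (consP arg0 (tlP (tlP idP)))))
  (λ x h t a → ≤-trans (ifᵗ-size (F (cons h x)) _ a) (≤-reflexive (+-comm (size (F (cons h x))) (size a))))

call2 : ∀ {f g h} → PolyTime f → PolyTime g → PolyTime h → PolyTime (λ x → f (cons (g x) (cons (h x) nil)))
call2 f p q = compP f (consP p (consP q nilP))

call3 : ∀ {f g h k} → PolyTime f → PolyTime g → PolyTime h → PolyTime k →
        PolyTime (λ x → f (cons (g x) (cons (h x) (cons (k x) nil))))
call3 f p q r = compP f (consP p (consP q (consP r nilP)))

call4 : ∀ {f g h k m} → PolyTime f → PolyTime g → PolyTime h → PolyTime k → PolyTime m →
        PolyTime (λ x → f (cons (g x) (cons (h x) (cons (k x) (cons (m x) nil)))))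
call4 f p q r s = compP f (consP p (consP q (consP r (consP s nilP))))

-- The search for an augmenting path

memb : Tree → Tree → Tree
memb x l = firstT (λ h → eqᵗ x h) l

membP : PolyTime (λ e → memb (hd e) (hd (tl e)))
membP = firstP (eqP arg1 arg0) arg1

membIn : Tree → Tree → Tree
membIn x ls = firstT (λ l → memb x l) ls

membInP : PolyTime (λ e → membIn (hd e) (hd (tl e)))
membInP = firstP (call2 membP arg1 arg0) arg1

-- Arcs are pairs (source, target).  An entry (z, Q, Ps) of the search consists
-- of the vertex z that it visits, a path Q from the source to z and complete
-- paths Ps.  Paths are the lists of their deletable arcs, last arc first.
visited : Tree → Tree → Tree
visited w V = firstT (λ e → eqᵗ w (hd e)) V

visitedP : PolyTime (λ e → visited (hd e) (hd (tl e)))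
visitedP = firstP (eqP arg1 (hdP arg0)) arg1

-- A deletable arc has capacity one, so it is refused when a complete path of the entry uses it. An
-- undeletable arc leaves no trace in the partial path.
arcMove : Tree → Tree → Tree → Tree → Tree
arcMove V toks e a =
  ifᵗ (eqᵗ (hd a) (hd e))
    (ifᵗ (visited (tl a) V) nil
      (ifᵗ (membIn a toks)
        (ifᵗ (membIn a (tl (tl e))) nil
          (cons (cons (tl a) (cons (cons a (hd (tl e))) (tl (tl e)))) nil))
        (cons (cons (tl a) (tl e)) nil)))
    nil

arcMoveP : PolyTime (λ x → arcMove (hd x) (hd (tl x)) (hd (tl (tl x))) (hd (tl (tl (tl x)))))
arcMoveP =
  ifP (eqP (hdP arg3) (hdP arg2))
    (ifP (call2 visitedP (tlP arg3) arg0) nilP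
      (ifP (call2 membInP arg3 arg1)
        (ifP (call2 membInP arg3 (tlP (tlP arg2))) nilP
          (consP (consP (tlP arg3) (consP (consP arg3 (hdP (tlP arg2))) (tlP (tlP arg2)))) nilP))
        (consP (consP (tlP arg3) (tlP arg2)) nilP)))
    nilP

touches : Tree → Tree → Tree
touches z x = ifᵗ (eqᵗ (hd x) z) tt (eqᵗ (tl x) z)

-- `P` is the part of the path before `x`. From either end of `x` a walk in the residual graph can
-- go back along the path to the target of the preceding arc; there must be such an arc, and its
-- target must be new.
canReroute : Tree → Tree → Tree → Tree → Tree
canReroute z V x P = ifᵗ P (ifᵗ (touches z x) (ifᵗ (visited (tl (hd P)) V) nil tt) nil) nil

-- In the two searches below, the result is a pair whose first component is the
-- list with one place replaced.
orSkip : Tree → Tree → Tree → Tree → Tree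
orSkip c y x r = ifᵗ c y (ifᵗ r (cons (cons x (hd r)) (tl r)) nil)

orSkip-size : ∀ c y x r → size (orSkip c y x r) ≤ size r + (size y + suc (size x))
orSkip-size (cons _ _) y x r = ≤-trans (m≤m+n _ _) (m≤n+m _ (size r))
orSkip-size nil y x nil = s≤s z≤n
orSkip-size nil y x (cons p q) = ≤-trans (≤-reflexive eq) (+-monoʳ-≤ (size (cons p q)) (m≤n+m _ (size y)))
  where
  eq : suc (suc (size x + size p) + size q) ≡ suc (size p + size q) + suc (size x)
  eq = solve 3 (λ x p q → con 1 :+ (con 1 :+ (x :+ p) :+ q) := con 1 :+ (p :+ q) :+ (con 1 :+ x))
         refl (size x) (size p) (size q)
    where open import Data.Nat.Solver using (module +-*-Solver)
          open +-*-Solver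

-- If `z` is the start of `x`, then `Q` continues with `x` and the rest of the path. If `z` is the
-- target of `x`, then `x` itself is dropped, as opposite flows on it cancel. The abandoned
-- beginning `P₁` becomes the new partial path.
reroute : Tree → Tree → Tree → Tree → Tree
reroute z Q V P =
  para (λ x P₁ r → orSkip (canReroute z V x P₁) (cons (ifᵗ (eqᵗ (hd x) z) (cons x Q) Q) P₁) x r) nil P

rerouteP : PolyTime (λ e → reroute (hd e) (hd (tl e)) (hd (tl (tl e))) (hd (tl (tl (tl e)))))
rerouteP = additiveP arg3 nilP
  (ifP (ifP arg1 (ifP (ifP (eqP (hdP arg0) arg3) ttP (eqP (tlP arg0) arg3))
                      (ifP (call2 visitedP (tlP (hdP arg1)) arg5) nilP ttP) nilP) nilP)
       (consP (ifP (eqP (hdP arg0) arg3) (consP arg0 arg4) arg4) arg1)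
       (ifP arg2 (consP (consP arg0 (hdP arg2)) (tlP arg2)) nilP))
  (pb-+ (sizeBound (consP (ifP (eqP (hdP arg0) arg2) (consP arg0 arg3) arg3) arg1))
        (pb-suc (sizeBound arg0)))
  (λ e h t a → orSkip-size (canReroute (hd e) (hd (tl (tl e))) h t) _ h a)

rerouteSome : Tree → Tree → Tree → Tree → Tree
rerouteSome z Q V Ps =
  para (λ P Os r → orSkip (reroute z Q V P)
                          (cons (cons (hd (reroute z Q V P)) Os) (tl (reroute z Q V P))) P r) nil Ps

rerouteSomeP : PolyTime (λ e → rerouteSome (hd e) (hd (tl e)) (hd (tl (tl e))) (hd (tl (tl (tl e)))))
rerouteSomeP = additiveP arg3 nilP
  (ifP r (consP (consP (hdP r) arg1) (tlP r))
       (ifP arg2 (consP (consP arg0 (hdP arg2)) (tlP arg2)) nilP))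
  (pb-+ (sizeBound (consP (consP (hdP r′) arg1) (tlP r′))) (pb-suc (sizeBound arg0)))
  (λ e h t a → orSkip-size (reroute (hd e) (hd (tl e)) (hd (tl (tl e))) h) _ h a)
  where
  r  = call4 rerouteP arg3 arg4 arg5 arg0
  r′ = call4 rerouteP arg2 arg3 arg4 arg0

-- All targets on the abandoned beginning are visited at once, each with the matching shorter
-- beginning as its partial path.
prefixEntries : Tree → Tree → Tree
prefixEntries Ps B = mapT (λ b B₁ → cons (tl b) (cons (cons b B₁) Ps)) B

prefixEntriesP : PolyTime (λ e → prefixEntries (hd e) (hd (tl e)))
prefixEntriesP = mapP (consP (tlP arg0) (consP (consP arg0 arg1) arg2)) arg1

pathMoves : Tree → Tree → Tree
pathMoves V e = ifᵗ r (prefixEntries (hd r) (tl r)) nil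
  where r = rerouteSome (hd e) (hd (tl e)) V (tl (tl e))

pathMovesP : PolyTime (λ x → pathMoves (hd x) (hd (tl x)))
pathMovesP = ifP r (call2 prefixEntriesP (hdP r) (tlP r)) nilP
  where r = call4 rerouteSomeP (hdP arg1) (hdP (tlP arg1)) arg0 (tlP (tlP arg1))

entryMoves : Tree → Tree → Tree → Tree → Tree
entryMoves arcs toks V e =
  ifᵗ (pathMoves V e) (pathMoves V e) (firstT (λ a → arcMove V toks e a) arcs)

entryMovesP : PolyTime (λ x → entryMoves (hd x) (hd (tl x)) (hd (tl (tl x))) (hd (tl (tl (tl x)))))
entryMovesP = ifP (call2 pathMovesP arg2 arg3) (call2 pathMovesP arg2 arg3)
  (firstP (call4 arcMoveP arg3 arg2 arg4 arg0) arg0)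

moves : Tree → Tree → Tree → Tree
moves arcs toks V = firstT (λ e → entryMoves arcs toks V e) V

expand : Tree → Tree → Tree → Tree
expand arcs toks V = append (moves arcs toks V) V

expandP : PolyTime (λ x → expand (hd x) (hd (tl x)) (hd (tl (tl x))))
expandP = appendP (firstP (call4 entryMovesP arg1 arg2 arg3 arg0) arg2) arg2

source : Tree
source = cons nil tt

initial : Tree → Tree
initial Ps = cons (cons source (cons nil Ps)) nil

search : Tree → Tree → Tree → Tree → Tree
search arcs toks Ps l = para (λ _ _ V → expand arcs toks V) (initial Ps) l

-- There are as many steps as arcs, which suffices since every step visits a
-- new target of an arc.
explore : Tree → Tree → Tree → Tree
explore arcs toks Ps = search arcs toks Ps arcs

-- Membership, equality tests, and rerouting as a relation

infix 4 _∈ₜ_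
data _∈ₜ_ (x : Tree) : Tree → Set where
  here  : ∀ {l} → x ∈ₜ cons x l
  there : ∀ {y l} → x ∈ₜ l → x ∈ₜ cons y l

∈-append⁻ : ∀ {x} l {m} → x ∈ₜ append l m → x ∈ₜ l ⊎ x ∈ₜ m
∈-append⁻ nil        p         = inj₂ p
∈-append⁻ (cons h t) here      = inj₁ here
∈-append⁻ (cons h t) (there p) with ∈-append⁻ t p
... | inj₁ q = inj₁ (there q)
... | inj₂ q = inj₂ q

∈-append⁺ˡ : ∀ {x l m} → x ∈ₜ l → x ∈ₜ append l m
∈-append⁺ˡ here      = here
∈-append⁺ˡ (there p) = there (∈-append⁺ˡ p)

∈-append⁺ʳ : ∀ {x} l {m} → x ∈ₜ m → x ∈ₜ append l m
∈-append⁺ʳ nil        p = p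
∈-append⁺ʳ (cons h t) p = there (∈-append⁺ʳ t p)

∈-size : ∀ {x l} → x ∈ₜ l → size x ≤ size l
∈-size {x} (here {l})  = m≤n⇒m≤1+n (m≤m+n (size x) (size l))
∈-size (there {y} {l} p) = m≤n⇒m≤1+n (≤-trans (∈-size p) (m≤n+m (size l) (size y)))

firstT-cons : ∀ F l {p q} → firstT F l ≡ cons p q → ∃[ h ] h ∈ₜ l × F h ≡ cons p q
firstT-cons F (cons h t) eq with F h in eq′
... | cons _ _ = h , here , trans eq′ eq
... | nil with firstT-cons F t eq
...   | h′ , h′∈t , eq″ = h′ , there h′∈t , eq″

firstT-nil : ∀ F l → firstT F l ≡ nil → ∀ {h} → h ∈ₜ l → F h ≡ nil
firstT-nil F (cons h t) eq p with F h in eq′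
firstT-nil F (cons h t) eq here      | nil = eq′
firstT-nil F (cons h t) eq (there p) | nil = firstT-nil F t eq p

eqᵗ-refl : ∀ x → eqᵗ x x ≡ tt
eqᵗ-refl nil = refl
eqᵗ-refl (cons x y) rewrite eqᵗ-refl x = eqᵗ-refl y

eqᵗ-sound : ∀ x y {p q} → eqᵗ x y ≡ cons p q → x ≡ y
eqᵗ-sound nil nil _ = refl
eqᵗ-sound (cons x₁ x₂) (cons y₁ y₂) eq with eqᵗ x₁ y₁ in eq₁
... | cons _ _ = cong₂ cons (eqᵗ-sound x₁ y₁ eq₁) (eqᵗ-sound x₂ y₂ eq)

eqᵗ-complete : ∀ {x y} → eqᵗ x y ≡ nil → x ≢ y
eqᵗ-complete {x} eq refl with trans (sym eq) (eqᵗ-refl x)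
... | ()

Visits : Tree → Tree → Set
Visits V w = ∃[ e ] e ∈ₜ V × w ≡ hd e

visited-sound : ∀ w V {p q} → visited w V ≡ cons p q → Visits V w
visited-sound w V eq with firstT-cons (λ e → eqᵗ w (hd e)) V eq
... | e , e∈V , eq′ = e , e∈V , eqᵗ-sound w (hd e) eq′

visited-complete : ∀ {w V} → visited w V ≡ nil → ¬ Visits V w
visited-complete {w} {V} eq (e , e∈V , refl) = eqᵗ-complete {hd e} (firstT-nil (λ e → eqᵗ w (hd e)) V eq e∈V) refl

data Reroute (z Q V : Tree) : Tree → Tree → Tree → Set where
  leave : ∀ {x y B} → hd x ≡ z → ¬ Visits V (tl y) → Reroute z Q V (cons x (cons y B)) (cons x Q) (cons y B)
  enter : ∀ {x y B} → tl x ≡ z → ¬ Visits V (tl y) → Reroute z Q V (cons x (cons y B)) Q (cons y B)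
  skip  : ∀ {x P P′ B} → Reroute z Q V P P′ B → Reroute z Q V (cons x P) (cons x P′) B

data RerouteSome (z Q V : Tree) : Tree → Tree → Tree → Set where
  here  : ∀ {P P′ B Os} → Reroute z Q V P P′ B → RerouteSome z Q V (cons P Os) (cons P′ Os) B
  there : ∀ {P Os Os′ B} → RerouteSome z Q V Os Os′ B → RerouteSome z Q V (cons P Os) (cons P Os′) B

reroute-sound : ∀ z Q V P {P′ B} → reroute z Q V P ≡ cons P′ B → Reroute z Q V P P′ B
reroute-sound z Q V (cons x nil) ()
reroute-sound z Q V (cons x (cons y B)) eq with eqᵗ (hd x) z in eq₁
... | cons _ _ with visited (tl y) V in eq₂
...   | nil with refl ← eq = leave (eqᵗ-sound (hd x) z eq₁) (visited-complete {tl y} {V} eq₂)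
...   | cons _ _ with reroute z Q V (cons y B) in eq₃
...     | cons _ _ with refl ← eq = skip (reroute-sound z Q V (cons y B) eq₃)
reroute-sound z Q V (cons x (cons y B)) eq | nil with eqᵗ (tl x) z in eq₁′
... | nil with reroute z Q V (cons y B) in eq₃
...     | cons _ _ with refl ← eq = skip (reroute-sound z Q V (cons y B) eq₃)
reroute-sound z Q V (cons x (cons y B)) eq | nil | cons _ _ with visited (tl y) V in eq₂
...   | nil with refl ← eq = enter (eqᵗ-sound (tl x) z eq₁′) (visited-complete {tl y} {V} eq₂)
...   | cons _ _ with reroute z Q V (cons y B) in eq₃
...     | cons _ _ with refl ← eq = skip (reroute-sound z Q V (cons y B) eq₃)

rerouteSome-sound : ∀ z Q V Ps {Ps′ B} → rerouteSome z Q V Ps ≡ cons Ps′ B → RerouteSome z Q V Ps Ps′ B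
rerouteSome-sound z Q V (cons P Os) eq with reroute z Q V P in eq₁
... | cons _ _ with refl ← eq = here (reroute-sound z Q V P eq₁)
... | nil with rerouteSome z Q V Os in eq₂
...   | cons _ _ with refl ← eq = there (rerouteSome-sound z Q V Os eq₂)

-- Rerouting permutes arcs between the paths, apart from dropping one.
module _ {weight μ ν : Tree → ℕ} {k : ℕ}
         (μ-cons : ∀ x l → μ (cons x l) ≡ weight x + μ l)
         (ν-cons : ∀ P l → ν (cons P l) ≡ (k + μ P) + ν l) where

  open ≤-Reasoning

  reroute-weight : ∀ {z Q V P P′ B} → Reroute z Q V P P′ B → μ P′ + μ B ≤ μ P + μ Q
  reroute-weight {Q = Q} (leave {x} {y} {B} _ _) = begin
    μ (cons x Q) + μ (cons y B)  ≡⟨ cong (_+ μ (cons y B)) (μ-cons x Q) ⟩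
    weight x + μ Q + μ (cons y B)  ≡⟨ +-assoc (weight x) _ _ ⟩
    weight x + (μ Q + μ (cons y B))  ≡⟨ cong (weight x +_) (+-comm (μ Q) _) ⟩
    weight x + (μ (cons y B) + μ Q)  ≡⟨ +-assoc (weight x) _ _ ⟨
    weight x + μ (cons y B) + μ Q  ≡⟨ cong (_+ μ Q) (μ-cons x (cons y B)) ⟨
    μ (cons x (cons y B)) + μ Q  ∎
  reroute-weight {Q = Q} (enter {x} {y} {B} _ _) = begin
    μ Q + μ (cons y B)  ≡⟨ +-comm (μ Q) _ ⟩
    μ (cons y B) + μ Q  ≤⟨ +-monoˡ-≤ (μ Q) (m≤n+m _ (weight x)) ⟩
    weight x + μ (cons y B) + μ Q  ≡⟨ cong (_+ μ Q) (μ-cons x (cons y B)) ⟨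
    μ (cons x (cons y B)) + μ Q  ∎
  reroute-weight {Q = Q} (skip {x} {P} {P′} {B} r) = begin
    μ (cons x P′) + μ B  ≡⟨ cong (_+ μ B) (μ-cons x P′) ⟩
    weight x + μ P′ + μ B  ≡⟨ +-assoc (weight x) _ _ ⟩
    weight x + (μ P′ + μ B)  ≤⟨ +-monoʳ-≤ (weight x) (reroute-weight r) ⟩
    weight x + (μ P + μ Q)  ≡⟨ +-assoc (weight x) _ _ ⟨
    weight x + μ P + μ Q  ≡⟨ cong (_+ μ Q) (μ-cons x P) ⟨
    μ (cons x P) + μ Q  ∎

  rerouteSome-weight : ∀ {z Q V Ps Ps′ B} → RerouteSome z Q V Ps Ps′ B → ν Ps′ + μ B ≤ ν Ps + μ Q
  rerouteSome-weight {Q = Q} (here {P} {P′} {B} {Os} r) = begin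
    ν (cons P′ Os) + μ B  ≡⟨ cong (_+ μ B) (ν-cons P′ Os) ⟩
    k + μ P′ + ν Os + μ B  ≡⟨ swap k (μ P′) (ν Os) (μ B) ⟩
    k + (μ P′ + μ B) + ν Os  ≤⟨ +-monoˡ-≤ (ν Os) (+-monoʳ-≤ k (reroute-weight r)) ⟩
    k + (μ P + μ Q) + ν Os  ≡⟨ swap k (μ P) (ν Os) (μ Q) ⟨
    k + μ P + ν Os + μ Q  ≡⟨ cong (_+ μ Q) (ν-cons P Os) ⟨
    ν (cons P Os) + μ Q  ∎
    where
    swap : ∀ a b c d → a + b + c + d ≡ a + (b + d) + c
    swap = solve 4 (λ a b c d → a :+ b :+ c :+ d := a :+ (b :+ d) :+ c) refl
      where open import Data.Nat.Solver using (module +-*-Solver)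
            open +-*-Solver
  rerouteSome-weight {Q = Q} (there {P} {Os} {Os′} {B} r) = begin
    ν (cons P Os′) + μ B  ≡⟨ cong (_+ μ B) (ν-cons P Os′) ⟩
    k + μ P + ν Os′ + μ B  ≡⟨ +-assoc (k + μ P) _ _ ⟩
    k + μ P + (ν Os′ + μ B)  ≤⟨ +-monoʳ-≤ (k + μ P) (rerouteSome-weight r) ⟩
    k + μ P + (ν Os + μ Q)  ≡⟨ +-assoc (k + μ P) _ _ ⟨
    k + μ P + ν Os + μ Q  ≡⟨ cong (_+ μ Q) (ν-cons P Os) ⟨
    ν (cons P Os) + μ Q  ∎

-- Size bounds for the search

split-size : ∀ x → size (hd x) + size (tl x) ≤ suc (size x)
split-size nil        = ≤-refl
split-size (cons x y) = m≤n⇒m≤1+n (n≤1+n _)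

size-split : ∀ x → size x ≤ suc (size (hd x) + size (tl x))
size-split nil        = s≤s z≤n
size-split (cons x y) = ≤-refl

-- A step of the search adds an amount that depends on the accumulator, so `additiveP` does not
-- apply. Entries are bounded individually instead: a move raises the bound on their components by
-- at most `growth arcs`.
Fits : ℕ → Tree → Set
Fits s e = size (hd e) ≤ s × size (tl e) ≤ s

fits-mono : ∀ {s s′ e} → s ≤ s′ → Fits s e → Fits s′ e
fits-mono s≤s′ (p , q) = ≤-trans p s≤s′ , ≤-trans q s≤s′

-- At most `u` entries, each of size at most `1 + u + u` and with a list cell of its own, and the
-- final `nil`.
entriesBound : ℕ → ℕ
entriesBound u = suc (u * (2 + (u + u)))

prefixEntries-fits : ∀ Ps B {u} → suc (size B + size Ps) ≤ u → ∀ {e} → e ∈ₜ prefixEntries Ps B → Fits u e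
prefixEntries-fits Ps (cons b B) le here =
  ≤-trans (tl-size b) (≤-trans (hd-size (cons b B)) (≤-trans (m≤n⇒m≤1+n (m≤m+n _ (size Ps))) le)) , le
prefixEntries-fits Ps (cons b B) le (there p) =
  prefixEntries-fits Ps B (≤-trans (s≤s (+-monoˡ-≤ (size Ps) (tl-size (cons b B)))) le) p

prefixEntries-size : ∀ Ps B {u} → suc (size B + size Ps) ≤ u →
                     size (prefixEntries Ps B) ≤ suc (size B * (2 + (u + u)))
prefixEntries-size Ps nil _ = s≤s z≤n
prefixEntries-size Ps (cons b B) {u} le = s≤s (begin
  suc (size (tl b) + suc (size (cons b B) + size Ps)) + size (prefixEntries Ps B)
    ≤⟨ +-mono-≤ (s≤s (+-mono-≤ (proj₁ fits) (proj₂ fits)))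
                (prefixEntries-size Ps B (≤-trans (s≤s (+-monoˡ-≤ (size Ps) (tl-size (cons b B)))) le)) ⟩
  suc (u + u) + suc (size B * (2 + (u + u)))
    ≡⟨ +-suc (suc (u + u)) _ ⟩
  suc (size B) * (2 + (u + u))
    ≤⟨ *-monoˡ-≤ (2 + (u + u)) (s≤s (m≤n+m (size B) (size b))) ⟩
  size (cons b B) * (2 + (u + u)) ∎)
  where
  open ≤-Reasoning
  fits = prefixEntries-fits Ps (cons b B) le here

growth : Tree → ℕ
growth arcs = 3 + size arcs

singleton-size : ∀ {u} e → 1 ≤ u → Fits u e → size (cons e nil) ≤ entriesBound u
singleton-size {suc u} e _ (p , q) = s≤s (begin
  size e + 1  ≤⟨ +-monoˡ-≤ 1 (size-split e) ⟩
  suc (size (hd e) + size (tl e)) + 1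
    ≤⟨ +-monoˡ-≤ 1 (s≤s (+-mono-≤ p q)) ⟩
  suc (suc u + suc u) + 1  ≡⟨ +-comm _ 1 ⟩
  2 + (suc u + suc u)  ≤⟨ m≤m+n _ _ ⟩
  suc u * (2 + (suc u + suc u)) ∎)
  where
  open ≤-Reasoning

module _ (arcs toks : Tree) where

  private
    g : ℕ
    g = growth arcs

  arcMove-fits : ∀ {s} V e a → Fits s e → a ∈ₜ arcs →
    (∀ {e′} → e′ ∈ₜ arcMove V toks e a → Fits (s + g) e′) × size (arcMove V toks e a) ≤ entriesBound (s + g)
  arcMove-fits {s} V e a (p , q) a∈ with eqᵗ (hd a) (hd e)
  ... | nil = (λ ()) , s≤s z≤n
  ... | cons _ _ with visited (tl a) V
  ...   | cons _ _ = (λ ()) , s≤s z≤n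
  ...   | nil with membIn a toks
  ...     | nil = (λ { here → fits }) , singleton-size (cons (tl a) (tl e)) (≤-trans (s≤s z≤n) (m≤n+m g s)) fits
    where
    fits : Fits (s + g) (cons (tl a) (tl e))
    fits = ≤-trans (tl-size a) (≤-trans (∈-size a∈) (≤-trans (m≤n+m (size arcs) 3) (m≤n+m g s)))
         , ≤-trans q (m≤m+n s g)
  ...     | cons _ _ with membIn a (tl (tl e))
  ...       | cons _ _ = (λ ()) , s≤s z≤n
  ...       | nil = (λ { here → fits }) ,
                    singleton-size (cons (tl a) (cons (cons a (hd (tl e))) (tl (tl e))))
                      (≤-trans (s≤s z≤n) (m≤n+m g s)) fits
    where
    open ≤-Reasoning
    fits : Fits (s + g) (cons (tl a) (cons (cons a (hd (tl e))) (tl (tl e))))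
    fits = ≤-trans (tl-size a) (≤-trans (∈-size a∈) (≤-trans (m≤n+m (size arcs) 3) (m≤n+m g s)))
         , (begin
      2 + (size a + size (hd (tl e)) + size (tl (tl e)))  ≡⟨ cong (2 +_) (+-assoc (size a) _ _) ⟩
      2 + (size a + (size (hd (tl e)) + size (tl (tl e)))) ≤⟨ +-monoʳ-≤ 2 (+-mono-≤ (∈-size a∈)
                                                              (≤-trans (split-size (tl e)) (s≤s q))) ⟩
      2 + (size arcs + suc s)  ≡⟨ cong (2 +_) (+-suc (size arcs) s) ⟩
      3 + (size arcs + s)  ≡⟨ +-comm g s ⟩
      s + g  ∎)

  pathMoves-fits : ∀ {s} V e → Fits s e →
    (∀ {e′} → e′ ∈ₜ pathMoves V e → Fits (s + g) e′) × size (pathMoves V e) ≤ entriesBound (s + g)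
  pathMoves-fits {s} V e (p , q) with rerouteSome (hd e) (hd (tl e)) V (tl (tl e)) in eq
  ... | nil        = (λ ()) , s≤s z≤n
  ... | cons Ps′ B = (λ {e′} → prefixEntries-fits Ps′ B le {e′}) ,
                     ≤-trans (prefixEntries-size Ps′ B le) (s≤s (*-monoˡ-≤ (2 + ((s + g) + (s + g)))
                       (≤-trans (≤-trans (m≤m+n (size B) (size Ps′)) (n≤1+n _)) le)))
    where
    open ≤-Reasoning
    le : suc (size B + size Ps′) ≤ s + g
    le = begin
      suc (size B + size Ps′)  ≡⟨ cong suc (+-comm (size B) _) ⟩
      suc (size Ps′ + size B)  ≤⟨ s≤s (rerouteSome-weight {suc ∘ size} {size} {size} {1}
                                                        (λ _ _ → refl) (λ _ _ → refl)
                                                        (rerouteSome-sound (hd e) (hd (tl e)) V (tl (tl e)) eq)) ⟩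
      suc (size (tl (tl e)) + size (hd (tl e)))  ≡⟨ cong suc (+-comm (size (tl (tl e))) _) ⟩
      suc (size (hd (tl e)) + size (tl (tl e)))  ≤⟨ s≤s (≤-trans (split-size (tl e)) (s≤s q)) ⟩
      2 + s  ≡⟨ +-comm 2 s ⟩
      s + 2  ≤⟨ +-monoʳ-≤ s (m≤m+n 2 (suc (size arcs))) ⟩
      s + g  ∎

  entryMoves-fits : ∀ {s} V e → Fits s e →
    (∀ {e′} → e′ ∈ₜ entryMoves arcs toks V e → Fits (s + g) e′) ×
    size (entryMoves arcs toks V e) ≤ entriesBound (s + g)
  entryMoves-fits V e fits with pathMoves V e | pathMoves-fits V e fits
  ... | cons _ _ | h = h
  ... | nil      | _ with firstT (λ a → arcMove V toks e a) arcs in eq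
  ...   | nil = (λ ()) , s≤s z≤n
  ...   | cons _ _ with firstT-cons (λ a → arcMove V toks e a) arcs eq
  ...     | a , a∈ , eq′ = subst (λ l → (∀ {e′} → e′ ∈ₜ l → Fits _ e′) × size l ≤ _) eq′
                             (arcMove-fits V e a fits a∈)

  moves-fits : ∀ {s} V → (∀ {e} → e ∈ₜ V → Fits s e) →
    (∀ {e′} → e′ ∈ₜ moves arcs toks V → Fits (s + g) e′) × size (moves arcs toks V) ≤ entriesBound (s + g)
  moves-fits V fits with moves arcs toks V in eq
  ... | nil = (λ ()) , s≤s z≤n
  ... | cons _ _ with firstT-cons (λ e → entryMoves arcs toks V e) V eq
  ...   | e , e∈ , eq′ = subst (λ l → (∀ {e′} → e′ ∈ₜ l → Fits _ e′) × size l ≤ _) eq′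
                           (entryMoves-fits V e (fits e∈))

  -- The 5 is the size of `source`; every step of the search contributes one `g`.
  entrySize : Tree → Tree → ℕ
  entrySize Ps l = 5 + size Ps + size l * g

  entrySize-step : ∀ Ps h t → entrySize Ps t + g ≤ entrySize Ps (cons h t)
  entrySize-step Ps h t = begin
    5 + size Ps + size t * g + g  ≡⟨ +-assoc (5 + size Ps) _ g ⟩
    5 + size Ps + (size t * g + g)  ≡⟨ cong (5 + size Ps +_) (+-comm _ g) ⟩
    5 + size Ps + (g + size t * g)  ≤⟨ +-monoʳ-≤ (5 + size Ps) (*-monoˡ-≤ g (s≤s (m≤n+m (size t) (size h)))) ⟩
    5 + size Ps + size (cons h t) * g ∎
    where open ≤-Reasoning

  search-fits : ∀ Ps l {e} → e ∈ₜ search arcs toks Ps l → Fits (entrySize Ps l) e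
  search-fits Ps nil here =
    ≤-trans (m≤m+n 5 (size Ps)) (m≤m+n _ g′) , ≤-trans (+-monoˡ-≤ (size Ps) (m≤m+n 2 3)) (m≤m+n _ g′)
    where g′ = size nil * g
  search-fits Ps (cons h t) {e} p with ∈-append⁻ (moves arcs toks (search arcs toks Ps t)) p
  ... | inj₁ q = fits-mono {e = e} (entrySize-step Ps h t)
                   (proj₁ (moves-fits _ (λ {e′} → search-fits Ps t {e′})) q)
  ... | inj₂ q = fits-mono {e = e} (≤-trans (m≤m+n _ g) (entrySize-step Ps h t)) (search-fits Ps t q)

  search-size : ∀ Ps L l → size l ≤ size L →
    size (search arcs toks Ps l) ≤ size (initial Ps) + size l * entriesBound (entrySize Ps L)
  search-size Ps L nil        _  = m≤m+n _ _
  search-size Ps L (cons h t) l≤ = begin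
    size (append (moves arcs toks V) V)
      ≤⟨ append-size (moves arcs toks V) V ⟩
    size (moves arcs toks V) + size V
      ≤⟨ +-mono-≤ (≤-trans (proj₂ (moves-fits V (λ {e} → search-fits Ps t {e})))
                           (s≤s (*-mono-≤ u≤ (+-monoʳ-≤ 2 (+-mono-≤ u≤ u≤)))))
                  (search-size Ps L t (≤-trans (tl-size (cons h t)) l≤)) ⟩
    E + (size (initial Ps) + size t * E)
      ≡⟨ +-assoc E _ _ ⟨
    E + size (initial Ps) + size t * E
      ≡⟨ cong (_+ size t * E) (+-comm E _) ⟩
    size (initial Ps) + E + size t * E
      ≡⟨ +-assoc (size (initial Ps)) E _ ⟩
    size (initial Ps) + suc (size t) * E
      ≤⟨ +-monoʳ-≤ (size (initial Ps)) (*-monoˡ-≤ E (s≤s (m≤n+m (size t) (size h)))) ⟩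
    size (initial Ps) + size (cons h t) * E ∎
    where
    open ≤-Reasoning
    V = search arcs toks Ps t
    E = entriesBound (entrySize Ps L)
    u≤ : entrySize Ps t + g ≤ entrySize Ps L
    u≤ = ≤-trans (entrySize-step Ps h t) (+-monoʳ-≤ (5 + size Ps) (*-monoˡ-≤ g l≤))

initialP : ∀ {f} → PolyTime f → PolyTime (λ x → initial (f x))
initialP p = consP (consP (consP nilP ttP) (consP nilP p)) nilP

exploreP : PolyTime (λ x → explore (hd x) (hd (tl x)) (hd (tl (tl x))))
exploreP = paraP arg0 (initialP arg2) (call3 expandP arg3 arg4 arg2)
  {S = λ x → size (initial (hd (tl (tl x)))) +
             size (hd x) * entriesBound (entrySize (hd x) (hd (tl x)) (hd (tl (tl x))) (hd x))}
  (pb-+ (sizeBound (initialP arg2)) (pb-* (sizeBound arg0) (pb-suc (pb-* E (pb-+ (pb-const 2) (pb-+ E E))))))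
  (λ x l l≤ → ≤-trans (search-size (hd x) (hd (tl x)) (hd (tl (tl x))) (hd x) l l≤)
    (+-monoʳ-≤ (size (initial (hd (tl (tl x)))))
               (*-monoˡ-≤ (entriesBound (entrySize (hd x) (hd (tl x)) (hd (tl (tl x))) (hd x))) l≤)))
  where
  E : PolyBounded (suc ∘ size) (λ x → entrySize (hd x) (hd (tl x)) (hd (tl (tl x))) (hd x))
  E = pb-+ (pb-+ (pb-const 5) (sizeBound arg2)) (pb-* (sizeBound arg0) (pb-+ (pb-const 3) (sizeBound arg0)))

-- The vertices with second component nil are the sinks.
sinkEntry : Tree → Tree
sinkEntry V = firstT (λ e → ifᵗ (tl (hd e)) nil e) V

sinkEntryP : ∀ {f} → PolyTime f → PolyTime (λ x → sinkEntry (f x))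
sinkEntryP p = firstP (ifP (tlP (hdP arg0)) nilP arg0) p

-- Rounds of guessing and augmenting

keep : Tree → Tree → Tree → Tree
keep bit P A = filterT (λ x → eqᵗ bit (memb x P)) A

keepP : PolyTime (λ x → keep (hd x) (hd (tl x)) (hd (tl (tl x))))
keepP = filterP (eqP arg1 (call2 membP arg0 arg2)) arg2

-- Restricts every token either to P or to the complement of P, as the next
-- bit of w dictates; the result contains the remaining bits.
refine1 : Tree → Tree → Tree → Tree
refine1 P toks w =
  para (λ A _ r → cons (cons (keep (hd (tl r)) P A) (hd r)) (tl (tl r))) (cons nil w) toks

filterT-size : ∀ F l → size (filterT F l) ≤ size l
filterT-size F nil = ≤-refl
filterT-size F (cons h t) with F h
... | nil      = ≤-trans (filterT-size F t) (tl-size (cons h t))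
... | cons _ _ = s≤s (+-monoʳ-≤ (size h) (filterT-size F t))

refine1-step : ∀ F r → size F + (size (hd r) + size (tl (tl r))) ≤ size F + suc (size r)
refine1-step F r = +-monoʳ-≤ (size F) (≤-trans (+-monoʳ-≤ (size (hd r)) (tl-size (tl r))) (split-size r))

refine1P : PolyTime (λ x → refine1 (hd x) (hd (tl x)) (hd (tl (tl x))))
refine1P = additiveP arg1 (consP nilP arg2)
  (consP (consP (call3 keepP (hdP (tlP arg2)) arg3 arg0) (hdP arg2)) (tlP (tlP arg2)))
  {q = λ e → 3 + size (hd e)} (pb-+ (pb-const 3) (sizeBound arg0))
  (λ x h t a → begin
    2 + (size (keep (hd (tl a)) (hd x) h) + size (hd a) + size (tl (tl a)))
      ≡⟨ cong (2 +_) (+-assoc (size (keep (hd (tl a)) (hd x) h)) _ _) ⟩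
    2 + (size (keep (hd (tl a)) (hd x) h) + (size (hd a) + size (tl (tl a))))
      ≤⟨ +-monoʳ-≤ 2 (≤-trans (refine1-step (keep (hd (tl a)) (hd x) h) a)
           (+-monoˡ-≤ (suc (size a)) (filterT-size _ h))) ⟩
    2 + (size h + suc (size a))
      ≡⟨ cong (2 +_) (trans (+-suc (size h) (size a)) (cong suc (+-comm (size h) (size a)))) ⟩
    3 + (size a + size h)
      ≡⟨ trans (+-suc (size a) _) (cong suc (trans (+-suc (size a) _) (cong suc (+-suc (size a) _)))) ⟨
    size a + (3 + size h) ∎)
  where open ≤-Reasoning

refine1-size : ∀ P toks w → size (hd (refine1 P toks w)) + size (tl (refine1 P toks w)) ≤ size toks + size w
refine1-size P nil w = ≤-refl
refine1-size P (cons A toks) w = s≤s (begin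
  size (keep bit P A) + size (hd r) + size (tl (tl r))  ≡⟨ +-assoc (size (keep bit P A)) _ _ ⟩
  size (keep bit P A) + (size (hd r) + size (tl (tl r)))  ≤⟨ +-mono-≤ (filterT-size _ A)
                                                              (+-monoʳ-≤ (size (hd r)) (tl-size (tl r))) ⟩
  size A + (size (hd r) + size (tl r))  ≤⟨ +-monoʳ-≤ (size A) (refine1-size P toks w) ⟩
  size A + (size toks + size w)  ≡⟨ +-assoc (size A) _ _ ⟨
  size A + size toks + size w  ∎)
  where
  open ≤-Reasoning
  r   = refine1 P toks w
  bit = hd (tl r)

refine : Tree → Tree → Tree → Tree
refine Ps toks w = para (λ P _ r → refine1 P (hd r) (tl r)) (cons toks w) Ps

refineP : PolyTime (λ x → refine (hd x) (hd (tl x)) (hd (tl (tl x))))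
refineP = additiveP arg0 (consP arg1 arg2) (call3 refine1P arg0 (hdP arg2) (tlP arg2))
  {q = λ _ → 2} (pb-const 2)
  (λ x h t a → ≤-trans (size-split (refine1 h (hd a) (tl a)))
    (≤-trans (s≤s (≤-trans (refine1-size h (hd a) (tl a)) (split-size a))) (≤-reflexive (+-comm 2 (size a)))))

refine-size : ∀ Ps toks w → size (hd (refine Ps toks w)) + size (tl (refine Ps toks w)) ≤ size toks + size w
refine-size nil         toks w = ≤-refl
refine-size (cons P Ps) toks w =
  ≤-trans (refine1-size P (hd (refine Ps toks w)) (tl (refine Ps toks w))) (refine-size Ps toks w)

-- An arc that has left all tokens has become undeletable, so the paths no longer record it.
restrict : Tree → Tree → Tree
restrict toks Ps = mapT (λ P _ → filterT (λ x → membIn x toks) P) Ps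

restrictP : PolyTime (λ x → restrict (hd x) (hd (tl x)))
restrictP = mapP (filterP (call2 membInP arg0 arg3) arg0) arg1

restrict-size : ∀ toks Ps → size (restrict toks Ps) ≤ size Ps
restrict-size toks nil         = ≤-refl
restrict-size toks (cons P Ps) = s≤s (+-mono-≤ (filterT-size _ P) (restrict-size toks Ps))

-- The index i of an element of a list is recovered from the tail t behind it:
-- i + m is the difference of the unary number N = length + m − 1 and the length of t.
index : Tree → Tree → Tree
index N t = para (λ _ _ a → tl a) N t

indexP : PolyTime (λ x → index (hd x) (hd (tl x)))
indexP = additiveP arg1 arg0 (tlP arg2) {q = λ _ → 0} (pb-const 0)
  (λ x h t a → ≤-trans (tl-size a) (m≤m+n _ 0))

element : Tree → Tree
element i = cons nil (cons nil i)

readout : Tree → Tree → Tree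
readout N V = mapT (λ _ t → ifᵗ (visited (element (index N t)) V) tt nil) N

readoutP : PolyTime (λ x → readout (hd x) (hd (tl x)))
readoutP = mapP (ifP (call2 visitedP (consP nilP (consP nilP (call2 indexP arg2 arg1))) arg3) ttP nilP) arg0

readout-size : ∀ N V → size (readout N V) ≤ 4 * size N
readout-size N V = go N
  where
  go : ∀ l → size (mapT (λ _ t → ifᵗ (visited (element (index N t)) V) tt nil) l) ≤ 4 * size l
  go nil        = s≤s z≤n
  go (cons h t) = begin
    suc (size b + size m)  ≤⟨ s≤s (+-mono-≤ b≤ (go t)) ⟩
    4 + 4 * size t  ≡⟨ *-suc 4 (size t) ⟨
    4 * suc (size t)  ≤⟨ *-monoʳ-≤ 4 (s≤s (m≤n+m (size t) (size h))) ⟩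
    4 * size (cons h t)  ∎
    where
    open ≤-Reasoning
    b = ifᵗ (visited (element (index N t)) V) tt nil
    m = mapT (λ _ t → ifᵗ (visited (element (index N t)) V) tt nil) t
    b≤ : size b ≤ 3
    b≤ with visited (element (index N t)) V
    ... | nil      = s≤s z≤n
    ... | cons _ _ = ≤-refl

-- A running state cons nil (cons Ps (cons toks w)) consists of disjoint paths
-- Ps, the tokens and the unused guess bits; a final state is cons tt X.
afterSearch : Tree → Tree → Tree → Tree
afterSearch N r V =
  -- The tail `cons Q Ps` of an entry at a sink, read as a list, is already the path system with the
  -- new path in front.
  ifᵗ (sinkEntry V) (cons nil (cons (tl (sinkEntry V)) r)) (cons tt (readout N V))

round : Tree → Tree → Tree → Tree
round arcs N st = afterSearch N r (explore arcs (hd r) (restrict (hd r) (hd st)))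
  where r = refine (hd st) (hd (tl st)) (tl (tl st))

roundP : PolyTime (λ x → round (hd x) (hd (tl x)) (hd (tl (tl x))))
roundP = ifP (sinkEntryP V) (consP nilP (consP (tlP (sinkEntryP V)) r)) (consP ttP (call2 readoutP arg1 V))
  where
  r = call3 refineP (hdP arg2) (hdP (tlP arg2)) (tlP (tlP arg2))
  V = call3 exploreP arg0 (hdP r) (call2 restrictP (hdP r) (hdP arg2))

sinkEntry-sound : ∀ V {p q} → sinkEntry V ≡ cons p q → cons p q ∈ₜ V × tl p ≡ nil
sinkEntry-sound V eq with firstT-cons (λ e → ifᵗ (tl (hd e)) nil e) V eq
... | e , e∈V , eq′ with tl (hd e) in eq″
...   | nil with refl ← eq′ = e∈V , eq″

roundGrowth : Tree → Tree → ℕ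
roundGrowth arcs N = (size arcs * growth arcs + 4 * size N) + 12

round-size : ∀ arcs N st → size (round arcs N st) ≤ size st + roundGrowth arcs N
round-size arcs N st with sinkEntry V in eq
  where
  r = refine (hd st) (hd (tl st)) (tl (tl st))
  V = explore arcs (hd r) (restrict (hd r) (hd st))
... | nil = begin
  4 + size (readout N V)  ≤⟨ +-monoʳ-≤ 4 (readout-size N V) ⟩
  4 + 4 * size N  ≡⟨ +-comm 4 _ ⟩
  4 * size N + 4  ≤⟨ +-mono-≤ (m≤n+m _ (size arcs * growth arcs)) (m≤m+n 4 8) ⟩
  roundGrowth arcs N  ≤⟨ m≤n+m _ (size st) ⟩
  size st + roundGrowth arcs N  ∎
  where
  open ≤-Reasoning
  r = refine (hd st) (hd (tl st)) (tl (tl st))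
  V = explore arcs (hd r) (restrict (hd r) (hd st))
... | cons z c = begin
  3 + (size c + size r)
    ≤⟨ +-monoʳ-≤ 3 (+-mono-≤ (proj₂ (search-fits arcs (hd r) Ps arcs (proj₁ (sinkEntry-sound V eq)))) (size-split r)) ⟩
  3 + ((5 + size Ps + G) + suc (size (hd r) + size (tl r)))
    ≤⟨ +-monoʳ-≤ 3 (+-mono-≤ (+-monoˡ-≤ G (+-monoʳ-≤ 5 (restrict-size (hd r) (hd st))))
         (s≤s (≤-trans (refine-size (hd st) (hd (tl st)) (tl (tl st))) (split-size (tl st))))) ⟩
  3 + ((5 + size (hd st) + G) + suc (suc (size (tl st))))
    ≡⟨ arith (size (hd st)) (size (tl st)) G ⟩
  size (hd st) + size (tl st) + (G + 10)
    ≤⟨ +-mono-≤ (split-size st) (+-mono-≤ (m≤m+n G (4 * size N)) (≤-refl {10})) ⟩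
  suc (size st) + (G + 4 * size N + 10)
    ≡⟨ trans (sym (+-suc (size st) _)) (cong (size st +_) (sym (+-suc (G + 4 * size N) 10))) ⟩
  size st + (G + 4 * size N + 11)
    ≤⟨ +-monoʳ-≤ (size st) (+-monoʳ-≤ (G + 4 * size N) (n≤1+n 11)) ⟩
  size st + roundGrowth arcs N ∎
  where
  open ≤-Reasoning
  r  = refine (hd st) (hd (tl st)) (tl (tl st))
  Ps = restrict (hd r) (hd st)
  V  = explore arcs (hd r) Ps
  G  = size arcs * growth arcs
  arith : ∀ a b c → 3 + ((5 + a + c) + suc (suc b)) ≡ a + b + (c + 10)
  arith = solve 3 (λ a b c → con 3 :+ ((con 5 :+ a :+ c) :+ (con 2 :+ b)) := a :+ b :+ (c :+ con 10)) refl
    where open import Data.Nat.Solver using (module +-*-Solver)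
          open +-*-Solver

rounds : Tree → Tree → Tree → Tree → Tree
rounds arcs N st l = para (λ _ _ st → ifᵗ (hd st) st (round arcs N (tl st))) st l

roundsP : PolyTime (λ x → rounds (hd x) (hd (tl x)) (hd (tl (tl x))) (hd (tl (tl (tl x)))))
roundsP = additiveP arg3 arg2 (ifP (hdP arg2) arg2 (call3 roundP arg3 arg4 (tlP arg2)))
  {q = λ e → roundGrowth (hd (tl (tl e))) (hd (tl (tl (tl e))))}
  (pb-+ (pb-+ (pb-* (sizeBound arg2) (pb-+ (pb-const 3) (sizeBound arg2)))
              (pb-* (pb-const 4) (sizeBound arg3))) (pb-const 12))
  bound
  where
  bound : ∀ x h t a → size (ifᵗ (hd a) a (round (hd x) (hd (tl x)) (tl a))) ≤
                      size a + roundGrowth (hd x) (hd (tl x))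
  bound x h t a with hd a
  ... | cons _ _ = m≤m+n _ _
  ... | nil      = ≤-trans (round-size (hd x) (hd (tl x)) (tl a)) (+-monoˡ-≤ _ (tl-size a))

attempt : Tree → Tree → Tree → Tree → Tree
attempt arcs N toks w = ifᵗ (hd st) (cons (tl st) nil) nil
  -- One round more than there are tokens: under the guesses of a solution there are never more
  -- paths than tokens, so the last round has to be final.
  where st = rounds arcs N (cons nil (cons nil (cons toks w))) (cons nil toks)

attemptP : PolyTime (λ x → attempt (hd x) (hd (tl x)) (hd (tl (tl x))) (hd (tl (tl (tl x)))))
attemptP = ifP (hdP st) (consP (tlP st) nilP) nilP
  where st = call4 roundsP arg0 arg1 (consP nilP (consP nilP (consP arg2 arg3))) (consP nilP arg2)

attempts : Tree → Tree → Tree → Tree → Tree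
attempts arcs N toks ws = firstT (λ w → attempt arcs N toks w) ws

attemptsP : PolyTime (λ x → attempts (hd x) (hd (tl x)) (hd (tl (tl x))) (hd (tl (tl (tl x)))))
attemptsP = firstP (call4 attemptP arg1 arg2 arg3 arg0) arg3

-- The reduction to a cut problem

-- The vertices are element i for the i-th element of V, and cons c j for the
-- parts of the lattice with colour c, where j = 0 for U_∞ and j = 1 + l for U_l.
partVertex : Tree → Tree → Tree
partVertex c m = cons c (ifᵗ m (cons nil (hd m)) nil)

itemPair : Tree → Tree → Tree
itemPair x p = cons (cons x p) (cons (cons p x) nil)

items : Tree → Tree → Tree → Tree
items N c R = concatMapT (λ m t → itemPair (element (index N t)) (partVertex c m)) (hd (tl R))

itemsP : PolyTime (λ e → items (hd e) (hd (tl e)) (hd (tl (tl e))))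
itemsP = concatMapP (consP (consP x p) (consP (consP p x) nilP)) (hdP (tlP arg2))
  where
  x = consP nilP (consP nilP (call2 indexP arg2 arg1))
  p = consP arg3 (ifP arg0 (consP nilP (hdP arg0)) nilP)

edgeArc : Tree → Tree → Tree → Tree → Tree
edgeArc c j l bit = ifᵗ bit (cons (cons (cons c (cons nil j)) (cons c (cons nil l))) nil) nil

fixedArcs : Tree → Tree → Tree
fixedArcs c R =
  -- `tt` is also the numeral 1, so `cons c tt` is the vertex of `U₀`.
  cons (cons source (cons c tt))
       (concatMapT (λ row t → concatMapT (λ bit t′ → edgeArc c (index (hd R) t) (index (hd R) t′) bit) row)
                   (tl (tl R)))

fixedArcsP : PolyTime (λ e → fixedArcs (hd e) (hd (tl e)))
fixedArcsP = consP (consP (consP nilP ttP) (consP arg0 ttP))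
  (concatMapP
    (concatMapP
      (ifP arg0 (consP (consP (consP arg4 (consP nilP (call2 indexP (hdP arg5) arg3)))
                              (consP arg4 (consP nilP (call2 indexP (hdP arg5) arg1)))) nilP) nilP)
      arg0)
    (tlP (tlP arg1)))

allArcs : Tree → Tree → Tree → Tree
allArcs N K Rs = concatMapT (λ R t → append (fixedArcs (index K t) R) (items N (index K t) R)) Rs

allArcsP : PolyTime (λ e → allArcs (hd e) (hd (tl e)) (hd (tl (tl e))))
allArcsP = concatMapP (appendP (call2 fixedArcsP c arg0) (call3 itemsP arg2 c arg0)) arg2
  where c = call2 indexP arg3 arg1

-- Before any guess a token may stand for every deletable arc of its colour, so the tokens of a
-- colour start as equal copies.
tokens : Tree → Tree → Tree → Tree → Tree
tokens N K D Rs = concatMapT (λ R t → mapT (λ _ _ → items N (index K t) R) D) Rs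

tokensP : PolyTime (λ e → tokens (hd e) (hd (tl e)) (hd (tl (tl e))) (hd (tl (tl (tl e)))))
tokensP = concatMapP (mapP (call3 itemsP arg4 (call2 indexP arg5 arg3) arg2) arg4) arg3

unary : Tree → Tree
unary l = mapT (λ _ _ → nil) l

unaryP : ∀ {f} → PolyTime f → PolyTime (λ x → unary (f x))
unaryP p = mapP nilP p

-- The argument is the list of guesses, then `d` in unary, then the encoded instance, which contains
-- `d` in binary.
solveP : PolyTime (λ x →
  attempts (allArcs (hd (tl (tl x))) (unary (tl (tl (tl (tl x))))) (tl (tl (tl (tl x))))) (hd (tl (tl x)))
           (tokens (hd (tl (tl x))) (unary (tl (tl (tl (tl x))))) (hd (tl x)) (tl (tl (tl (tl x))))) (hd x))
solveP = call4 attemptsP (call3 allArcsP N K Rs) N (call4 tokensP N K arg1 Rs) arg0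
  where
  N  = hdP (tlP (tlP idP))
  Rs = tlP (tlP (tlP (tlP idP)))
  K  = unaryP Rs

mulU : Tree → Tree → Tree
mulU a b = concatMapT (λ _ _ → b) a

mulUP : PolyTime (λ x → mulU (hd x) (hd (tl x)))
mulUP = concatMapP arg3 arg0

bitsU : Tree → Tree → Tree
bitsU k d = mulU m (mulU m m)
  where m = mulU (cons nil k) (cons nil d)

bitsUP : PolyTime (λ x → bitsU (hd x) (hd (tl x)))
bitsUP = call2 mulUP m (call2 mulUP m m)
  where m = call2 mulUP (consP nilP arg0) (consP nilP arg1)

digitP : PolyTime (λ x → cons nil (ifᵗ (hd x) (cons nil (append (hd (tl (tl x))) (hd (tl (tl x)))))
                                              (append (hd (tl (tl x))) (hd (tl (tl x))))))
digitP = consP nilP (ifP arg0 (consP nilP (appendP arg2 arg2)) (appendP arg2 arg2))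

toUnary : Tree → Tree
toUnary x = para (λ h _ a → cons nil (ifᵗ h (cons nil (append a a)) (append a a))) nil x

extendP : PolyTime (λ x → append (mapT (λ w _ → cons nil w) (hd (tl (tl x))))
                                 (mapT (λ w _ → cons tt w) (hd (tl (tl x)))))
extendP = appendP (mapP (consP nilP arg0) arg2) (mapP (consP ttP arg0) arg2)

allWords : Tree → Tree
-- The base `tt` is the list whose only element is the empty word.
allWords l = para (λ _ _ a → append (mapT (λ w _ → cons nil w) a) (mapT (λ w _ → cons tt w) a)) tt l

inputBitsP : PolyTime (λ x → bitsU (unary (tl (tl (tl x)))) (hd x))
inputBitsP = call2 bitsUP (unaryP (tlP (tlP (tlP idP)))) arg0

-- The main program and its running time

-- `U` and `W` are bare codes because they stand for the two exponential stages; `pipelineC-time`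
-- takes their bounds on the inputs that actually occur as premises.
module Pipeline {f b δ w u : Tree → Tree} (W U : Code)
                (W-computes : ∀ x → ⟦ W ⟧ x ≡ w x) (U-computes : ∀ x → ⟦ U ⟧ x ≡ u x)
                (S : PolyTime f) (I : PolyTime b) (D : PolyTime δ) where

  first second : Tree → Tree
  first x  = cons (u (δ x)) x
  second x = cons (w (b x)) x

  firstC secondC pipelineC : Code
  firstC    = consC (U ∘C code D) idC
  secondC   = consC (W ∘C code I) idC
  pipelineC = code S ∘C (secondC ∘C firstC)

  firstC-computes : ∀ x → ⟦ firstC ⟧ x ≡ first x
  firstC-computes x =
    cong (λ y → cons y x) (trans (cong ⟦ U ⟧ (computes D x)) (U-computes (δ x)))

  secondC-computes : ∀ x → ⟦ secondC ⟧ x ≡ second x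
  secondC-computes x =
    cong (λ y → cons y x) (trans (cong ⟦ W ⟧ (computes I x)) (W-computes (b x)))

  secondC∘firstC-computes : ∀ x → ⟦ secondC ∘C firstC ⟧ x ≡ second (first x)
  secondC∘firstC-computes x = trans (cong ⟦ secondC ⟧ (firstC-computes x)) (secondC-computes (first x))

  pipelineC-computes : ∀ x → ⟦ pipelineC ⟧ x ≡ f (second (first x))
  pipelineC-computes x =
    trans (cong ⟦ code S ⟧ (secondC∘firstC-computes x)) (computes S (second (first x)))

  module _ {A : Set} {β : A → ℕ} (2≤β : ∀ i → 2 ≤ β i) where

    private
      module PB = PolyBounds 2≤β

    pipelineC-time : {y : A → Tree} → PolyBounded β (size ∘ y) →
      PolyBounded β (λ i → time U (δ (y i))) → PolyBounded β (λ i → size (u (δ (y i)))) →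
      PolyBounded β (λ i → time W (b (first (y i)))) → PolyBounded β (λ i → size (w (b (first (y i))))) →
      PolyBounded β (λ i → time pipelineC (y i))
    pipelineC-time {y} yB Ut Us Wt Ws = PB.pb-≤
      (λ i → s≤s (+-mono-≤
        (s≤s (+-mono-≤
          (s≤s (+-monoˡ-≤ 1 (s≤s (+-monoʳ-≤ (time (code D) (y i))
            (≤-reflexive (cong (time U) (computes D (y i))))))))
          (≤-trans (≤-reflexive (cong (time secondC) (firstC-computes (y i))))
            (s≤s (+-monoˡ-≤ 1 (s≤s (+-monoʳ-≤ (time (code I) (first (y i)))
              (≤-reflexive (cong (time W) (computes I (first (y i)))))))))) ))
        (≤-reflexive (cong (time (code S)) (secondC∘firstC-computes (y i))))))
      (PB.pb-suc (PB.pb-+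
        (PB.pb-suc (PB.pb-+
          (PB.pb-suc (PB.pb-+ (PB.pb-suc (PB.pb-+ (PB.pb-∘ (timeBound D) yB) Ut)) (PB.pb-const 1)))
          (PB.pb-suc (PB.pb-+ (PB.pb-suc (PB.pb-+ (PB.pb-∘ (timeBound I) firstB) Wt)) (PB.pb-const 1)))))
        (PB.pb-∘ (timeBound S) (PB.pb-suc (PB.pb-+ Ws firstB)))))
      where
      firstB : PolyBounded β (λ i → size (first (y i)))
      firstB = PB.pb-suc (PB.pb-+ Us yB)

-- Unary arithmetic and the exponential stages

append-encodeℕ : ∀ m n → append (encodeℕ m) (encodeℕ n) ≡ encodeℕ (m + n)
append-encodeℕ zero    n = refl
append-encodeℕ (suc m) n = cong (cons nil) (append-encodeℕ m n)

mulU-encodeℕ : ∀ m n → mulU (encodeℕ m) (encodeℕ n) ≡ encodeℕ (m * n)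
mulU-encodeℕ zero    n = refl
mulU-encodeℕ (suc m) n = trans (cong (append (encodeℕ n)) (mulU-encodeℕ m n)) (append-encodeℕ n (m * n))

-- Room for `kd + 1` rounds, each reading one bit for every pair of one of at most `kd` paths and
-- one of the `kd` tokens.
bits : ℕ → ℕ → ℕ
bits k d = m * (m * m)
  where m = suc k * suc d

cube-encodeℕ : ∀ m → mulU (encodeℕ m) (mulU (encodeℕ m) (encodeℕ m)) ≡ encodeℕ (m * (m * m))
cube-encodeℕ m = trans (cong (mulU (encodeℕ m)) (mulU-encodeℕ m m)) (mulU-encodeℕ m (m * m))

bitsU-encodeℕ : ∀ k d → bitsU (encodeℕ k) (encodeℕ d) ≡ encodeℕ (bits k d)
bitsU-encodeℕ k d =
  trans (cong (λ m → mulU m (mulU m m)) (mulU-encodeℕ (suc k) (suc d))) (cube-encodeℕ (suc k * suc d))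

toUnary-encodeℕᵇ : ∀ x → toUnary (encodeℕᵇ x) ≡ encodeℕ (toℕᵇ x)
toUnary-encodeℕᵇ 0ᵇ = refl
toUnary-encodeℕᵇ 2[1+ x ]
  rewrite toUnary-encodeℕᵇ x | append-encodeℕ (toℕᵇ x) (toℕᵇ x) =
  cong encodeℕ (trans (sym (cong suc (+-suc (toℕᵇ x) (toℕᵇ x))))
                      (cong (λ y → suc (toℕᵇ x + suc y)) (sym (+-identityʳ (toℕᵇ x)))))
toUnary-encodeℕᵇ 1+[2 x ]
  rewrite toUnary-encodeℕᵇ x | append-encodeℕ (toℕᵇ x) (toℕᵇ x) =
  cong encodeℕ (cong (λ y → suc (toℕᵇ x + y)) (sym (+-identityʳ (toℕᵇ x))))

toUnary-fromℕ : ∀ d → toUnary (encodeℕᵇ (fromℕ d)) ≡ encodeℕ d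
toUnary-fromℕ d = trans (toUnary-encodeℕᵇ (fromℕ d)) (cong encodeℕ (ℕᵇ.toℕ-fromℕ d))

-- The offset 4 makes the induction exact: a digit turns size `a` into at most `4 + 2a`, and
-- `4 + (4 + 2a) = 2(4 + a)`.
toUnary-size : ∀ x → 4 + size (toUnary x) ≤ 5 * 2 ^ size x
toUnary-size nil = m≤m+n 5 5
toUnary-size (cons h t) = begin
  4 + suc (1 + size (ifᵗ h (cons nil (append a a)) (append a a))) ≤⟨ +-monoʳ-≤ 6 (if≤ h) ⟩
  6 + (2 + (size a + size a))  ≡⟨ arith (size a) ⟩
  2 * (4 + size a)  ≤⟨ *-monoʳ-≤ 2 (toUnary-size t) ⟩
  2 * (5 * 2 ^ size t)  ≡⟨ trans (sym (*-assoc 2 5 (2 ^ size t))) (*-assoc 5 2 (2 ^ size t)) ⟩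
  5 * 2 ^ suc (size t)  ≤⟨ *-monoʳ-≤ 5 (^-monoʳ-≤ 2 (s≤s (m≤n+m (size t) (size h)))) ⟩
  5 * 2 ^ size (cons h t)  ∎
  where
  open ≤-Reasoning
  a = toUnary t
  if≤ : ∀ h → size (ifᵗ h (cons nil (append a a)) (append a a)) ≤ 2 + (size a + size a)
  if≤ nil        = ≤-trans (append-size a a) (m≤n+m _ 2)
  if≤ (cons _ _) = +-monoʳ-≤ 2 (append-size a a)
  arith : ∀ a → 6 + (2 + (a + a)) ≡ 2 * (4 + a)
  arith = Solver.solve 1 (λ a → con 6 :+ (con 2 :+ (a :+ a)) := con 2 :* (con 4 :+ a)) refl
    where open import Data.Nat.Solver using (module +-*-Solver)
          module Solver = +-*-Solver
          open +-*-Solver using (con; _:+_; _:*_; _:=_)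

*-^-distrib : ∀ m n e → m ^ e * n ^ e ≡ (m * n) ^ e
*-^-distrib m n zero    = refl
*-^-distrib m n (suc e) =
  trans ([m*n]*[o*p]≡[m*o]*[n*p] m (m ^ e) n (n ^ e)) (cong (m * n *_) (*-^-distrib m n e))

private
  halve : ∀ a b → a * (2 * b) ≡ 2 * (a * b)
  halve a b = trans (sym (*-assoc a 2 b)) (trans (cong (_* b) (*-comm a 2)) (*-assoc 2 a b))

-- A digit costs at most four nodes and at least doubles the successor of the number. So a quantity
-- exponential in the binary length is polynomial in the number itself.
encodeℕᵇ-size : ∀ x → 2 ^ size (encodeℕᵇ x) ≤ 2 * suc (toℕᵇ x) ^ 4
encodeℕᵇ-size 0ᵇ = ≤-refl
encodeℕᵇ-size 2[1+ x ] = begin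
  2 ^ (4 + size (encodeℕᵇ x))  ≡⟨ ^-distribˡ-+-* 2 4 (size (encodeℕᵇ x)) ⟩
  2 ^ 4 * 2 ^ size (encodeℕᵇ x)  ≤⟨ *-monoʳ-≤ (2 ^ 4) (encodeℕᵇ-size x) ⟩
  2 ^ 4 * (2 * suc (toℕᵇ x) ^ 4)  ≡⟨ halve (2 ^ 4) (suc (toℕᵇ x) ^ 4) ⟩
  2 * (2 ^ 4 * suc (toℕᵇ x) ^ 4)  ≡⟨ cong (2 *_) (*-^-distrib 2 (suc (toℕᵇ x)) 4) ⟩
  2 * (2 * suc (toℕᵇ x)) ^ 4  ≤⟨ *-monoʳ-≤ 2 (^-monoˡ-≤ 4 (n≤1+n (2 * suc (toℕᵇ x)))) ⟩
  2 * suc (2 * suc (toℕᵇ x)) ^ 4  ∎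
  where open ≤-Reasoning
encodeℕᵇ-size 1+[2 x ] = begin
  2 ^ (2 + size (encodeℕᵇ x))  ≤⟨ ^-monoʳ-≤ 2 (+-monoˡ-≤ (size (encodeℕᵇ x)) (m≤m+n 2 2)) ⟩
  2 ^ (4 + size (encodeℕᵇ x))  ≡⟨ ^-distribˡ-+-* 2 4 (size (encodeℕᵇ x)) ⟩
  2 ^ 4 * 2 ^ size (encodeℕᵇ x)  ≤⟨ *-monoʳ-≤ (2 ^ 4) (encodeℕᵇ-size x) ⟩
  2 ^ 4 * (2 * suc (toℕᵇ x) ^ 4)  ≡⟨ halve (2 ^ 4) (suc (toℕᵇ x) ^ 4) ⟩
  2 * (2 ^ 4 * suc (toℕᵇ x) ^ 4)  ≡⟨ cong (2 *_) (*-^-distrib 2 (suc (toℕᵇ x)) 4) ⟩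
  2 * (2 * suc (toℕᵇ x)) ^ 4  ≡⟨ cong (λ y → 2 * y ^ 4) (*-suc 2 (toℕᵇ x)) ⟩
  2 * suc (toℕᵇ 1+[2 x ]) ^ 4  ∎
  where open ≤-Reasoning

prefixBit-size : ∀ b → size b ≤ 3 → ∀ l → size (mapT (λ w _ → cons b w) l) ≤ 5 * size l
prefixBit-size b b≤ nil = s≤s z≤n
prefixBit-size b b≤ (cons h t) = begin
  suc (suc (size b + size h) + size (mapT (λ w _ → cons b w) t))
    ≤⟨ s≤s (+-mono-≤ (s≤s (+-mono-≤ b≤ (m≤n*m (size h) 5))) (prefixBit-size b b≤ t)) ⟩
  5 + (5 * size h + 5 * size t)
    ≡⟨ cong (5 +_) (*-distribˡ-+ 5 (size h) (size t)) ⟨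
  5 + 5 * (size h + size t)
    ≡⟨ *-suc 5 _ ⟨
  5 * size (cons h t) ∎
  where open ≤-Reasoning

-- One more bit multiplies the size by at most 10, rounded up to 16 so that `sixteen` can express
-- the bound as a power of `2 ^ M`.
allWords-size : ∀ l → size (allWords l) ≤ 3 * 16 ^ size l
allWords-size nil = m≤m+n 3 45
allWords-size (cons h t) = begin
  size (append (mapT (λ w _ → cons nil w) a) (mapT (λ w _ → cons tt w) a))
    ≤⟨ append-size (mapT (λ w _ → cons nil w) a) _ ⟩
  size (mapT (λ w _ → cons nil w) a) + size (mapT (λ w _ → cons tt w) a)
    ≤⟨ +-mono-≤ (prefixBit-size nil (s≤s z≤n) a) (prefixBit-size tt ≤-refl a) ⟩
  5 * size a + 5 * size a  ≡⟨ *-distribʳ-+ (size a) 5 5 ⟨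
  10 * size a  ≤⟨ *-mono-≤ (m≤m+n 10 6) (allWords-size t) ⟩
  16 * (3 * 16 ^ size t)  ≡⟨ trans (sym (*-assoc 16 3 (16 ^ size t))) (*-assoc 3 16 (16 ^ size t)) ⟩
  3 * 16 ^ suc (size t)  ≤⟨ *-monoʳ-≤ 3 (^-monoʳ-≤ 16 (s≤s (m≤n+m (size t) (size h)))) ⟩
  3 * 16 ^ size (cons h t)  ∎
  where
  open ≤-Reasoning
  a = allWords t

size-encodeℕ : ∀ n → size (encodeℕ n) ≡ suc (2 * n)
size-encodeℕ zero    = refl
size-encodeℕ (suc n) = trans (cong (2 +_) (size-encodeℕ n)) (cong suc (sym (*-suc 2 n)))

guesses : ℕ → ℕ → ℕ
guesses k d = 2 ^ bits k d

module _ where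
  open Instance

  -- Both summands are at least 2, so the sum is at most their product and its powers split into a
  -- parameter part and a power of the length.
  β : Instance → ℕ
  β I = length I + guesses (k I) (d I)

  2≤length : ∀ I → 2 ≤ length I
  2≤length I = s≤s (≤-trans (1≤size (encodeℕ (n I))) (m≤m+n _ _))

  2≤β : ∀ I → 2 ≤ β I
  2≤β I = ≤-trans (2≤length I) (m≤m+n _ _)

  private
    module B = PolyBounds 2≤β

  unary-tab : ∀ {k} {A : Set} (enc : A → Tree) (f : Fin k → A) →
              unary (encodeFun enc f) ≡ encodeℕ k
  unary-tab {zero}  enc f = refl
  unary-tab {suc k} enc f = cong (cons nil) (unary-tab enc (f ∘ Fin.suc))

  distance : Instance → Tree
  distance I = encodeℕᵇ (fromℕ (d I))

  d≤guesses : ∀ I → d I ≤ guesses (k I) (d I)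
  d≤guesses I = begin
    d I  ≤⟨ n≤1+n _ ⟩
    suc (d I)  ≤⟨ m≤n*m (suc (d I)) (suc (k I)) ⟩
    m  ≤⟨ m≤m*n m (m * m) ⟩
    bits (k I) (d I)  ≤⟨ n≤2^n _ ⟩
    guesses (k I) (d I)  ∎
    where
    open ≤-Reasoning
    m = suc (k I) * suc (d I)

  pb-d : PolyBounded β d
  pb-d = B.pb-≤ (λ I → ≤-trans (d≤guesses I) (m≤n+m _ (length I))) B.pb-base

  pb-length : PolyBounded β length
  pb-length = B.pb-≤ (λ I → m≤m+n _ _) B.pb-base

  pb-distance : PolyBounded β (λ I → 5 * 2 ^ size (distance I))
  pb-distance = B.pb-≤
    (λ I → *-monoʳ-≤ 5 (≤-trans (encodeℕᵇ-size (fromℕ (d I)))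
             (≤-reflexive (cong (λ v → 2 * suc v ^ 4) (ℕᵇ.toℕ-fromℕ (d I))))))
    (B.pb-* (B.pb-const 5) (B.pb-* (B.pb-const 2) (B.pb-^ (B.pb-suc pb-d) 4)))

  inputBits : ∀ I → bitsU (unary (tl (tl (encodeInstance I)))) (toUnary (distance I)) ≡
                    encodeℕ (bits (k I) (d I))
  inputBits I = trans (cong₂ bitsU (unary-tab (λ i → encodeCompact (compact I i)) (λ i → i)) (toUnary-fromℕ (d I)))
                      (bitsU-encodeℕ (k I) (d I))

  sixteen : ∀ M → 3 * 16 ^ size (encodeℕ M) ≡ 3 * (16 * (2 ^ M) ^ 8)
  sixteen M = cong (3 *_) (begin
    16 ^ size (encodeℕ M)  ≡⟨ cong (16 ^_) (size-encodeℕ M) ⟩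
    16 * 16 ^ (2 * M)  ≡⟨ cong (16 *_) (^-*-assoc 2 4 (2 * M)) ⟩
    16 * 2 ^ (4 * (2 * M))  ≡⟨ cong (λ y → 16 * 2 ^ y) (trans (sym (*-assoc 4 2 M)) (*-comm 8 M)) ⟩
    16 * 2 ^ (M * 8)  ≡⟨ cong (16 *_) (^-*-assoc 2 M 8) ⟨
    16 * (2 ^ M) ^ 8  ∎)
    where open ≡-Reasoning

  pb-words : PolyBounded β (λ I → 3 * 16 ^ size (encodeℕ (bits (k I) (d I))))
  pb-words = B.pb-≤ (λ I → ≤-reflexive (sixteen (bits (k I) (d I))))
    (B.pb-* (B.pb-const 3) (B.pb-* (B.pb-const 16)
      (B.pb-^ (B.pb-≤ (λ I → m≤n+m _ (length I)) B.pb-base) 8)))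

  toUnary-time : PolyBounded β (λ I → time (paraCode idP nilP digitP) (distance I))
  toUnary-time = paraCode-timeBound idP nilP digitP 2≤β {y = distance}
    (B.pb-≤ (λ I → ≤-trans (n≤2^n _) (m≤n*m _ 5)) pb-distance)
    pb-distance
    (λ I l l≤ → ≤-trans (m≤n+m _ 4) (≤-trans (toUnary-size l) (*-monoʳ-≤ 5 (^-monoʳ-≤ 2 l≤))))

  allWords-time : PolyBounded β (λ I → time (paraCode idP ttP extendP) (encodeℕ (bits (k I) (d I))))
  allWords-time = paraCode-timeBound idP ttP extendP 2≤β {y = λ I → encodeℕ (bits (k I) (d I))}
    (B.pb-≤ (λ I → ≤-trans (n≤2^n _) (≤-trans (^-monoˡ-≤ (size (encodeℕ (bits (k I) (d I)))) (m≤m+n 2 14))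
                                              (m≤n*m _ 3))) pb-words)
    pb-words
    (λ I l l≤ → ≤-trans (allWords-size l) (*-monoʳ-≤ 3 (^-monoʳ-≤ 16 l≤)))

  private
    module P = Pipeline (paraCode idP ttP extendP) (paraCode idP nilP digitP)
      (paraCode-computes idP ttP extendP) (paraCode-computes idP nilP digitP) solveP inputBitsP arg1

  computation : ∀ I →
    attempts (allArcs (encodeℕ (n I)) (unary (tl (tl (encodeInstance I)))) (tl (tl (encodeInstance I))))
             (encodeℕ (n I))
             (tokens (encodeℕ (n I)) (unary (tl (tl (encodeInstance I)))) (toUnary (distance I))
                     (tl (tl (encodeInstance I))))
             (allWords (bitsU (unary (tl (tl (encodeInstance I)))) (toUnary (distance I)))) ≡
    attempts (allArcs (encodeℕ (n I)) (encodeℕ (k I)) (tl (tl (encodeInstance I)))) (encodeℕ (n I))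
             (tokens (encodeℕ (n I)) (encodeℕ (k I)) (encodeℕ (d I)) (tl (tl (encodeInstance I))))
             (allWords (encodeℕ (bits (k I) (d I))))
  computation I = trans
    (cong (λ K → attempts (allArcs (encodeℕ (n I)) K Rs) (encodeℕ (n I))
                   (tokens (encodeℕ (n I)) K (toUnary (distance I)) Rs) words)
          (unary-tab (λ i → encodeCompact (compact I i)) (λ i → i)))
    (trans
      (cong (λ D → attempts (allArcs (encodeℕ (n I)) (encodeℕ (k I)) Rs) (encodeℕ (n I))
                     (tokens (encodeℕ (n I)) (encodeℕ (k I)) D Rs) words)
            (toUnary-fromℕ (d I)))
      (cong (λ M → attempts (allArcs (encodeℕ (n I)) (encodeℕ (k I)) Rs) (encodeℕ (n I))
                     (tokens (encodeℕ (n I)) (encodeℕ (k I)) (encodeℕ (d I)) Rs) (allWords M))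
            (inputBits I)))
    where
    Rs words : Tree
    Rs    = tl (tl (encodeInstance I))
    words = allWords (bitsU (unary (tl (tl (encodeInstance I)))) (toUnary (distance I)))

  abstract
    mainCode : ∃[ c ]
      (∀ I → ⟦ c ⟧ (encodeInstance I) ≡
        attempts (allArcs (encodeℕ (n I)) (encodeℕ (k I)) (tl (tl (encodeInstance I)))) (encodeℕ (n I))
                 (tokens (encodeℕ (n I)) (encodeℕ (k I)) (encodeℕ (d I)) (tl (tl (encodeInstance I))))
                 (allWords (encodeℕ (bits (k I) (d I))))) ×
      PolyBounded β (λ I → time c (encodeInstance I))
    mainCode = P.pipelineC
      , (λ I → trans (P.pipelineC-computes (encodeInstance I)) (computation I))
      , P.pipelineC-time 2≤β {y = encodeInstance} pb-length toUnary-time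
          (B.pb-≤ (λ I → ≤-trans (m≤n+m _ 4) (toUnary-size (distance I))) pb-distance)
          (B.pb-≤ (λ I → ≤-reflexive (cong (time (paraCode idP ttP extendP)) (inputBits I))) allWords-time)
          (B.pb-≤ (λ I → ≤-trans (≤-reflexive (cong (size ∘ allWords) (inputBits I)))
                                 (allWords-size (encodeℕ (bits (k I) (d I))))) pb-words)

-- Correctness of the search

memb-sound : ∀ x l {p q} → memb x l ≡ cons p q → x ∈ₜ l
memb-sound x l eq with firstT-cons (λ h → eqᵗ x h) l eq
... | h , h∈l , eq′ = subst (_∈ₜ l) (sym (eqᵗ-sound x h eq′)) h∈l

memb-complete : ∀ x l → memb x l ≡ nil → ¬ x ∈ₜ l
memb-complete x l eq x∈l = eqᵗ-complete {x} (firstT-nil (λ h → eqᵗ x h) l eq x∈l) refl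

_∈∈_ : Tree → Tree → Set
x ∈∈ ls = ∃[ l ] l ∈ₜ ls × x ∈ₜ l

membIn-sound : ∀ x ls {p q} → membIn x ls ≡ cons p q → x ∈∈ ls
membIn-sound x ls eq with firstT-cons (λ l → memb x l) ls eq
... | l , l∈ls , eq′ = l , l∈ls , memb-sound x l eq′

membIn-complete : ∀ x ls → membIn x ls ≡ nil → ¬ x ∈∈ ls
membIn-complete x ls eq (l , l∈ls , x∈l) =
  memb-complete x l (firstT-nil (λ l → memb x l) ls eq l∈ls) x∈l

visits? : ∀ V w → Dec (Visits V w)
visits? V w with visited w V in eq
... | nil      = no (visited-complete {w} {V} eq)
... | cons _ _ = yes (visited-sound w V eq)

-- Adjacent x y P: on the path P, the arc y immediately precedes x.
data Adjacent (x y : Tree) : Tree → Set where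
  here  : ∀ {B} → Adjacent x y (cons x (cons y B))
  there : ∀ {p P} → Adjacent x y P → Adjacent x y (cons p P)

Adjacent-∈ : ∀ {x y P} → Adjacent x y P → y ∈ₜ P
Adjacent-∈ here      = there here
Adjacent-∈ (there a) = there (Adjacent-∈ a)

reroute-complete : ∀ z Q V P → reroute z Q V P ≡ nil →
  ∀ {x y} → Adjacent x y P → hd x ≡ z ⊎ tl x ≡ z → Visits V (tl y)
reroute-complete z Q V (cons x nil) eq (there ()) touch
reroute-complete z Q V (cons x (cons y B)) eq adj touch with eqᵗ (hd x) z in eq₁
reroute-complete z Q V (cons x (cons y B)) eq adj touch | cons _ _ with visited (tl y) V in eq₂
reroute-complete z Q V (cons x (cons y B)) eq here touch | cons _ _ | cons _ _ = visited-sound (tl y) V eq₂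
reroute-complete z Q V (cons x (cons y B)) eq (there adj) touch | cons _ _ | cons _ _
  with nil ← reroute z Q V (cons y B) in eq₃ = reroute-complete z Q V (cons y B) eq₃ adj touch
reroute-complete z Q V (cons x (cons y B)) eq adj touch | nil with eqᵗ (tl x) z in eq₁′
reroute-complete z Q V (cons x (cons y B)) eq here (inj₁ p) | nil | nil = ⊥-elim (eqᵗ-complete {hd x} eq₁ p)
reroute-complete z Q V (cons x (cons y B)) eq here (inj₂ p) | nil | nil = ⊥-elim (eqᵗ-complete {tl x} eq₁′ p)
reroute-complete z Q V (cons x (cons y B)) eq (there adj) touch | nil | nil
  with nil ← reroute z Q V (cons y B) in eq₃ = reroute-complete z Q V (cons y B) eq₃ adj touch
reroute-complete z Q V (cons x (cons y B)) eq adj touch | nil | cons _ _ with visited (tl y) V in eq₂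
reroute-complete z Q V (cons x (cons y B)) eq here touch | nil | cons _ _ | cons _ _ = visited-sound (tl y) V eq₂
reroute-complete z Q V (cons x (cons y B)) eq (there adj) touch | nil | cons _ _ | cons _ _
  with nil ← reroute z Q V (cons y B) in eq₃ = reroute-complete z Q V (cons y B) eq₃ adj touch

rerouteSome-complete : ∀ z Q V Ps → rerouteSome z Q V Ps ≡ nil → ∀ {P} → P ∈ₜ Ps → reroute z Q V P ≡ nil
rerouteSome-complete z Q V (cons P Os) eq P∈ with reroute z Q V P in eq₁
rerouteSome-complete z Q V (cons P Os) eq P∈ | nil with rerouteSome z Q V Os in eq₂
rerouteSome-complete z Q V (cons P Os) eq here       | nil | nil = eq₁
rerouteSome-complete z Q V (cons P Os) eq (there P∈) | nil | nil = rerouteSome-complete z Q V Os eq₂ P∈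

module _ {z Q V : Tree} where

  reroute-∈ : ∀ {P P′ B x} → Reroute z Q V P P′ B → x ∈ₜ P′ → x ∈ₜ P ⊎ x ∈ₜ Q
  reroute-∈ (leave _ _) here      = inj₁ here
  reroute-∈ (leave _ _) (there p) = inj₂ p
  reroute-∈ (enter _ _) p         = inj₂ p
  reroute-∈ (skip r)    here      = inj₁ here
  reroute-∈ (skip r)    (there p) with reroute-∈ r p
  ... | inj₁ q = inj₁ (there q)
  ... | inj₂ q = inj₂ q

  reroute-∈ᴮ : ∀ {P P′ B x} → Reroute z Q V P P′ B → x ∈ₜ B → x ∈ₜ P
  reroute-∈ᴮ (leave _ _) p = there p
  reroute-∈ᴮ (enter _ _) p = there p
  reroute-∈ᴮ (skip r)    p = there (reroute-∈ᴮ r p)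

  -- Outside the abandoned part `B`, the only pair that can break is the one whose earlier arc is
  -- dropped by `enter`, and that arc ends at `z`.
  reroute-adjacent : ∀ {P P′ B x y} → Reroute z Q V P P′ B → Adjacent x y P →
                     Adjacent x y P′ ⊎ y ∈ₜ B ⊎ tl y ≡ z
  reroute-adjacent (leave _ _)        here      = inj₂ (inj₁ here)
  reroute-adjacent (leave _ _)        (there a) = inj₂ (inj₁ (Adjacent-∈ a))
  reroute-adjacent (enter _ _)        here      = inj₂ (inj₁ here)
  reroute-adjacent (enter _ _)        (there a) = inj₂ (inj₁ (Adjacent-∈ a))
  reroute-adjacent (skip (leave _ _)) here      = inj₁ here
  reroute-adjacent (skip (enter e _)) here      = inj₂ (inj₂ e)
  reroute-adjacent (skip (skip _))    here      = inj₁ here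
  reroute-adjacent (skip r)           (there a) with reroute-adjacent r a
  ... | inj₁ b = inj₁ (there b)
  ... | inj₂ b = inj₂ b

  reroute-unvisited : ∀ {P P′ B} → Reroute z Q V P P′ B → ∃[ y ] ∃[ B′ ] B ≡ cons y B′ × ¬ Visits V (tl y)
  reroute-unvisited (leave _ ¬v) = _ , _ , refl , ¬v
  reroute-unvisited (enter _ ¬v) = _ , _ , refl , ¬v
  reroute-unvisited (skip r)     = reroute-unvisited r

  rerouteSome-∈ : ∀ {Ps Ps′ B x} → RerouteSome z Q V Ps Ps′ B → x ∈∈ Ps′ → x ∈∈ Ps ⊎ x ∈ₜ Q
  rerouteSome-∈ (here r) (_ , here , x∈) with reroute-∈ r x∈
  ... | inj₁ q = inj₁ (_ , here , q)
  ... | inj₂ q = inj₂ q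
  rerouteSome-∈ (here r)  (_ , there P∈ , x∈) = inj₁ (_ , there P∈ , x∈)
  rerouteSome-∈ (there r) (_ , here , x∈)     = inj₁ (_ , here , x∈)
  rerouteSome-∈ (there r) (_ , there P∈ , x∈) with rerouteSome-∈ r (_ , P∈ , x∈)
  ... | inj₁ (_ , P∈′ , x∈′) = inj₁ (_ , there P∈′ , x∈′)
  ... | inj₂ q               = inj₂ q

  rerouteSome-∈ᴮ : ∀ {Ps Ps′ B x} → RerouteSome z Q V Ps Ps′ B → x ∈ₜ B → x ∈∈ Ps
  rerouteSome-∈ᴮ (here r)  x∈ = _ , here , reroute-∈ᴮ r x∈
  rerouteSome-∈ᴮ (there r) x∈ with rerouteSome-∈ᴮ r x∈
  ... | P , P∈ , x∈P = P , there P∈ , x∈P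

  rerouteSome-adjacent : ∀ {Ps Ps′ B P x y} → RerouteSome z Q V Ps Ps′ B → P ∈ₜ Ps → Adjacent x y P →
    (∃[ P′ ] P′ ∈ₜ Ps′ × Adjacent x y P′) ⊎ y ∈ₜ B ⊎ tl y ≡ z
  rerouteSome-adjacent (here r) here a with reroute-adjacent r a
  ... | inj₁ b = inj₁ (_ , here , b)
  ... | inj₂ b = inj₂ b
  rerouteSome-adjacent (here r)  (there P∈) a = inj₁ (_ , there P∈ , a)
  rerouteSome-adjacent (there r) here       a = inj₁ (_ , here , a)
  rerouteSome-adjacent (there r) (there P∈) a with rerouteSome-adjacent r P∈ a
  ... | inj₁ (_ , P∈′ , b) = inj₁ (_ , there P∈′ , b)
  ... | inj₂ b             = inj₂ b

  rerouteSome-unvisited : ∀ {Ps Ps′ B} → RerouteSome z Q V Ps Ps′ B →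
                          ∃[ y ] ∃[ B′ ] B ≡ cons y B′ × ¬ Visits V (tl y)
  rerouteSome-unvisited (here r)  = reroute-unvisited r
  rerouteSome-unvisited (there r) = rerouteSome-unvisited r

data Suffix : Tree → Tree → Set where
  whole : ∀ {l} → Suffix l l
  tail  : ∀ {l x m} → Suffix l m → Suffix l (cons x m)

Suffix-∈ : ∀ {l m x} → Suffix l m → x ∈ₜ l → x ∈ₜ m
Suffix-∈ whole    p = p
Suffix-∈ (tail s) p = there (Suffix-∈ s p)

prefixEntries-∈⁻ : ∀ {Ps} B {e} → e ∈ₜ prefixEntries Ps B →
  ∃[ b ] ∃[ B′ ] Suffix (cons b B′) B × e ≡ cons (tl b) (cons (cons b B′) Ps)
prefixEntries-∈⁻ (cons b B) here = b , B , whole , refl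
prefixEntries-∈⁻ (cons b B) (there p) with prefixEntries-∈⁻ B p
... | b′ , B′ , s , eq = b′ , B′ , tail s , eq

prefixEntries-visits : ∀ {Ps} B {b} → b ∈ₜ B → Visits (prefixEntries Ps B) (tl b)
prefixEntries-visits (cons b B) here = _ , here , refl
prefixEntries-visits (cons _ B) (there p) with prefixEntries-visits B p
... | e , e∈ , eq = e , there e∈ , eq

data Move (arcs toks V e : Tree) : Tree → Set where
  fixed : ∀ {a} → a ∈ₜ arcs → hd a ≡ hd e → ¬ Visits V (tl a) → ¬ a ∈∈ toks →
          Move arcs toks V e (cons (cons (tl a) (tl e)) nil)
  push  : ∀ {a} → a ∈ₜ arcs → hd a ≡ hd e → ¬ Visits V (tl a) → a ∈∈ toks → ¬ a ∈∈ tl (tl e) →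
          Move arcs toks V e (cons (cons (tl a) (cons (cons a (hd (tl e))) (tl (tl e)))) nil)
  path  : ∀ {Ps′ B} → RerouteSome (hd e) (hd (tl e)) V (tl (tl e)) Ps′ B →
          Move arcs toks V e (prefixEntries Ps′ B)

arcMove-sound : ∀ {arcs} V toks e a {p q} → a ∈ₜ arcs → arcMove V toks e a ≡ cons p q →
                Move arcs toks V e (cons p q)
arcMove-sound V toks e a a∈ eq with eqᵗ (hd a) (hd e) in eq₁
... | cons _ _ with visited (tl a) V in eq₂
...   | nil with membIn a toks in eq₃
...     | nil with refl ← eq =
  fixed a∈ (eqᵗ-sound (hd a) (hd e) eq₁) (visited-complete {tl a} {V} eq₂) (membIn-complete a toks eq₃)
...     | cons _ _ with membIn a (tl (tl e)) in eq₄
...       | nil with refl ← eq =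
  push a∈ (eqᵗ-sound (hd a) (hd e) eq₁) (visited-complete {tl a} {V} eq₂)
       (membIn-sound a toks eq₃) (membIn-complete a (tl (tl e)) eq₄)

entryMoves-sound : ∀ arcs toks V e {p q} → entryMoves arcs toks V e ≡ cons p q → Move arcs toks V e (cons p q)
entryMoves-sound arcs toks V e {p} {q} eq with rerouteSome (hd e) (hd (tl e)) V (tl (tl e)) in eq₁
... | cons Ps′ B with prefixEntries Ps′ B in eq₂
...   | cons _ _ = subst (Move arcs toks V e) (trans eq₂ eq)
                     (path (rerouteSome-sound (hd e) (hd (tl e)) V (tl (tl e)) eq₁))
...   | nil with firstT-cons (λ a → arcMove V toks e a) arcs eq
...     | a , a∈ , eq′ = arcMove-sound V toks e a a∈ eq′
entryMoves-sound arcs toks V e eq | nil with firstT-cons (λ a → arcMove V toks e a) arcs eq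
...     | a , a∈ , eq′ = arcMove-sound V toks e a a∈ eq′

moves-sound : ∀ arcs toks V {p q} → moves arcs toks V ≡ cons p q → ∃[ e ] e ∈ₜ V × Move arcs toks V e (cons p q)
moves-sound arcs toks V eq with firstT-cons (λ e → entryMoves arcs toks V e) V eq
... | e , e∈ , eq′ = e , e∈ , entryMoves-sound arcs toks V e eq′

visits-appendˡ : ∀ {M V w} → Visits M w → Visits (append M V) w
visits-appendˡ (e , e∈ , eq) = e , ∈-append⁺ˡ e∈ , eq

visits-appendʳ : ∀ M {V w} → Visits V w → Visits (append M V) w
visits-appendʳ M (e , e∈ , eq) = e , ∈-append⁺ʳ M e∈ , eq

search-invariant : ∀ {arcs toks Ps} (Inv : Tree → Tree → Set) →
  (∀ {M V e} → Inv V e → Inv (append M V) e) →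
  (∀ {M V e} → e ∈ₜ V → (∀ {e} → e ∈ₜ V → Inv V e) → Move arcs toks V e M → ∀ {e′} → e′ ∈ₜ M → Inv (append M V) e′) →
  Inv (initial Ps) (hd (initial Ps)) →
  ∀ l {e} → e ∈ₜ search arcs toks Ps l → Inv (search arcs toks Ps l) e
search-invariant Inv mono move init nil here = init
search-invariant {arcs} {toks} {Ps} Inv mono move init (cons h t) {e} =
  expand-invariant (search arcs toks Ps t) (λ {e} → search-invariant Inv (λ {M} {V} {e} → mono {M} {V} {e}) move init t {e})
  where
  expand-invariant : ∀ V → (∀ {e} → e ∈ₜ V → Inv V e) → e ∈ₜ expand arcs toks V → Inv (expand arcs toks V) e
  expand-invariant V inv e∈ with moves arcs toks V in eq
  ... | nil = inv e∈
  ... | cons p q with ∈-append⁻ (cons p q) e∈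
  ...   | inj₂ e∈V = mono {cons p q} {V} (inv e∈V)
  ...   | inj₁ e∈M with moves-sound arcs toks V eq
  ...     | e₀ , e₀∈ , m = move e₀∈ inv m e∈M

module Search (arcs toks F₀ : Tree) (F₀⊆arcs : ∀ {x} → x ∈∈ F₀ → x ∈ₜ arcs) where

  -- Each entry has a rerouted path system of its own, while the cut is judged on the initial paths
  -- `F₀`. `kept` transfers a failed rerouting in an entry back to `F₀`; `added` does so for an arc
  -- that is refused because a path of the entry uses it; `behind` preserves `added` when `Q` is
  -- spliced into a path.
  record Entry (V e : Tree) : Set where
    field
      kept   : ∀ {P x y} → P ∈ₜ F₀ → Adjacent x y P → ¬ Visits V (tl y) →
               ∃[ P′ ] P′ ∈ₜ tl (tl e) × Adjacent x y P′
      added  : ∀ {x} → x ∈∈ tl (tl e) → x ∈∈ F₀ ⊎ Visits V (tl x)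
      behind : ∀ {x} → x ∈ₜ hd (tl e) → Visits V (tl x)
      Q⊆arcs : ∀ {x} → x ∈ₜ hd (tl e) → x ∈ₜ arcs
      P⊆arcs : ∀ {x} → x ∈∈ tl (tl e) → x ∈ₜ arcs
  open Entry

  entry-mono : ∀ {M V e} → Entry V e → Entry (append M V) e
  entry-mono {M} E = record
    { kept   = λ P∈ a ¬v → kept E P∈ a (¬v ∘ visits-appendʳ M)
    ; added  = λ x∈ → map₂ (visits-appendʳ M) (added E x∈)
    ; behind = λ x∈ → visits-appendʳ M (behind E x∈)
    ; Q⊆arcs = Q⊆arcs E
    ; P⊆arcs = P⊆arcs E
    }

  entry-move : ∀ {M V e} → e ∈ₜ V → (∀ {e} → e ∈ₜ V → Entry V e) → Move arcs toks V e M →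
               ∀ {e′} → e′ ∈ₜ M → Entry (append M V) e′
  entry-move {M} {V} {e} e∈ inv (fixed _ _ _ _) here = record
    { kept = kept E ; added = added E ; behind = behind E ; Q⊆arcs = Q⊆arcs E ; P⊆arcs = P⊆arcs E }
    where E = entry-mono {M} {V} {e} (inv e∈)
  entry-move {M} {V} {e} e∈ inv (push a∈ _ _ _ _) here = record
    { kept   = kept E
    ; added  = added E
    ; behind = λ { here → _ , here , refl ; (there x∈) → behind E x∈ }
    ; Q⊆arcs = λ { here → a∈ ; (there x∈) → Q⊆arcs E x∈ }
    ; P⊆arcs = P⊆arcs E }
    where E = entry-mono {M} {V} {e} (inv e∈)
  entry-move {V = V} {e} e∈ inv (path {Ps′} {B} r) e′∈ with prefixEntries-∈⁻ B e′∈
  ... | b , B′ , s , refl = record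
    { kept   = kept′
    ; added  = added′
    ; behind = λ x∈ → vB (Suffix-∈ s x∈)
    ; Q⊆arcs = λ x∈ → P⊆arcs E (rerouteSome-∈ᴮ r (Suffix-∈ s x∈))
    ; P⊆arcs = P⊆arcs′
    }
    where
    M = prefixEntries Ps′ B
    E = entry-mono {M} {V} {e} (inv e∈)
    vB : ∀ {x} → x ∈ₜ B → Visits (append M V) (tl x)
    vB x∈ = visits-appendˡ (prefixEntries-visits B x∈)
    kept′ : ∀ {P x y} → P ∈ₜ F₀ → Adjacent x y P → ¬ Visits (append M V) (tl y) → _
    kept′ P∈ a ¬v with kept E P∈ a ¬v
    ... | P₁ , P₁∈ , a₁ with rerouteSome-adjacent r P₁∈ a₁
    ...   | inj₁ res          = res
    ...   | inj₂ (inj₁ y∈B)   = ⊥-elim (¬v (vB y∈B))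
    ...   | inj₂ (inj₂ eq)    = ⊥-elim (¬v (visits-appendʳ M (e , e∈ , eq)))
    added′ : ∀ {x} → x ∈∈ Ps′ → x ∈∈ F₀ ⊎ Visits (append M V) (tl x)
    added′ x∈ with rerouteSome-∈ r x∈
    ... | inj₁ q = added E q
    ... | inj₂ q = inj₂ (behind E q)
    P⊆arcs′ : ∀ {x} → x ∈∈ Ps′ → x ∈ₜ arcs
    P⊆arcs′ x∈ with rerouteSome-∈ r x∈
    ... | inj₁ q = P⊆arcs E q
    ... | inj₂ q = Q⊆arcs E q

  entry-initial : Entry (initial F₀) (hd (initial F₀))
  entry-initial = record
    { kept = λ P∈ a _ → _ , P∈ , a ; added = inj₁ ; behind = λ () ; Q⊆arcs = λ () ; P⊆arcs = F₀⊆arcs }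

  search-entry : ∀ l {e} → e ∈ₜ search arcs toks F₀ l → Entry (search arcs toks F₀ l) e
  search-entry = search-invariant {arcs} {toks} {F₀} Entry
    (λ {M} {V} {e} → entry-mono {M} {V} {e}) entry-move entry-initial

  move-progress : ∀ {V e p q} → Entry V e → Move arcs toks V e (cons p q) →
    ∃[ a ] a ∈ₜ arcs × ¬ Visits V (tl a) × Visits (cons p q) (tl a)
  move-progress {V} {e} {p} {q} E m = go m refl
    where
    go : ∀ {M} → Move arcs toks V e M → M ≡ cons p q →
         ∃[ a ] a ∈ₜ arcs × ¬ Visits V (tl a) × Visits (cons p q) (tl a)
    go (fixed {a} a∈ _ ¬v _) refl = a , a∈ , ¬v , _ , here , refl
    go (push {a} a∈ _ ¬v _ _) refl = a , a∈ , ¬v , _ , here , refl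
    go (path {Ps′} r) eq with rerouteSome-unvisited r
    ... | y , B′ , refl , ¬v = y , P⊆arcs E (rerouteSome-∈ᴮ r here) , ¬v ,
      subst (λ M → Visits M (tl y)) eq (prefixEntries-visits {Ps′} (cons y B′) here)

  isNil : Tree → ℕ
  isNil nil        = 1
  isNil (cons _ _) = 0

  unvisited : Tree → Tree → ℕ
  unvisited V nil        = 0
  unvisited V (cons a l) = isNil (visited (tl a) V) + unvisited V l

  isNil-mono : ∀ {V V′} w → (Visits V w → Visits V′ w) → isNil (visited w V′) ≤ isNil (visited w V)
  isNil-mono {V} {V′} w h with visited w V in eq | visited w V′ in eq′
  ... | nil      | nil      = ≤-refl
  ... | nil      | cons _ _ = z≤n
  ... | cons _ _ | nil      = ⊥-elim (visited-complete {w} {V′} eq′ (h (visited-sound w V eq)))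
  ... | cons _ _ | cons _ _ = z≤n

  isNil-< : ∀ {V V′} w → ¬ Visits V w → Visits V′ w → isNil (visited w V′) < isNil (visited w V)
  isNil-< {V} {V′} w ¬v v with visited w V in eq | visited w V′ in eq′
  ... | nil      | cons _ _ = ≤-refl
  ... | nil      | nil      = ⊥-elim (visited-complete {w} {V′} eq′ v)
  ... | cons _ _ | _        = ⊥-elim (¬v (visited-sound w V eq))

  unvisited-mono : ∀ M V l → unvisited (append M V) l ≤ unvisited V l
  unvisited-mono M V nil        = z≤n
  unvisited-mono M V (cons a l) =
    +-mono-≤ (isNil-mono {V} {append M V} (tl a) (visits-appendʳ M)) (unvisited-mono M V l)

  unvisited-< : ∀ M V {a} l → a ∈ₜ l → ¬ Visits V (tl a) → Visits M (tl a) →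
                unvisited (append M V) l < unvisited V l
  unvisited-< M V (cons a l) here ¬v v =
    +-mono-<-≤ (isNil-< {V} {append M V} (tl a) ¬v (visits-appendˡ v)) (unvisited-mono M V l)
  unvisited-< M V (cons b l) (there a∈) ¬v v =
    +-mono-≤-< (isNil-mono {V} {append M V} (tl b) (visits-appendʳ M)) (unvisited-< M V l a∈ ¬v v)

  unvisited-≤ : ∀ V l → unvisited V l ≤ unvisited nil l
  unvisited-≤ V nil        = z≤n
  unvisited-≤ V (cons a l) = +-mono-≤ (isNil-mono {nil} {V} (tl a) (λ { (_ , () , _) })) (unvisited-≤ V l)

  expand-progress : ∀ V → (∀ {e} → e ∈ₜ V → Entry V e) →
    moves arcs toks V ≡ nil ⊎ unvisited (expand arcs toks V) arcs < unvisited V arcs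
  expand-progress V inv with moves arcs toks V in eq
  ... | nil = inj₁ refl
  ... | cons p q with moves-sound arcs toks V eq
  ...   | e , e∈ , m with move-progress (inv e∈) m
  ...     | a , a∈ , ¬v , v = inj₂ (unvisited-< (cons p q) V arcs a∈ ¬v v)

  -- `unvisited nil l` is the length of `l`, the number of steps made. Every step that is not idle
  -- visits the target of at least one more arc, so with `arcs` for `l` no arc is left to make
  -- progress on.
  Settled : Tree → Tree → Set
  Settled V l = moves arcs toks V ≡ nil ⊎ unvisited V arcs + unvisited nil l ≤ unvisited nil arcs

  closed-expand : ∀ V → moves arcs toks V ≡ nil → moves arcs toks (expand arcs toks V) ≡ nil
  closed-expand V eq = trans (cong (λ M → moves arcs toks (append M V)) eq) eq

  settled-expand : ∀ V h t → moves arcs toks V ≡ nil ⊎ unvisited (expand arcs toks V) arcs < unvisited V arcs →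
                   Settled V t → Settled (expand arcs toks V) (cons h t)
  settled-expand V h t (inj₁ eq) _         = inj₁ (closed-expand V eq)
  settled-expand V h t (inj₂ _)  (inj₁ eq) = inj₁ (closed-expand V eq)
  settled-expand V h t (inj₂ lt) (inj₂ le) =
    inj₂ (≤-trans (≤-reflexive (+-suc (unvisited (expand arcs toks V) arcs) (unvisited nil t)))
                  (≤-trans (+-monoˡ-≤ (unvisited nil t) lt) le))

  search-settled : ∀ l → Settled (search arcs toks F₀ l) l
  search-settled nil = inj₂ (≤-trans (≤-reflexive (+-identityʳ _)) (unvisited-≤ (initial F₀) arcs))
  search-settled (cons h t) = settled-expand (search arcs toks F₀ t) h t
    (expand-progress (search arcs toks F₀ t) (search-entry t)) (search-settled t)

  settled-closed : ∀ V → moves arcs toks V ≡ nil ⊎ unvisited (expand arcs toks V) arcs < unvisited V arcs →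
                   Settled V arcs → moves arcs toks V ≡ nil
  settled-closed V _         (inj₁ eq) = eq
  settled-closed V (inj₁ eq) (inj₂ _)  = eq
  settled-closed V (inj₂ lt) (inj₂ le) =
    ⊥-elim (n≮0 (≤-trans lt (+-cancelʳ-≤ (unvisited nil arcs) (unvisited V arcs) 0 le)))

  explore-closed : moves arcs toks (explore arcs toks F₀) ≡ nil
  explore-closed = settled-closed (explore arcs toks F₀)
    (expand-progress (explore arcs toks F₀) (search-entry arcs)) (search-settled arcs)

  module Closed (V : Tree) (entries : ∀ {e} → e ∈ₜ V → Entry V e) (closed : moves arcs toks V ≡ nil) where

    entry-closed : ∀ {e} → e ∈ₜ V → entryMoves arcs toks V e ≡ nil
    entry-closed = firstT-nil (λ e → entryMoves arcs toks V e) V closed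

    pathMoves-closed : ∀ {e} → e ∈ₜ V → rerouteSome (hd e) (hd (tl e)) V (tl (tl e)) ≡ nil
    pathMoves-closed {e} e∈ with rerouteSome (hd e) (hd (tl e)) V (tl (tl e)) in eq | entry-closed e∈
    ... | nil      | _ = refl
    ... | cons Ps′ B | eq′ with rerouteSome-unvisited (rerouteSome-sound (hd e) (hd (tl e)) V (tl (tl e)) eq)
    ...   | y , B′ , refl , _ with () ← eq′

    arcMove-closed : ∀ {e a} → e ∈ₜ V → a ∈ₜ arcs → arcMove V toks e a ≡ nil
    arcMove-closed {e} {a} e∈ a∈ = firstT-nil (λ a → arcMove V toks e a) arcs
      (subst (λ r → ifᵗ (ifᵗ r (prefixEntries (hd r) (tl r)) nil) (ifᵗ r (prefixEntries (hd r) (tl r)) nil)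
                        (firstT (λ a → arcMove V toks e a) arcs) ≡ nil)
             (pathMoves-closed e∈) (entry-closed e∈)) a∈

    Crosses : Tree → Set
    Crosses a = Visits V (hd a) × ¬ Visits V (tl a)

    -- The entry at the start of `a` refuses it. As the target is unvisited, the only possible
    -- reason is that `a` is deletable and on a path of the entry, and `added` moves this path to
    -- `F₀`.
    crossing-arc : ∀ {a} → a ∈ₜ arcs → Crosses a → a ∈∈ toks × a ∈∈ F₀
    crossing-arc {a} a∈ ((e , e∈ , eq) , ¬v) with arcMove-closed e∈ a∈
    ... | closed with eqᵗ (hd a) (hd e) in eq₁
    ...   | nil = ⊥-elim (eqᵗ-complete {hd a} eq₁ eq)
    ...   | cons _ _ with visited (tl a) V in eq₂
    ...     | cons _ _ = ⊥-elim (¬v (visited-sound (tl a) V eq₂))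
    ...     | nil with membIn a toks in eq₃
    ...       | nil with () ← closed
    ...       | cons _ _ with membIn a (tl (tl e)) in eq₄
    ...         | nil with () ← closed
    ...         | cons _ _ with added (entries e∈) (membIn-sound a (tl (tl e)) eq₄)
    ...           | inj₁ a∈F₀ = membIn-sound a toks eq₃ , a∈F₀
    ...           | inj₂ v    = ⊥-elim (¬v v)

    -- The visited vertices of a path form a prefix of it.
    adjacent-visited : ∀ {P x y} → P ∈ₜ F₀ → Adjacent x y P → Visits V (hd x) ⊎ Visits V (tl x) → Visits V (tl y)
    adjacent-visited {P} {x} {y} P∈ adj touch with visits? V (tl y)
    ... | yes v = v
    ... | no ¬v with touch
    ...   | inj₁ (e , e∈ , eq) with kept (entries e∈) P∈ adj ¬v
    ...     | P′ , P′∈ , adj′ = reroute-complete (hd e) (hd (tl e)) V P′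
                (rerouteSome-complete (hd e) (hd (tl e)) V (tl (tl e)) (pathMoves-closed e∈) P′∈) adj′ (inj₁ eq)
    adjacent-visited {P} {x} {y} P∈ adj touch | no ¬v | inj₂ (e , e∈ , eq) with kept (entries e∈) P∈ adj ¬v
    ...     | P′ , P′∈ , adj′ = reroute-complete (hd e) (hd (tl e)) V P′
                (rerouteSome-complete (hd e) (hd (tl e)) V (tl (tl e)) (pathMoves-closed e∈) P′∈) adj′ (inj₂ eq)

    -- The start of a crossing arc is visited, so by `adjacent-visited` all earlier arcs of the path
    -- have visited targets and do not cross.
    crossing-once : ∀ {P x x′} → P ∈ₜ F₀ → x ∈ₜ P → x′ ∈ₜ P → Crosses x → Crosses x′ → x ≡ x′
    crossing-once P∈ = once (adjacent-visited P∈)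
      where
      earlier : ∀ {x P} → (∀ {x y} → Adjacent x y P → Visits V (hd x) ⊎ Visits V (tl x) → Visits V (tl y)) →
                ∀ {B} → P ≡ cons x B → Visits V (hd x) ⊎ Visits V (tl x) → ∀ {x′} → x′ ∈ₜ B → Visits V (tl x′)
      earlier chain refl touch here      = chain here touch
      earlier chain {cons _ _} refl touch (there p) =
        earlier (λ a → chain (there a)) refl (inj₂ (chain here touch)) p
      once : ∀ {P x x′} → (∀ {x y} → Adjacent x y P → Visits V (hd x) ⊎ Visits V (tl x) → Visits V (tl y)) →
             x ∈ₜ P → x′ ∈ₜ P → Crosses x → Crosses x′ → x ≡ x′
      once chain here      here       _ _ = refl
      once chain here      (there p′) c c′ = ⊥-elim (proj₂ c′ (earlier chain refl (inj₁ (proj₁ c)) p′))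
      once chain (there p) here       c c′ = ⊥-elim (proj₂ c (earlier chain refl (inj₁ (proj₁ c′)) p))
      once chain (there p) (there p′) c c′ = once (λ a → chain (there a)) p p′ c c′

  source-visited : ∀ l → Visits (search arcs toks F₀ l) source
  source-visited nil        = _ , here , refl
  source-visited (cons h t) = visits-appendʳ (moves arcs toks (search arcs toks F₀ t)) (source-visited t)

-- Soundness: every answer is a cut respecting the budgets

len : Tree → ℕ
len nil        = 0
len (cons x l) = suc (len l)

_⊆ₜ_ : Tree → Tree → Set
A ⊆ₜ B = ∀ {x} → x ∈ₜ A → x ∈ₜ B

data Pointwise (R : Tree → Tree → Set) : Tree → Tree → Set where
  nil  : Pointwise R nil nil
  cons : ∀ {x y l m} → R x y → Pointwise R l m → Pointwise R (cons x l) (cons y m)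

pointwise-len : ∀ {R l m} → Pointwise R l m → len l ≡ len m
pointwise-len nil        = refl
pointwise-len (cons _ p) = cong suc (pointwise-len p)

pointwise-∈ : ∀ {R l m x} → Pointwise R l m → x ∈ₜ l → ∃[ y ] y ∈ₜ m × R x y
pointwise-∈ (cons r p) here       = _ , here , r
pointwise-∈ (cons r p) (there x∈) with pointwise-∈ p x∈
... | y , y∈ , r′ = y , there y∈ , r′

⊆-pointwise-refl : ∀ l → Pointwise _⊆ₜ_ l l
⊆-pointwise-refl nil        = nil
⊆-pointwise-refl (cons x l) = cons id (⊆-pointwise-refl l)

⊆-pointwise-trans : ∀ {k l m} → Pointwise _⊆ₜ_ k l → Pointwise _⊆ₜ_ l m → Pointwise _⊆ₜ_ k m
⊆-pointwise-trans nil        nil        = nil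
⊆-pointwise-trans (cons r p) (cons s q) = cons (s ∘ r) (⊆-pointwise-trans p q)

filterT-∈⁻ : ∀ F l {x} → x ∈ₜ filterT F l → x ∈ₜ l × ∃[ p ] ∃[ q ] F x ≡ cons p q
filterT-∈⁻ F (cons h t) x∈ with F h in eq
filterT-∈⁻ F (cons h t) x∈         | nil with filterT-∈⁻ F t x∈
... | y , z = there y , z
filterT-∈⁻ F (cons h t) here       | cons p q = here , p , q , eq
filterT-∈⁻ F (cons h t) (there x∈) | cons p q with filterT-∈⁻ F t x∈
... | y , z = there y , z

filterT-∈⁺ : ∀ F l {x p q} → x ∈ₜ l → F x ≡ cons p q → x ∈ₜ filterT F l
filterT-∈⁺ F (cons h t) x∈ eq with F h in eq′
filterT-∈⁺ F (cons h t) here       eq | nil with () ← trans (sym eq) eq′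
filterT-∈⁺ F (cons h t) (there x∈) eq | nil      = filterT-∈⁺ F t x∈ eq
filterT-∈⁺ F (cons h t) here       eq | cons _ _ = here
filterT-∈⁺ F (cons h t) (there x∈) eq | cons _ _ = there (filterT-∈⁺ F t x∈ eq)

Aligned : Tree → Tree → Set
Aligned P A = A ⊆ₜ P ⊎ (∀ {x} → x ∈ₜ A → ¬ x ∈ₜ P)

aligned-⊆ : ∀ {P A B} → B ⊆ₜ A → Aligned P A → Aligned P B
aligned-⊆ s (inj₁ a) = inj₁ (a ∘ s)
aligned-⊆ s (inj₂ a) = inj₂ (a ∘ s)

keep-⊆ : ∀ bit P A → keep bit P A ⊆ₜ A
keep-⊆ bit P A x∈ = proj₁ (filterT-∈⁻ (λ x → eqᵗ bit (memb x P)) A x∈)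

keep-bit : ∀ bit P A {x} → x ∈ₜ keep bit P A → bit ≡ memb x P
keep-bit bit P A {x} x∈ with filterT-∈⁻ (λ x → eqᵗ bit (memb x P)) A x∈
... | _ , _ , _ , eq = eqᵗ-sound bit (memb x P) eq

keep-aligned : ∀ bit P A → Aligned P (keep bit P A)
keep-aligned nil        P A = inj₂ (λ {x} x∈ → memb-complete x P (sym (keep-bit nil P A x∈)))
keep-aligned (cons b c) P A = inj₁ (λ {x} x∈ → memb-sound x P (sym (keep-bit (cons b c) P A x∈)))

refine1-⊆ : ∀ P toks w → Pointwise _⊆ₜ_ (hd (refine1 P toks w)) toks
refine1-⊆ P nil           w = nil
refine1-⊆ P (cons A toks) w = cons (keep-⊆ (hd (tl (refine1 P toks w))) P A) (refine1-⊆ P toks w)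

refine1-aligned : ∀ P toks w {A} → A ∈ₜ hd (refine1 P toks w) → Aligned P A
refine1-aligned P (cons A toks) w here       = keep-aligned (hd (tl (refine1 P toks w))) P A
refine1-aligned P (cons A toks) w (there A∈) = refine1-aligned P toks w A∈

refine-⊆ : ∀ Ps toks w → Pointwise _⊆ₜ_ (hd (refine Ps toks w)) toks
refine-⊆ nil         toks w = ⊆-pointwise-refl toks
refine-⊆ (cons P Ps) toks w = ⊆-pointwise-trans
  (refine1-⊆ P (hd (refine Ps toks w)) (tl (refine Ps toks w))) (refine-⊆ Ps toks w)

-- Refining with a further path only shrinks tokens, which preserves their alignment with the paths
-- already treated.
refine-aligned : ∀ Ps toks w {A P} → A ∈ₜ hd (refine Ps toks w) → P ∈ₜ Ps → Aligned P A
refine-aligned (cons P Ps) toks w A∈ here =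
  refine1-aligned P (hd (refine Ps toks w)) (tl (refine Ps toks w)) A∈
refine-aligned (cons P Ps) toks w A∈ (there P∈)
  with pointwise-∈ (refine1-⊆ P (hd (refine Ps toks w)) (tl (refine Ps toks w))) A∈
... | A′ , A′∈ , sub = aligned-⊆ sub (refine-aligned Ps toks w A′∈ P∈)

restrictPath : Tree → Tree → Tree
restrictPath toks P = filterT (λ x → membIn x toks) P

restrict-∈⁻ : ∀ toks Ps {P} → P ∈ₜ restrict toks Ps → ∃[ P₀ ] P₀ ∈ₜ Ps × P ≡ restrictPath toks P₀
restrict-∈⁻ toks (cons P Ps) here       = P , here , refl
restrict-∈⁻ toks (cons P Ps) (there P∈) with restrict-∈⁻ toks Ps P∈
... | P₀ , P₀∈ , eq = P₀ , there P₀∈ , eq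

restrict-∈∈ : ∀ toks Ps {x} → x ∈∈ restrict toks Ps → x ∈∈ Ps
restrict-∈∈ toks Ps (P , P∈ , x∈) with restrict-∈⁻ toks Ps P∈
... | P₀ , P₀∈ , refl = P₀ , P₀∈ , proj₁ (filterT-∈⁻ (λ x → membIn x toks) P₀ x∈)

∈∈-split : ∀ c {x} → x ∈∈ c → x ∈ₜ hd c ⊎ x ∈∈ tl c
∈∈-split (cons Q Ps) (_ , here , x∈)     = inj₁ x∈
∈∈-split (cons Q Ps) (P , there P∈ , x∈) = inj₂ (P , P∈ , x∈)

sinkEntry-complete : ∀ V → sinkEntry V ≡ nil → ∀ {c} → ¬ Visits V (cons c nil)
sinkEntry-complete V eq (cons (cons c nil) r , e∈ , refl) with firstT-nil (λ e → ifᵗ (tl (hd e)) nil e) V eq e∈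
... | ()

module Rounds (arcs N toks₀ : Tree) where

  record Separates (V toks : Tree) : Set where
    field
      source∈   : Visits V source
      sink∉     : ∀ {c} → ¬ Visits V (cons c nil)
      crossing∈ : ∀ {a} → a ∈ₜ arcs → Visits V (hd a) → ¬ Visits V (tl a) → a ∈∈ toks
      once      : ∀ {A a b} → A ∈ₜ toks → a ∈ₜ A → b ∈ₜ A → a ∈ₜ arcs → b ∈ₜ arcs →
                  Visits V (hd a) × ¬ Visits V (tl a) → Visits V (hd b) × ¬ Visits V (tl b) → a ≡ b
      tokens⊆   : Pointwise _⊆ₜ_ toks toks₀

  record Running (st : Tree) : Set where
    field
      running  : hd st ≡ nil
      paths⊆   : ∀ {x} → x ∈∈ hd (tl st) → x ∈ₜ arcs
      tokens⊆  : Pointwise _⊆ₜ_ (hd (tl (tl st))) toks₀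

  Final : Tree → Set
  Final st = ∃[ V ] ∃[ toks ] st ≡ cons tt (readout N V) × Separates V toks

  module _ (Ps toks : Tree) (F₀⊆arcs : ∀ {x} → x ∈∈ restrict toks Ps → x ∈ₜ arcs)
           (toks⊆ : Pointwise _⊆ₜ_ toks toks₀)
           (aligned : ∀ {A P} → A ∈ₜ toks → P ∈ₜ Ps → Aligned P A) where

    open Search arcs toks (restrict toks Ps) F₀⊆arcs

    explore-separates : ∀ V → Visits V source → (∀ {e} → e ∈ₜ V → Entry V e) → moves arcs toks V ≡ nil →
                        sinkEntry V ≡ nil → Separates V toks
    explore-separates V src entries closed noSink = record
      { source∈   = src
      ; sink∉     = sinkEntry-complete V noSink
      ; crossing∈ = λ a∈ v ¬v → proj₁ (crossing-arc a∈ (v , ¬v))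
      ; once      = once
      ; tokens⊆   = toks⊆
      }
      where
      open Closed V entries closed
      -- The crossing arc `a` lies on a path. The token is aligned with this path, hence contained
      -- in it, and `crossing-once` applies to its arcs.
      once : ∀ {A a b} → A ∈ₜ toks → a ∈ₜ A → b ∈ₜ A → a ∈ₜ arcs → b ∈ₜ arcs → Crosses a → Crosses b → a ≡ b
      once {A} {a} {b} A∈ a∈A b∈A a∈ b∈ ca cb with proj₂ (crossing-arc a∈ ca)
      ... | P , P∈ , a∈P with restrict-∈⁻ toks Ps P∈
      ...   | P₀ , P₀∈ , refl with aligned A∈ P₀∈
      ...     | inj₂ out = ⊥-elim (out a∈A (proj₁ (filterT-∈⁻ (λ x → membIn x toks) P₀ a∈P)))
      ...     | inj₁ inn with membIn b toks in eq
      ...       | nil      = ⊥-elim (membIn-complete b toks eq (A , A∈ , b∈A))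
      ...       | cons _ _ = crossing-once P∈ a∈P (filterT-∈⁺ (λ x → membIn x toks) P₀ (inn b∈A) eq) ca cb

    afterSearch-sound : ∀ r V → hd r ≡ toks → Visits V source → (∀ {e} → e ∈ₜ V → Entry V e) →
                        moves arcs toks V ≡ nil → Final (afterSearch N r V) ⊎ Running (afterSearch N r V)
    afterSearch-sound r V refl src entries closed with sinkEntry V in eq
    ... | nil = inj₁ (V , toks , refl , explore-separates V src entries closed eq)
    ... | cons z c = inj₂ (record
      { running = refl
      ; paths⊆  = λ x∈ → [ Entry.Q⊆arcs E , Entry.P⊆arcs E ] (∈∈-split c x∈)
      ; tokens⊆ = toks⊆ })
      where E = entries (proj₁ (sinkEntry-sound V eq))

    round-explore : ∀ r → hd r ≡ toks → Final (afterSearch N r (explore arcs toks (restrict toks Ps))) ⊎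
                                        Running (afterSearch N r (explore arcs toks (restrict toks Ps)))
    round-explore r eq = afterSearch-sound r (explore arcs toks (restrict toks Ps)) eq
      (source-visited arcs) (search-entry arcs) explore-closed

  round-sound : ∀ st → Running st → Final (round arcs N (tl st)) ⊎ Running (round arcs N (tl st))
  round-sound st R = round-explore Ps (hd r) (λ x∈ → Running.paths⊆ R (restrict-∈∈ (hd r) Ps x∈))
    (⊆-pointwise-trans (refine-⊆ Ps toks w) (Running.tokens⊆ R)) (refine-aligned Ps toks w) r refl
    where
    Ps   = hd (tl st)
    toks = hd (tl (tl st))
    w    = tl (tl (tl st))
    r    = refine Ps toks w

  step-sound : ∀ st → Final st ⊎ Running st →
    Final (ifᵗ (hd st) st (round arcs N (tl st))) ⊎ Running (ifᵗ (hd st) st (round arcs N (tl st)))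
  step-sound st (inj₁ (V , toks , refl , s)) = inj₁ (V , toks , refl , s)
  step-sound st (inj₂ R) =
    subst (λ h → Final (ifᵗ h st (round arcs N (tl st))) ⊎ Running (ifᵗ h st (round arcs N (tl st))))
          (sym (Running.running R)) (round-sound st R)

  start : Tree → Tree
  start w = cons nil (cons nil (cons toks₀ w))

  rounds-sound : ∀ w l → Final (rounds arcs N (start w) l) ⊎ Running (rounds arcs N (start w) l)
  rounds-sound w nil = inj₂ (record
    { running = refl ; paths⊆ = λ { (_ , () , _) } ; tokens⊆ = ⊆-pointwise-refl toks₀ })
  rounds-sound w (cons h t) = step-sound (rounds arcs N (start w) t) (rounds-sound w t)

  attempt-final : ∀ st {X q} → Final st ⊎ Running st → ifᵗ (hd st) (cons (tl st) nil) nil ≡ cons X q →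
    q ≡ nil × ∃[ V ] ∃[ toks ] X ≡ readout N V × Separates V toks
  attempt-final st (inj₁ (V , toks , refl , s)) refl = refl , V , toks , refl , s
  attempt-final st {X} {q} (inj₂ R) eq
    with () ← trans (sym eq) (cong (λ h → ifᵗ h (cons (tl st) nil) nil) (Running.running R))

  attempt-sound : ∀ w {X q} → attempt arcs N toks₀ w ≡ cons X q →
    q ≡ nil × ∃[ V ] ∃[ toks ] X ≡ readout N V × Separates V toks
  attempt-sound w = attempt-final (rounds arcs N (start w) (cons nil toks₀)) (rounds-sound w (cons nil toks₀))

-- Completeness: some guess succeeds

append-assoc : ∀ l m n → append (append l m) n ≡ append l (append m n)
append-assoc nil        m n = refl
append-assoc (cons h t) m n = cong (cons h) (append-assoc t m n)

append-len : ∀ l m → len (append l m) ≡ len l + len m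
append-len nil        m = refl
append-len (cons h t) m = cong suc (append-len t m)

data IsWord : Tree → Set where
  []  : IsWord nil
  _∷_ : ∀ {b w} → b ≡ nil ⊎ b ≡ tt → IsWord w → IsWord (cons b w)

append-isWord : ∀ {v w} → IsWord v → IsWord w → IsWord (append v w)
append-isWord []      q = q
append-isWord (b ∷ p) q = b ∷ append-isWord p q

eqᵗ-bit : ∀ x y → eqᵗ x y ≡ nil ⊎ eqᵗ x y ≡ tt
eqᵗ-bit x y with eqᵗ x y in eq
... | nil      = inj₁ refl
... | cons _ _ with refl ← eqᵗ-sound x y eq = inj₂ (trans (sym eq) (eqᵗ-refl x))

memb-bit : ∀ x l → memb x l ≡ nil ⊎ memb x l ≡ tt
memb-bit x nil = inj₁ refl
memb-bit x (cons h t) with eqᵗ x h | eqᵗ-bit x h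
... | nil      | _         = memb-bit x t
... | cons _ _ | inj₂ refl = inj₂ refl

wsum : (Tree → ℕ) → Tree → ℕ
wsum f nil        = 0
wsum f (cons x l) = f x + wsum f l

isCons : Tree → ℕ
isCons nil        = 0
isCons (cons _ _) = 1

count : Tree → Tree → ℕ
count x l = wsum (λ y → isCons (eqᵗ x y)) l

counts : Tree → Tree → ℕ
counts x ls = wsum (count x) ls

count-∉ : ∀ x l → ¬ x ∈ₜ l → count x l ≡ 0
count-∉ x nil _ = refl
count-∉ x (cons y l) x∉ with eqᵗ x y in eq
... | nil      = count-∉ x l (x∉ ∘ there)
... | cons _ _ = ⊥-elim (x∉ (subst (_∈ₜ cons y l) (sym (eqᵗ-sound x y eq)) here))

count-∈ : ∀ x l → x ∈ₜ l → 1 ≤ count x l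
count-∈ x (cons y l) here rewrite eqᵗ-refl x = s≤s z≤n
count-∈ x (cons y l) (there x∈) = ≤-trans (count-∈ x l x∈) (m≤n+m _ _)

counts-∉ : ∀ x ls → ¬ x ∈∈ ls → counts x ls ≡ 0
counts-∉ x nil _ = refl
counts-∉ x (cons l ls) x∉ = cong₂ _+_ (count-∉ x l (λ x∈ → x∉ (l , here , x∈)))
                                      (counts-∉ x ls (λ { (m , m∈ , x∈) → x∉ (m , there m∈ , x∈) }))

count-filterT : ∀ x F l → count x (filterT F l) ≤ count x l
count-filterT x F nil = z≤n
count-filterT x F (cons h t) with F h
... | nil      = ≤-trans (count-filterT x F t) (m≤n+m _ _)
... | cons _ _ = +-monoʳ-≤ (isCons (eqᵗ x h)) (count-filterT x F t)

count-suffix : ∀ x {l m} → Suffix l m → count x l ≤ count x m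
count-suffix x whole    = ≤-refl
count-suffix x (tail s) = ≤-trans (count-suffix x s) (m≤n+m _ _)

restrict-counts : ∀ x toks Ps → counts x (restrict toks Ps) ≤ counts x Ps
restrict-counts x toks nil         = z≤n
restrict-counts x toks (cons P Ps) =
  +-mono-≤ (count-filterT x (λ x → membIn x toks) P) (restrict-counts x toks Ps)

restrict-len : ∀ toks Ps → len (restrict toks Ps) ≡ len Ps
restrict-len toks nil         = refl
restrict-len toks (cons P Ps) = cong suc (restrict-len toks Ps)

rerouteSome-len : ∀ {z Q V Ps Ps′ B} → RerouteSome z Q V Ps Ps′ B → len Ps′ ≡ len Ps
rerouteSome-len (here _)  = refl
rerouteSome-len (there r) = cong suc (rerouteSome-len r)

wsum-mono : ∀ {f g} l → (∀ x → f x ≤ g x) → wsum f l ≤ wsum g l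
wsum-mono nil        h = z≤n
wsum-mono (cons x l) h = +-mono-≤ (h x) (wsum-mono l h)

wsum-+ : ∀ f g l → wsum (λ x → f x + g x) l ≡ wsum f l + wsum g l
wsum-+ f g nil        = refl
wsum-+ f g (cons x l) = trans (cong (f x + g x +_) (wsum-+ f g l)) (interchange (f x) (g x) _ _)
  where open import Algebra.Properties.CommutativeSemigroup +-commutativeSemigroup using (interchange)

wsum-∈ : ∀ f l {x} → x ∈ₜ l → f x ≤ wsum f l
wsum-∈ f (cons x l) here       = m≤m+n _ _
wsum-∈ f (cons y l) (there x∈) = ≤-trans (wsum-∈ f l x∈) (m≤n+m _ _)

wsum-1 : ∀ l → wsum (λ _ → 1) l ≡ len l
wsum-1 nil        = refl
wsum-1 (cons x l) = cong suc (wsum-1 l)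

-- A solution is given by the set val of the vertices on its source side and by
-- one (possibly irrelevant) arc in cs for each token.
module Solution (arcs N toks₀ cs : Tree) (val : Tree → Set) (val? : ∀ z → Dec (val z))
                (val-source : val source) (val-sink : ∀ z → tl z ≡ nil → ¬ val z)
                (cut∈cs : ∀ {a} → a ∈ₜ arcs → val (hd a) → ¬ val (tl a) → a ∈ₜ cs) where

  IsCut : Tree → Set
  IsCut a = val (hd a) × ¬ val (tl a)

  Hosts : Tree → Tree → Set
  Hosts c A = IsCut c → c ∈ₜ A

  -- If no arc of the path Q is cut, then Z holds.
  Leads : Tree → Set → Set
  Leads nil        Z = Z
  Leads (cons x Q) Z = (val (tl x) → Z) × Leads Q (val (hd x))

  leads-map : ∀ {Z Z′ : Set} Q → (Z → Z′) → Leads Q Z → Leads Q Z′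
  leads-map nil        f z       = f z
  leads-map (cons x Q) f (g , q) = f ∘ g , q

  leads-suffix : ∀ {Z b l m} → Suffix (cons b l) m → Leads m Z → Leads (cons b l) (val (tl b))
  leads-suffix whole    (_ , q) = id , q
  leads-suffix (tail s) (_ , q) = leads-suffix s q

  -- An arc that is not cut carries `val` from its start to its target, so the implications on its
  -- two sides compose.
  leads-filter : ∀ {Z} F P → (∀ {x} → x ∈ₜ P → F x ≡ nil → ¬ IsCut x) → Leads P Z → Leads (filterT F P) Z
  leads-filter F nil _ z = z
  leads-filter F (cons x P) h (g , q) with F x in eq
  ... | cons _ _ = g , leads-filter F P (h ∘ there) q
  ... | nil      = leads-map (filterT F P) (g ∘ through) (leads-filter F P (h ∘ there) q)
    where
    through : val (hd x) → val (tl x)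
    through v with val? (tl x)
    ... | yes v′ = v′
    ... | no ¬v′ = ⊥-elim (h here eq (v , ¬v′))

  -- Going backwards from the end of the path, the first arc whose start satisfies `val` is cut.
  leads-cut : ∀ {Z} P → Leads P Z → ¬ Z → ∃[ x ] x ∈ₜ P × IsCut x
  leads-cut nil        z       ¬z = ⊥-elim (¬z z)
  leads-cut (cons x P) (g , q) ¬z with val? (hd x)
  ... | yes v = x , here , v , ¬z ∘ g
  ... | no ¬v with leads-cut P q ¬v
  ...   | y , y∈ , cut = y , there y∈ , cut

  reroute-leads : ∀ {z Q V P P′ B Z} → Reroute z Q V P P′ B → Leads P Z → Leads Q (val z) →
                  Leads P′ Z × ∃[ Z′ ] Leads B Z′
  reroute-leads (leave refl _) (g , q) l = (g , l) , _ , q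
  reroute-leads {Q = Q} (enter refl _) (g , q) l = leads-map Q g l , _ , q
  reroute-leads (skip r)  (g , q) l with reroute-leads r q l
  ... | p′ , b = (g , p′) , b

  rerouteSome-leads : ∀ {z Q V Ps Ps′ B} → RerouteSome z Q V Ps Ps′ B →
    (∀ {P} → P ∈ₜ Ps → Leads P ⊥) → Leads Q (val z) →
    (∀ {P} → P ∈ₜ Ps′ → Leads P ⊥) × ∃[ Z′ ] Leads B Z′
  rerouteSome-leads (here r) ps l with reroute-leads r (ps here) l
  ... | p′ , b = (λ { here → p′ ; (there P∈) → ps (there P∈) }) , b
  rerouteSome-leads (there r) ps l with rerouteSome-leads r (ps ∘ there) l
  ... | ps′ , b = (λ { here → ps here ; (there P∈) → ps′ P∈ }) , b

  record Paths (λ′ : ℕ) (Ps : Tree) : Set where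
    field
      paths⊆   : ∀ {x} → x ∈∈ Ps → x ∈ₜ arcs
      leads    : ∀ {P} → P ∈ₜ Ps → Leads P ⊥
      disjoint : ∀ x → counts x Ps ≤ 1
      number   : len Ps ≡ λ′
  open Paths

  -- Double counting: every path contains a cut arc, this arc is a member of `cs`, and by
  -- disjointness each member of `cs` is on at most one path.
  few-paths : ∀ {m Ps} → Paths m Ps → m ≤ len cs
  few-paths {m} {Ps} p = begin
    m  ≡⟨ number p ⟨
    len Ps  ≤⟨ go Ps (leads p) (paths⊆ p) ⟩
    wsum (λ c → counts c Ps) cs  ≤⟨ wsum-mono cs (disjoint p) ⟩
    wsum (λ _ → 1) cs  ≡⟨ wsum-1 cs ⟩
    len cs  ∎
    where
    open ≤-Reasoning
    go : ∀ Ps → (∀ {P} → P ∈ₜ Ps → Leads P ⊥) → (∀ {x} → x ∈∈ Ps → x ∈ₜ arcs) →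
         len Ps ≤ wsum (λ c → counts c Ps) cs
    go nil _ _ = z≤n
    go (cons P Ps) l s with leads-cut P (l here) id
    ... | x , x∈ , v , ¬v = begin
      1 + len Ps
        ≤⟨ +-mono-≤ (≤-trans (count-∈ x P x∈) (wsum-∈ (λ c → count c P) cs (cut∈cs (s (P , here , x∈)) v ¬v)))
                    (go Ps (l ∘ there) (λ { (P′ , P′∈ , x∈′) → s (P′ , there P′∈ , x∈′) })) ⟩
      wsum (λ c → count c P) cs + wsum (λ c → counts c Ps) cs
        ≡⟨ wsum-+ (λ c → count c P) (λ c → counts c Ps) cs ⟨
      wsum (λ c → counts c (cons P Ps)) cs ∎

  hosts-∈ : ∀ {cs toks c} → Pointwise Hosts cs toks → c ∈ₜ cs → IsCut c → c ∈∈ toks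
  hosts-∈ hosts c∈ cut with pointwise-∈ hosts c∈
  ... | A , A∈ , h = A , A∈ , h cut

  restrict-paths : ∀ {m toks Ps} → Pointwise Hosts cs toks → Paths m Ps → Paths m (restrict toks Ps)
  restrict-paths {m} {toks} {Ps} hosts p = record
    { paths⊆   = λ x∈ → paths⊆ p (restrict-∈∈ toks Ps x∈)
    ; leads    = leads′
    ; disjoint = λ x → ≤-trans (restrict-counts x toks Ps) (disjoint p x)
    ; number   = trans (restrict-len toks Ps) (number p)
    }
    where
    leads′ : ∀ {P} → P ∈ₜ restrict toks Ps → Leads P ⊥
    leads′ P∈ with restrict-∈⁻ toks Ps P∈
    ... | P₀ , P₀∈ , refl = leads-filter (λ x → membIn x toks) P₀
      (λ {x} x∈ eq cut → membIn-complete x toks eq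
        (hosts-∈ hosts (cut∈cs (paths⊆ p (P₀ , P₀∈ , x∈)) (proj₁ cut) (proj₂ cut)) cut))
      (leads p P₀∈)

  -- The right bit for a token with cut arc `c` tells whether `c` is on `P`; it keeps `c` in the
  -- token. The quantifier over `v` makes the result independent of the guesses not yet read.
  refine1-hosts : ∀ P {cs toks} → Pointwise Hosts cs toks → ∃[ w ] ∃[ toks′ ]
    (∀ v → refine1 P toks (append w v) ≡ cons toks′ v) × Pointwise Hosts cs toks′ × IsWord w × len w ≡ len toks
  refine1-hosts P nil = nil , nil , (λ _ → refl) , nil , [] , refl
  refine1-hosts P {cons c cs} {cons A toks} (cons h hosts) with refine1-hosts P hosts
  ... | w , toks′ , eq , hosts′ , word , l =
    -- The fold treats the later tokens before `A`, so the bit of `A` is read last.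
    append w (cons bit nil) , cons (keep bit P A) toks′
    , (λ v → trans (cong (λ r → cons (cons (keep (hd (tl r)) P A) (hd r)) (tl (tl r)))
                         (trans (cong (refine1 P toks) (append-assoc w (cons bit nil) v)) (eq (cons bit v)))) refl)
    , cons (λ cut → filterT-∈⁺ (λ x → eqᵗ bit (memb x P)) A (h cut) (eqᵗ-refl bit)) hosts′
    , append-isWord word (memb-bit c P ∷ [])
    , trans (append-len w (cons bit nil)) (trans (+-comm (len w) 1) (cong suc l))
    where
    bit : Tree
    bit = memb c P

  refine-hosts : ∀ Ps {toks} → Pointwise Hosts cs toks → ∃[ w ] ∃[ toks′ ]
    (∀ v → refine Ps toks (append w v) ≡ cons toks′ v) × Pointwise Hosts cs toks′ × IsWord w ×
    len w ≡ len Ps * len cs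
  refine-hosts nil {toks} hosts = nil , toks , (λ _ → refl) , hosts , [] , refl
  refine-hosts (cons P Ps) {toks} hosts with refine-hosts Ps hosts
  ... | w , toks′ , eq , hosts′ , word , l with refine1-hosts P hosts′
  ...   | w₁ , toks″ , eq₁ , hosts″ , word₁ , l₁ =
    append w w₁ , toks″
    , (λ v → trans (cong (λ r → refine1 P (hd r) (tl r))
                         (trans (cong (refine Ps toks) (append-assoc w w₁ v)) (eq (append w₁ v)))) (eq₁ v))
    , hosts″ , append-isWord word word₁
    , trans (append-len w w₁) (trans (cong₂ _+_ l (trans l₁ (sym (pointwise-len hosts′)))) (+-comm (len Ps * len cs) (len cs)))

  module _ {m : ℕ} (Ps toks : Tree) (hosts : Pointwise Hosts cs toks) (paths : Paths m Ps) where

    open Search arcs toks Ps (paths⊆ paths)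

    record Leading (V e : Tree) : Set where
      field
        entry   : Entry V e
        shape   : tl e ≡ cons (hd (tl e)) (tl (tl e))
        here-Q  : Leads (hd (tl e)) (val (hd e))
        here-Ps : ∀ {P} → P ∈ₜ tl (tl e) → Leads P ⊥
        simple  : ∀ x → count x (hd (tl e)) + counts x (tl (tl e)) ≤ 1
        many    : len (tl (tl e)) ≡ m
    open Leading

    leading-mono : ∀ {M V e} → Leading V e → Leading (append M V) e
    leading-mono {M} {V} {e} L = record
      { entry = entry-mono {M} {V} {e} (entry L) ; shape = shape L ; here-Q = here-Q L
      ; here-Ps = here-Ps L ; simple = simple L ; many = many L }

    leading-move : ∀ {M V e} → e ∈ₜ V → (∀ {e} → e ∈ₜ V → Leading V e) → Move arcs toks V e M →
                   ∀ {e′} → e′ ∈ₜ M → Leading (append M V) e′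
    leading-move {M} {V} {e} e∈ inv mv@(fixed {a} a∈ eq ¬v a∉) here = record
      { entry   = entry-move e∈ (λ e∈ → entry (inv e∈)) mv here
      ; shape   = shape L
      ; here-Q  = leads-map (hd (tl e)) through (here-Q L)
      ; here-Ps = here-Ps L ; simple = simple L ; many = many L }
      where
      L = inv e∈
      -- If the arc were cut, some token would host it, but an undeletable arc is in no token.
      through : val (hd e) → val (tl a)
      through v with val? (tl a)
      ... | yes v′ = v′
      ... | no ¬v′ = ⊥-elim (a∉ (hosts-∈ hosts (cut∈cs a∈ v″ ¬v′) (v″ , ¬v′)))
        where v″ = subst val (sym eq) v
    leading-move {M} {V} {e} e∈ inv mv@(push {a} a∈ eq ¬v a∈toks a∉) here = record
      { entry   = entry-move e∈ (λ e∈ → entry (inv e∈)) mv here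
      ; shape   = refl
      ; here-Q  = id , subst (λ z → Leads (hd (tl e)) (val z)) (sym eq) (here-Q L)
      ; here-Ps = here-Ps L ; simple = simple′ ; many = many L }
      where
      L = inv e∈
      simple′ : ∀ x → count x (cons a (hd (tl e))) + counts x (tl (tl e)) ≤ 1
      simple′ x with eqᵗ x a in eq′
      ... | nil = simple L x
      -- The pushed arc is on no complete path by the test, and not on `Q` because the arcs of `Q`
      -- have visited targets.
      ... | cons _ _ with refl ← eqᵗ-sound x a eq′ = s≤s (≤-reflexive (cong₂ _+_
        (count-∉ x (hd (tl e)) (λ x∈ → ¬v (Entry.behind (entry L) x∈))) (counts-∉ x (tl (tl e)) a∉)))
    leading-move {V = V} {e} e∈ inv mv@(path {Ps′} {B} r) e′∈
      with prefixEntries-∈⁻ B e′∈ | rerouteSome-leads r (here-Ps (inv e∈)) (here-Q (inv e∈))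
    ... | b , B′ , s , refl | ps′ , _ , lB = record
      { entry   = entry-move e∈ (λ e∈ → entry (inv e∈)) mv e′∈
      ; shape   = refl
      ; here-Q  = leads-suffix s lB
      ; here-Ps = ps′
      ; simple  = simple′
      ; many    = trans (rerouteSome-len r) (many (inv e∈)) }
      where
      open ≤-Reasoning
      simple′ : ∀ x → count x (cons b B′) + counts x Ps′ ≤ 1
      simple′ x = begin
        count x (cons b B′) + counts x Ps′  ≤⟨ +-monoˡ-≤ (counts x Ps′) (count-suffix x s) ⟩
        count x B + counts x Ps′  ≡⟨ +-comm (count x B) _ ⟩
        -- With the indicator of `x` as weight, rerouting does not increase the multiplicity of `x`.
        counts x Ps′ + count x B  ≤⟨ rerouteSome-weight {λ y → isCons (eqᵗ x y)} {count x} {counts x} {0}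
                                                              (λ _ _ → refl) (λ _ _ → refl) r ⟩
        counts x (tl (tl e)) + count x (hd (tl e))  ≡⟨ +-comm (counts x (tl (tl e))) _ ⟩
        count x (hd (tl e)) + counts x (tl (tl e))  ≤⟨ simple (inv e∈) x ⟩
        1  ∎

    search-leading : ∀ l {e} → e ∈ₜ search arcs toks Ps l → Leading (search arcs toks Ps l) e
    search-leading = search-invariant {arcs} {toks} {Ps} Leading
      (λ {M} {V} {e} → leading-mono {M} {V} {e}) leading-move
      (record { entry = entry-initial ; shape = refl ; here-Q = val-source ; here-Ps = leads paths
              ; simple = disjoint paths ; many = number paths })

    afterSearch-complete : ∀ V → (∀ {e} → e ∈ₜ V → Leading V e) →
      (∀ v → hd (afterSearch N (cons toks v) V) ≡ tt) ⊎
      ∃[ Ps′ ] (∀ v → afterSearch N (cons toks v) V ≡ cons nil (cons Ps′ (cons toks v))) × Paths (suc m) Ps′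
    afterSearch-complete V inv with sinkEntry V in eq
    ... | nil = inj₁ (λ _ → refl)
    ... | cons z c with sinkEntry-sound V eq
    ...   | e∈ , sink = inj₂ (c , (λ _ → refl) , record
      { paths⊆   = λ x∈ → [ Entry.Q⊆arcs (entry L) , Entry.P⊆arcs (entry L) ] (∈∈-split c x∈)
      ; leads    = λ P∈ → split (shape L) P∈
      ; disjoint = λ x → subst (λ c → counts x c ≤ 1) (sym (shape L)) (simple L x)
      ; number   = trans (cong len (shape L)) (cong suc (many L)) })
      where
      L = inv e∈
      split : ∀ {c′ P} → c′ ≡ cons (hd c) (tl c) → P ∈ₜ c′ → Leads P ⊥
      split refl here       = leads-map (hd c) (val-sink z sink) (here-Q L)
      split refl (there P∈) = here-Ps L P∈

    explore-complete :
      (∀ v → hd (afterSearch N (cons toks v) (explore arcs toks Ps)) ≡ tt) ⊎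
      ∃[ Ps′ ] (∀ v → afterSearch N (cons toks v) (explore arcs toks Ps) ≡ cons nil (cons Ps′ (cons toks v))) ×
        Paths (suc m) Ps′
    explore-complete = afterSearch-complete (explore arcs toks Ps) (search-leading arcs)

  -- The run f, which depends on the guess, is final for all guesses starting
  -- with w or has found m paths, and then w is what it has consumed.
  Outcome : (Tree → Tree) → ℕ → Tree → Set
  Outcome f m w = (∀ v → hd (f (append w v)) ≡ tt) ⊎
    ∃[ Ps ] ∃[ toks ] (∀ v → f (append w v) ≡ cons nil (cons Ps (cons toks v))) ×
      Pointwise Hosts cs toks × Paths m Ps

  round-complete : ∀ {m Ps toks} → Pointwise Hosts cs toks → Paths m Ps → ∃[ w ] IsWord w × len w ≡ m * len cs ×
    Outcome (λ u → round arcs N (cons Ps (cons toks u))) (suc m) w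
  round-complete {m} {Ps} {toks} hosts paths with refine-hosts Ps hosts
  ... | w , toks′ , eq , hosts′ , word , l =
    w , word , trans l (cong (_* len cs) (number paths)) ,
    [ (λ h → inj₁ (λ v → trans (cong hd (after v)) (h v)))
    , (λ { (Ps′ , h , p) → inj₂ (Ps′ , toks′ , (λ v → trans (after v) (h v)) , hosts′ , p) })
    ] (explore-complete (restrict toks′ Ps) toks′ hosts′ (restrict-paths hosts′ paths))
    where
    after : ∀ v → round arcs N (cons Ps (cons toks (append w v))) ≡
                  afterSearch N (cons toks′ v) (explore arcs toks′ (restrict toks′ Ps))
    after v = cong (λ r → afterSearch N r (explore arcs (hd r) (restrict (hd r) Ps))) (eq v)

  open Rounds arcs N toks₀ using (start)

  continue : Tree → Tree
  continue st = ifᵗ (hd st) st (round arcs N (tl st))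

  run : Tree → Tree → Tree
  run l u = rounds arcs N (start u) l

  Run : Tree → Set
  Run l = ∃[ w ] IsWord w × len w ≤ len l * (len cs * len cs) × Outcome (run l) (len l) w

  run-final : ∀ st → hd st ≡ tt → hd (continue st) ≡ tt
  run-final st eq = trans (cong (λ h → hd (ifᵗ h st (round arcs N (tl st)))) eq) eq

  run-round : ∀ h t {w w₁ Ps toks} → (∀ v → run t (append w v) ≡ cons nil (cons Ps (cons toks v))) →
    Outcome (λ u → round arcs N (cons Ps (cons toks u))) (suc (len t)) w₁ →
    Outcome (run (cons h t)) (suc (len t)) (append w w₁)
  run-round h t {w} {w₁} {Ps} {toks} eq = λ
    { (inj₁ done) → inj₁ (λ v → trans (cong (λ st → hd (continue st)) (before v)) (done v))
    ; (inj₂ (Ps′ , toks′ , eq′ , rest)) →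
        inj₂ (Ps′ , toks′ , (λ v → trans (cong continue (before v)) (eq′ v)) , rest) }
    where
    before : ∀ v → run t (append (append w w₁) v) ≡ cons nil (cons Ps (cons toks (append w₁ v)))
    before v = trans (cong (run t) (append-assoc w w₁ v)) (eq (append w₁ v))

  run-step : ∀ h t → Run t → Run (cons h t)
  run-step h t (w , word , l , inj₁ done) =
    w , word , ≤-trans l (m≤n+m _ _) , inj₁ (λ v → run-final (run t (append w v)) (done v))
  run-step h t (w , word , l , inj₂ (Ps , toks , eq , hosts′ , paths)) = extend (round-complete hosts′ paths)
    where
    open ≤-Reasoning
    extend : (∃[ w₁ ] IsWord w₁ × len w₁ ≡ len t * len cs ×
              Outcome (λ u → round arcs N (cons Ps (cons toks u))) (suc (len t)) w₁) → Run (cons h t)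
    extend (w₁ , word₁ , l₁ , res) = append w w₁ , append-isWord word word₁ , l′ , run-round h t {w} {w₁} eq res
      where
      l′ : len (append w w₁) ≤ len cs * len cs + len t * (len cs * len cs)
      l′ = begin
        len (append w w₁)  ≡⟨ append-len w w₁ ⟩
        -- A round reads one bit per path and token, and `few-paths` bounds the number of paths by
        -- `len cs`.
        len w + len w₁  ≤⟨ +-mono-≤ l (≤-trans (≤-reflexive l₁) (*-monoˡ-≤ (len cs) (few-paths paths))) ⟩
        len t * (len cs * len cs) + len cs * len cs  ≡⟨ +-comm (len t * (len cs * len cs)) _ ⟩
        len cs * len cs + len t * (len cs * len cs)  ∎

  run-complete : Pointwise Hosts cs toks₀ → ∀ l → Run l
  run-complete hosts nil = nil , [] , z≤n , inj₂ (nil , toks₀ , (λ _ → refl) , hosts , record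
    { paths⊆ = λ { (_ , () , _) } ; leads = λ () ; disjoint = λ _ → z≤n ; number = refl })
  run-complete hosts (cons h t) = run-step h t (run-complete hosts t)

  answer : ∀ st → hd st ≡ tt → ∃[ p ] ∃[ q ] ifᵗ (hd st) (cons (tl st) nil) nil ≡ cons p q
  answer st eq = tl st , nil , cong (λ h → ifᵗ h (cons (tl st) nil) nil) eq

  Success : Tree → Set
  Success w = ∀ v → ∃[ p ] ∃[ q ] attempt arcs N toks₀ (append w v) ≡ cons p q

  -- A run that is still not final after one round more than there are tokens would have found more
  -- paths than `few-paths` allows.
  attempt-complete : Pointwise Hosts cs toks₀ →
    ∃[ w ] IsWord w × len w ≤ suc (len cs) * (len cs * len cs) × Success w
  attempt-complete hosts = conclude (run-complete hosts (cons nil toks₀))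
    where
    conclude : Run (cons nil toks₀) → ∃[ w ] IsWord w × len w ≤ suc (len cs) * (len cs * len cs) × Success w
    conclude (w , word , l , inj₁ done) =
      w , word , ≤-trans l (≤-reflexive (cong (λ n → suc n * (len cs * len cs)) (sym (pointwise-len hosts)))) ,
      λ v → answer (run (cons nil toks₀) (append w v)) (done v)
    conclude (w , word , l , inj₂ (_ , _ , _ , _ , paths)) =
      ⊥-elim (1+n≰n (≤-trans (few-paths paths) (≤-reflexive (pointwise-len hosts))))

-- Instances and their encodings

mapT-const-∈ : ∀ b {w} l → w ∈ₜ l → cons b w ∈ₜ mapT (λ w _ → cons b w) l
mapT-const-∈ b (cons _ _) here       = here
mapT-const-∈ b (cons _ l) (there w∈) = there (mapT-const-∈ b l w∈)

allWords-∈ : ∀ {w} l → IsWord w → len w ≡ len l → w ∈ₜ allWords l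
allWords-∈ nil        []               _  = here
allWords-∈ (cons h t) (inj₁ refl ∷ p) eq =
  ∈-append⁺ˡ (mapT-const-∈ nil (allWords t) (allWords-∈ t p (suc-injective eq)))
allWords-∈ (cons h t) (inj₂ refl ∷ p) eq =
  ∈-append⁺ʳ (mapT (λ w _ → cons nil w) (allWords t))
             (mapT-const-∈ tt (allWords t) (allWords-∈ t p (suc-injective eq)))

encodeℕ-isWord : ∀ n → IsWord (encodeℕ n)
encodeℕ-isWord zero    = []
encodeℕ-isWord (suc n) = inj₁ refl ∷ encodeℕ-isWord n

len-encodeℕ : ∀ n → len (encodeℕ n) ≡ n
len-encodeℕ zero    = refl
len-encodeℕ (suc n) = cong suc (len-encodeℕ n)

encodeℕ-injective : ∀ {m n} → encodeℕ m ≡ encodeℕ n → m ≡ n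
encodeℕ-injective {m} {n} eq = trans (sym (len-encodeℕ m)) (trans (cong len eq) (len-encodeℕ n))

tab : ∀ {n} → (Fin n → Tree) → Tree
tab {zero}  f = nil
tab {suc n} f = cons (f zero) (tab (f ∘ suc))

tab-cong : ∀ {n} {f g : Fin n → Tree} → (∀ i → f i ≡ g i) → tab f ≡ tab g
tab-cong {zero}  h = refl
tab-cong {suc n} h = cong₂ cons (h zero) (tab-cong (h ∘ suc))

encodeFun-tab : ∀ {A : Set} {n} (enc : A → Tree) (f : Fin n → A) → encodeFun enc f ≡ tab (enc ∘ f)
encodeFun-tab {n = zero}  enc f = refl
encodeFun-tab {n = suc n} enc f = cong (cons (enc (f zero))) (encodeFun-tab enc (f ∘ suc))

flat : Tree → Tree
flat l = concatMapT (λ h _ → h) l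

flat-tab-∈⁻ : ∀ {n x} (f : Fin n → Tree) → x ∈ₜ flat (tab f) → ∃[ i ] x ∈ₜ f i
flat-tab-∈⁻ {suc n} f x∈ with ∈-append⁻ (f zero) x∈
... | inj₁ p = zero , p
... | inj₂ p with flat-tab-∈⁻ (f ∘ suc) p
...   | i , q = suc i , q

flat-tab-∈⁺ : ∀ {n x} (f : Fin n → Tree) i → x ∈ₜ f i → x ∈ₜ flat (tab f)
flat-tab-∈⁺ f zero    x∈ = ∈-append⁺ˡ x∈
flat-tab-∈⁺ f (suc i) x∈ = ∈-append⁺ʳ (f zero) (flat-tab-∈⁺ (f ∘ suc) i x∈)

tl-encodeℕ : ∀ m → tl (encodeℕ m) ≡ encodeℕ (m ∸ 1)
tl-encodeℕ zero    = refl
tl-encodeℕ (suc m) = refl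

index-tab : ∀ m {n} (f : Fin n → Tree) → index (encodeℕ m) (tab f) ≡ encodeℕ (m ∸ n)
index-tab m {zero}  f = refl
index-tab m {suc n} f = begin
  tl (index (encodeℕ m) (tab (f ∘ suc)))  ≡⟨ cong tl (index-tab m (f ∘ suc)) ⟩
  tl (encodeℕ (m ∸ n))  ≡⟨ tl-encodeℕ (m ∸ n) ⟩
  encodeℕ (m ∸ n ∸ 1)  ≡⟨ cong encodeℕ (∸-+-assoc m n 1) ⟩
  encodeℕ (m ∸ (n + 1))  ≡⟨ cong (λ l → encodeℕ (m ∸ l)) (+-comm n 1) ⟩
  encodeℕ (m ∸ suc n)  ∎
  where open ≡-Reasoning

position : ℕ → ∀ {n} → Fin n → Tree
position m {n} i = encodeℕ (m ∸ (n ∸ suc (toℕ i)))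

concatMap-index : ∀ m {n} (G : Tree → Tree → Tree) (f : Fin n → Tree) →
  concatMapT (λ h t → G (index (encodeℕ m) t) h) (tab f) ≡ flat (tab (λ i → G (position m i) (f i)))
concatMap-index m {zero}  G f = refl
concatMap-index m {suc n} G f = cong₂ append (cong (λ j → G j (f zero)) (index-tab m (f ∘ suc)))
                                             (concatMap-index m G (f ∘ suc))

map-index : ∀ m {n} (G : Tree → Tree) (f : Fin n → Tree) →
  mapT (λ _ t → G (index (encodeℕ m) t)) (tab f) ≡ tab {n} (λ i → G (position m i))
map-index m {zero}  G f = refl
map-index m {suc n} G f = cong₂ cons (cong G (index-tab m (f ∘ suc))) (map-index m {n} G (f ∘ suc))

encodeℕ-tab : ∀ n → encodeℕ n ≡ tab {n} (λ _ → nil)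
encodeℕ-tab zero    = refl
encodeℕ-tab (suc n) = cong (cons nil) (encodeℕ-tab n)

position-suc : ∀ {n} (i : Fin n) → position n i ≡ encodeℕ (suc (toℕ i))
position-suc {n} i = cong encodeℕ (m∸[m∸n]≡n (toℕ<n i))

position-pred : ∀ {b} (j : Fin (suc b)) → position b j ≡ encodeℕ (toℕ j)
position-pred {b} j = cong encodeℕ (m∸[m∸n]≡n (≤-pred (toℕ<n j)))

mapT-const-pointwise : ∀ {R c A} d → (∀ {x} → x ∈ₜ c → R x A) → len c ≡ d →
                       Pointwise R c (mapT (λ _ _ → A) (encodeℕ d))
mapT-const-pointwise {c = nil}      zero    h eq = nil
mapT-const-pointwise {c = cons _ _} (suc d) h eq =
  cons (h here) (mapT-const-pointwise d (h ∘ there) (suc-injective eq))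

mapT-const-∈⁻ : ∀ {A B} d → A ∈ₜ mapT (λ _ _ → B) (encodeℕ d) → A ≡ B
mapT-const-∈⁻ (suc d) here       = refl
mapT-const-∈⁻ (suc d) (there A∈) = mapT-const-∈⁻ d A∈

mapT-const-len : ∀ {B} d → len (mapT (λ _ _ → B) (encodeℕ d)) ≡ d
mapT-const-len zero    = refl
mapT-const-len (suc d) = cong suc (mapT-const-len d)

pointwise-append : ∀ {R k l m n} → Pointwise R k m → Pointwise R l n → Pointwise R (append k l) (append m n)
pointwise-append nil        q = q
pointwise-append (cons r p) q = cons r (pointwise-append p q)

pointwise-flat : ∀ {R n} {f g : Fin n → Tree} → (∀ i → Pointwise R (f i) (g i)) →
                 Pointwise R (flat (tab f)) (flat (tab g))
pointwise-flat {n = zero}  h = nil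
pointwise-flat {n = suc n} h = pointwise-append (h zero) (pointwise-flat (h ∘ suc))

pointwise-append⁻ : ∀ {R l n} m → Pointwise R l (append m n) →
  ∃[ l₁ ] ∃[ l₂ ] l ≡ append l₁ l₂ × Pointwise R l₁ m × Pointwise R l₂ n
pointwise-append⁻ nil p = nil , _ , refl , nil , p
pointwise-append⁻ (cons x m) (cons r p) with pointwise-append⁻ m p
... | l₁ , l₂ , refl , p₁ , p₂ = _ , l₂ , refl , cons r p₁ , p₂

pointwise-flat⁻ : ∀ {R l n} (g : Fin n → Tree) → Pointwise R l (flat (tab g)) →
  ∃[ f ] l ≡ flat (tab f) × (∀ i → Pointwise R (f i) (g i))
pointwise-flat⁻ {n = zero}  g nil = (λ ()) , refl , (λ ())
pointwise-flat⁻ {n = suc n} g p with pointwise-append⁻ (g zero) p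
... | l₁ , l₂ , refl , p₁ , p₂ with pointwise-flat⁻ (g ∘ suc) p₂
...   | f , refl , q = (λ { zero → l₁ ; (suc i) → f i }) , refl , (λ { zero → p₁ ; (suc i) → q i })

flat-len : ∀ {n} m (f : Fin n → Tree) → (∀ i → len (f i) ≡ m) → len (flat (tab f)) ≡ n * m
flat-len {zero}  m f h = refl
flat-len {suc n} m f h = trans (append-len (f zero) _) (cong₂ _+_ (h zero) (flat-len m (f ∘ suc) (h ∘ suc)))

place : ∀ {x l} → x ∈ₜ l → Fin (len l)
place here      = zero
place (there p) = suc (place p)

place-injective : ∀ {x y l} (p : x ∈ₜ l) (q : y ∈ₜ l) → place p ≡ place q → x ≡ y
place-injective here      here      _    = refl
place-injective (there p) (there q) eq = place-injective p q (Fin-suc-injective eq)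

-- `φ` takes the membership proof because a token is assigned only to members of the symmetric
-- difference.
card-≤ : ∀ {n m} (p : Subset n) (φ : ∀ v → v ∈ˢ p → Fin m) →
         (∀ {v w} (v∈ : v ∈ˢ p) (w∈ : w ∈ˢ p) → φ v v∈ ≡ φ w w∈ → v ≡ w) → ∣ p ∣ ≤ m
card-≤ []            φ inj = z≤n
card-≤ (outside ∷ p) φ inj =
  card-≤ p (λ v v∈ → φ (suc v) (there v∈)) (λ v∈ w∈ eq → Fin-suc-injective (inj (there v∈) (there w∈) eq))
card-≤ {m = zero}  (inside ∷ p) φ inj with () ← φ zero here
card-≤ {m = suc m} (inside ∷ p) φ inj = s≤s (card-≤ p
  (λ v v∈ → punchOut (apart v v∈))
  (λ {v} {w} v∈ w∈ eq → Fin-suc-injective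
    (inj (there v∈) (there w∈) (punchOut-injective (apart v v∈) (apart w w∈) eq))))
  where
  apart : ∀ v (v∈ : v ∈ˢ p) → φ zero here ≢ φ (suc v) (there v∈)
  apart v v∈ eq with () ← inj here (there v∈) eq

elements : ∀ {n} → Subset n → (Fin n → Tree) → Tree
elements []            f = nil
elements (inside ∷ p)  f = cons (f zero) (elements p (f ∘ suc))
elements (outside ∷ p) f = elements p (f ∘ suc)

elements-len : ∀ {n} (p : Subset n) f → len (elements p f) ≡ ∣ p ∣
elements-len []            f = refl
elements-len (inside ∷ p)  f = cong suc (elements-len p (f ∘ suc))
elements-len (outside ∷ p) f = elements-len p (f ∘ suc)

elements-∈⁺ : ∀ {n v} (p : Subset n) f → v ∈ˢ p → f v ∈ₜ elements p f
elements-∈⁺ (inside ∷ p)  f here       = here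
elements-∈⁺ (inside ∷ p)  f (there v∈) = there (elements-∈⁺ p (f ∘ suc) v∈)
elements-∈⁺ (outside ∷ p) f (there v∈) = elements-∈⁺ p (f ∘ suc) v∈

elements-∈⁻ : ∀ {n x} (p : Subset n) f → x ∈ₜ elements p f → ∃[ v ] x ≡ f v
elements-∈⁻ (inside ∷ p)  f here = zero , refl
elements-∈⁻ (inside ∷ p)  f (there x∈) with elements-∈⁻ p (f ∘ suc) x∈
... | v , eq = suc v , eq
elements-∈⁻ (outside ∷ p) f x∈ with elements-∈⁻ p (f ∘ suc) x∈
... | v , eq = suc v , eq

-- Tokens without a cut arc receive the dummy arc `nil`. Its start is `nil`, which counts as a sink
-- and so is never on the source side; hence the dummy is never cut.
pad : ℕ → Tree → Tree
pad zero    l          = nil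
pad (suc d) nil        = cons nil (pad d nil)
pad (suc d) (cons x l) = cons x (pad d l)

pad-len : ∀ d l → len (pad d l) ≡ d
pad-len zero    l          = refl
pad-len (suc d) nil        = cong suc (pad-len d nil)
pad-len (suc d) (cons x l) = cong suc (pad-len d l)

pad-∈⁺ : ∀ {d x} l → len l ≤ d → x ∈ₜ l → x ∈ₜ pad d l
pad-∈⁺ {suc d} (cons x l) le       here       = here
pad-∈⁺ {suc d} (cons y l) (s≤s le) (there x∈) = there (pad-∈⁺ l le x∈)

pad-∈⁻ : ∀ {x} d l → x ∈ₜ pad d l → x ≡ nil ⊎ x ∈ₜ l
pad-∈⁻ (suc d) nil        here       = inj₁ refl
pad-∈⁻ (suc d) nil        (there x∈) = pad-∈⁻ d nil x∈
pad-∈⁻ (suc d) (cons y l) here       = inj₂ here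
pad-∈⁻ (suc d) (cons y l) (there x∈) with pad-∈⁻ d l x∈
... | inj₁ eq = inj₁ eq
... | inj₂ p  = inj₂ (there p)

_≟ₜ_ : ∀ (x y : Tree) → Dec (x ≡ y)
x ≟ₜ y with eqᵗ x y in eq
... | nil      = no (eqᵗ-complete eq)
... | cons _ _ = yes (eqᵗ-sound x y eq)

toBool : Tree → Bool
toBool nil        = false
toBool (cons _ _) = true

encodeBool-toBool : ∀ t → ifᵗ t tt nil ≡ encodeBool (toBool t)
encodeBool-toBool nil        = refl
encodeBool-toBool (cons _ _) = refl

visited-true : ∀ w V → toBool (visited w V) ≡ true → Visits V w
visited-true w V eq with cons _ _ ← visited w V in eq′ = visited-sound w V eq′

visited-false : ∀ w V → toBool (visited w V) ≡ false → ¬ Visits V w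
visited-false w V eq with nil ← visited w V in eq′ = visited-complete {w} {V} eq′

true-visited : ∀ w V → Visits V w → toBool (visited w V) ≡ true
true-visited w V v with visited w V in eq
... | cons _ _ = refl
... | nil      = ⊥-elim (visited-complete {w} {V} eq v)

lookup⇒∈ : ∀ {n} (p : Subset n) v → lookup p v ≡ true → v ∈ˢ p
lookup⇒∈ p v = lookup⇒[]= v p

∈⇒lookup : ∀ {n} {p : Subset n} {v} → v ∈ˢ p → lookup p v ≡ true
∈⇒lookup = []=⇒lookup

∉⇒lookup : ∀ {n} (p : Subset n) v → ¬ v ∈ˢ p → lookup p v ≡ false
∉⇒lookup p v v∉ with lookup p v in eq
... | false = refl
... | true  = ⊥-elim (v∉ (lookup⇒∈ p v eq))

xor-true : ∀ a b → a xor b ≡ true → (a ≡ true × b ≡ false) ⊎ (a ≡ false × b ≡ true)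
xor-true true  false _ = inj₁ (refl , refl)
xor-true false true  _ = inj₂ (refl , refl)

∈-△ : ∀ {n} (p q : Subset n) {v} → v ∈ˢ (p △ q) →
      (lookup p v ≡ true × lookup q v ≡ false) ⊎ (lookup p v ≡ false × lookup q v ≡ true)
∈-△ p q {v} v∈ = xor-true _ _ (trans (sym (lookup-zipWith _xor_ v p q)) (∈⇒lookup v∈))

△-∈ : ∀ {n} (p q : Subset n) v → lookup p v xor lookup q v ≡ true → v ∈ˢ (p △ q)
△-∈ p q v eq = lookup⇒∈ (p △ q) v (trans (lookup-zipWith _xor_ v p q) eq)

-- `generated` adds `U₀` separately from `J`, whereas `closed⇔∈𝓛` speaks of a single vertex set that
-- contains `U₀`.
⋃ᵁ-insert-zero : ∀ {n b} (part : Fin n → Maybe (Fin (suc b))) J →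
                 ⋃ᵁ part ⁅ zero ⁆ ∪ ⋃ᵁ part (outside ∷ J) ≡ ⋃ᵁ part (inside ∷ J)
⋃ᵁ-insert-zero {zero}  part J = refl
⋃ᵁ-insert-zero {suc n} part J = cong₂ _∷_ (at (part zero)) (⋃ᵁ-insert-zero (part ∘ suc) J)
  where
  at : ∀ m → maybe (lookup ⁅ zero ⁆) outside m ∨ maybe (lookup (outside ∷ J)) outside m ≡
             maybe (lookup (inside ∷ J)) outside m
  at nothing         = refl
  at (just zero)     = refl
  at (just (suc j))  = cong (_∨ lookup J j) (lookup-replicate j false)

-- The arcs and tokens of an instance

module Encoding (I : Instance) where

  open Instance I
  module L (i : Fin k) = CompactRepresentation (compact i)
  open L

  -- Colours start at 1, since a first component `nil` marks the source and the elements of `V`.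
  colour : Fin k → Tree
  colour i = encodeℕ (suc (toℕ i))

  -- Numbering from 1 keeps the elements apart from the source, which is `element (encodeℕ 0)`
  -- increased by one: the tree `element nil`.
  X : Fin n → Tree
  X v = element (encodeℕ (suc (toℕ v)))

  U : ∀ i → Maybe (Fin (suc (b i))) → Tree
  U i m = partVertex (colour i) (encodeMaybe (λ j → encodeℕ (toℕ j)) m)

  Rs arcs toks : Tree
  Rs   = tl (tl (encodeInstance I))
  arcs = allArcs (encodeℕ n) (encodeℕ k) Rs
  toks = tokens (encodeℕ n) (encodeℕ k) (encodeℕ d) Rs

  itemsOf fixedOf copies : Fin k → Tree
  itemsOf i = flat (tab (λ v → itemPair (X v) (U i (part i v))))
  fixedOf i = cons (cons source (cons (colour i) tt)) (flat (tab (λ j → flat (tab (λ l →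
    edgeArc (colour i) (encodeℕ (toℕ j)) (encodeℕ (toℕ l)) (encodeBool (edge i j l)))))))
  copies i  = mapT (λ _ _ → itemsOf i) (encodeℕ d)

  Rs-tab : Rs ≡ tab (λ i → encodeCompact (compact i))
  Rs-tab = encodeFun-tab (λ i → encodeCompact (compact i)) (λ i → i)

  items-tab : ∀ i → items (encodeℕ n) (colour i) (encodeCompact (compact i)) ≡ itemsOf i
  items-tab i = begin
    concatMapT (λ m t → itemPair (element (index (encodeℕ n) t)) (partVertex (colour i) m))
               (encodeFun (encodeMaybe (λ j → encodeℕ (toℕ j))) (part i))
      ≡⟨ cong (concatMapT (λ m t → itemPair (element (index (encodeℕ n) t)) (partVertex (colour i) m)))
              (encodeFun-tab (encodeMaybe (λ j → encodeℕ (toℕ j))) (part i)) ⟩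
    concatMapT (λ m t → itemPair (element (index (encodeℕ n) t)) (partVertex (colour i) m))
               (tab (λ v → encodeMaybe (λ j → encodeℕ (toℕ j)) (part i v)))
      ≡⟨ concatMap-index n (λ x m → itemPair (element x) (partVertex (colour i) m))
           (λ v → encodeMaybe (λ j → encodeℕ (toℕ j)) (part i v)) ⟩
    flat (tab (λ v → itemPair (element (position n v)) (U i (part i v))))
      ≡⟨ cong flat (tab-cong (λ v → cong (λ x → itemPair (element x) (U i (part i v))) (position-suc v))) ⟩
    itemsOf i ∎
    where open ≡-Reasoning

  fixed-tab : ∀ i → fixedArcs (colour i) (encodeCompact (compact i)) ≡ fixedOf i
  fixed-tab i = cong (cons (cons source (cons (colour i) tt))) (begin
    concatMapT (λ row t → row-arcs (index B t) row) (encodeFun (encodeFun encodeBool) (edge i))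
      ≡⟨ cong (concatMapT (λ row t → row-arcs (index B t) row)) (encodeFun-tab (encodeFun encodeBool) (edge i)) ⟩
    concatMapT (λ row t → row-arcs (index B t) row) (tab (λ j → encodeFun encodeBool (edge i j)))
      ≡⟨ concatMap-index (b i) row-arcs (λ j → encodeFun encodeBool (edge i j)) ⟩
    flat (tab (λ j → row-arcs (position (b i) j) (encodeFun encodeBool (edge i j))))
      ≡⟨ cong flat (tab-cong (λ j → trans (cong₂ row-arcs (position-pred j) (encodeFun-tab encodeBool (edge i j)))
           (trans (concatMap-index (b i) (edgeArc (colour i) (encodeℕ (toℕ j))) (λ l → encodeBool (edge i j l)))
                  (cong flat (tab-cong (λ l → cong (λ x → edgeArc (colour i) (encodeℕ (toℕ j)) x (encodeBool (edge i j l)))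
                                                   (position-pred l))))))) ⟩
    flat (tab (λ j → flat (tab (λ l →
      edgeArc (colour i) (encodeℕ (toℕ j)) (encodeℕ (toℕ l)) (encodeBool (edge i j l)))))) ∎)
    where
    open ≡-Reasoning
    B : Tree
    B = encodeℕ (b i)
    row-arcs : Tree → Tree → Tree
    row-arcs j row = concatMapT (λ bit t′ → edgeArc (colour i) j (index B t′) bit) row

  arcs-tab : arcs ≡ flat (tab (λ i → append (fixedOf i) (itemsOf i)))
  arcs-tab = begin
    concatMapT (λ R t → arcsOf (index (encodeℕ k) t) R) Rs
      ≡⟨ cong (concatMapT (λ R t → arcsOf (index (encodeℕ k) t) R)) Rs-tab ⟩
    concatMapT (λ R t → arcsOf (index (encodeℕ k) t) R) (tab (λ i → encodeCompact (compact i)))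
      ≡⟨ concatMap-index k arcsOf (λ i → encodeCompact (compact i)) ⟩
    flat (tab (λ i → arcsOf (position k i) (encodeCompact (compact i))))
      ≡⟨ cong flat (tab-cong (λ i → trans (cong (λ c → arcsOf c (encodeCompact (compact i))) (position-suc i))
                                          (cong₂ append (fixed-tab i) (items-tab i)))) ⟩
    flat (tab (λ i → append (fixedOf i) (itemsOf i))) ∎
    where
    open ≡-Reasoning
    arcsOf : Tree → Tree → Tree
    arcsOf c R = append (fixedArcs c R) (items (encodeℕ n) c R)

  toks-tab : toks ≡ flat (tab copies)
  toks-tab = begin
    concatMapT (λ R t → copiesOf (index (encodeℕ k) t) R) Rs
      ≡⟨ cong (concatMapT (λ R t → copiesOf (index (encodeℕ k) t) R)) Rs-tab ⟩
    concatMapT (λ R t → copiesOf (index (encodeℕ k) t) R) (tab (λ i → encodeCompact (compact i)))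
      ≡⟨ concatMap-index k copiesOf (λ i → encodeCompact (compact i)) ⟩
    flat (tab (λ i → copiesOf (position k i) (encodeCompact (compact i))))
      ≡⟨ cong flat (tab-cong (λ i → trans (cong (λ c → copiesOf c (encodeCompact (compact i))) (position-suc i))
                                          (cong (λ A → mapT (λ _ _ → A) (encodeℕ d)) (items-tab i)))) ⟩
    flat (tab copies) ∎
    where
    open ≡-Reasoning
    copiesOf : Tree → Tree → Tree
    copiesOf c R = mapT (λ _ _ → items (encodeℕ n) c R) (encodeℕ d)

  data FixedArc (i : Fin k) : Tree → Set where
    fromSource : FixedArc i (cons source (U i (just zero)))
    alongEdge  : ∀ j l → T (edge i j l) → FixedArc i (cons (U i (just j)) (U i (just l)))

  data Item (i : Fin k) : Tree → Set where
    out  : ∀ v → Item i (cons (X v) (U i (part i v)))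
    back : ∀ v → Item i (cons (U i (part i v)) (X v))

  itemsOf-∈⁻ : ∀ {i a} → a ∈ₜ itemsOf i → Item i a
  itemsOf-∈⁻ {i} a∈ with flat-tab-∈⁻ (λ v → itemPair (X v) (U i (part i v))) a∈
  ... | v , here       = out v
  ... | v , there here = back v

  itemsOf-∈⁺ : ∀ {i a} → Item i a → a ∈ₜ itemsOf i
  itemsOf-∈⁺ {i} (out v)  = flat-tab-∈⁺ (λ v → itemPair (X v) (U i (part i v))) v here
  itemsOf-∈⁺ {i} (back v) = flat-tab-∈⁺ (λ v → itemPair (X v) (U i (part i v))) v (there here)

  edgeArcs : ∀ i → Fin (suc (b i)) → Fin (suc (b i)) → Tree
  edgeArcs i j l = edgeArc (colour i) (encodeℕ (toℕ j)) (encodeℕ (toℕ l)) (encodeBool (edge i j l))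

  fixedOf-∈⁻ : ∀ {i a} → a ∈ₜ fixedOf i → FixedArc i a
  fixedOf-∈⁻ here = fromSource
  fixedOf-∈⁻ {i} (there a∈) with flat-tab-∈⁻ (λ j → flat (tab (edgeArcs i j))) a∈
  ... | j , a∈′ with flat-tab-∈⁻ (edgeArcs i j) a∈′
  ...   | l , a∈″ with edge i j l in eq
  fixedOf-∈⁻ {i} (there a∈) | j , a∈′ | l , here | true = alongEdge j l (subst T (sym eq) _)

  fixedOf-∈⁺ : ∀ {i a} → FixedArc i a → a ∈ₜ fixedOf i
  fixedOf-∈⁺ fromSource = here
  fixedOf-∈⁺ {i} (alongEdge j l e) =
    there (flat-tab-∈⁺ (λ j → flat (tab (edgeArcs i j))) j (flat-tab-∈⁺ (edgeArcs i j) l edge-∈))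
    where
    edge-∈ : cons (U i (just j)) (U i (just l)) ∈ₜ edgeArcs i j l
    edge-∈ with true ← edge i j l = here

  arcs-∈⁻ : ∀ {a} → a ∈ₜ arcs → ∃[ i ] (FixedArc i a ⊎ Item i a)
  arcs-∈⁻ {a} a∈ with flat-tab-∈⁻ (λ i → append (fixedOf i) (itemsOf i)) (subst (a ∈ₜ_) arcs-tab a∈)
  ... | i , a∈′ with ∈-append⁻ (fixedOf i) a∈′
  ...   | inj₁ p = i , inj₁ (fixedOf-∈⁻ p)
  ...   | inj₂ p = i , inj₂ (itemsOf-∈⁻ p)

  fixed-∈arcs : ∀ {i a} → FixedArc i a → a ∈ₜ arcs
  fixed-∈arcs {i} {a} p = subst (a ∈ₜ_) (sym arcs-tab)
    (flat-tab-∈⁺ (λ i → append (fixedOf i) (itemsOf i)) i (∈-append⁺ˡ (fixedOf-∈⁺ p)))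

  item-∈arcs : ∀ {i a} → Item i a → a ∈ₜ arcs
  item-∈arcs {i} {a} p = subst (a ∈ₜ_) (sym arcs-tab)
    (flat-tab-∈⁺ (λ i → append (fixedOf i) (itemsOf i)) i (∈-append⁺ʳ (fixedOf i) (itemsOf-∈⁺ p)))

  X-injective : ∀ {v w} → X v ≡ X w → v ≡ w
  X-injective eq = toℕ-injective (suc-injective (encodeℕ-injective (cong (tl ∘ tl) eq)))

  colour-injective : ∀ {i j} → colour i ≡ colour j → i ≡ j
  colour-injective eq = toℕ-injective (suc-injective (encodeℕ-injective eq))

  U-injective : ∀ {i j l} → U i (just j) ≡ U i (just l) → j ≡ l
  U-injective eq = toℕ-injective (encodeℕ-injective (cong (tl ∘ tl) eq))

  item-colour : ∀ {i j a} → Item i a → Item j a → i ≡ j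
  item-colour {i} {j} (out v) q = go q refl
    where
    go : ∀ {a} → Item j a → a ≡ cons (X v) (U i (part i v)) → i ≡ j
    go (out w)  eq = sym (colour-injective (cong (hd ∘ tl) eq))
    go (back w) eq with () ← cong (hd ∘ hd) eq
  item-colour {i} {j} (back v) q = go q refl
    where
    go : ∀ {a} → Item j a → a ≡ cons (U i (part i v)) (X v) → i ≡ j
    go (out w)  eq with () ← cong (hd ∘ hd) eq
    go (back w) eq = sym (colour-injective (cong (hd ∘ hd) eq))

  fixed-not-item : ∀ {i j a} → FixedArc i a → ¬ Item j a
  fixed-not-item {i} {j} p q = go p q refl
    where
    go : ∀ {a a′} → FixedArc i a → Item j a′ → a ≢ a′
    go fromSource        (out w)  eq with () ← cong (tl ∘ tl ∘ hd) eq
    go fromSource        (back w) eq with () ← cong (hd ∘ hd) eq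
    go (alongEdge _ _ _) (out w)  eq with () ← cong (hd ∘ hd) eq
    go (alongEdge _ _ _) (back w) eq with () ← cong (hd ∘ tl) eq

nil≢cons : ∀ {x y : Tree} → Tree.nil ≢ cons x y
nil≢cons ()

-- From separating sets to robust sets, and back

module Decoding (I : Instance) where

  open Instance I
  open Encoding I
  open L

  GoodGuess : Set
  GoodGuess = ∃[ w ] w ∈ₜ allWords (encodeℕ (bits k d)) ×
              ∃[ p ] ∃[ q ] attempt arcs (encodeℕ n) toks w ≡ cons p q

  data ItemAt (i : Fin k) (v : Fin n) : Tree → Set where
    out  : ItemAt i v (cons (X v) (U i (part i v)))
    back : ItemAt i v (cons (U i (part i v)) (X v))

  item : ∀ {i v a} → ItemAt i v a → Item i a
  item {v = v} out  = out v
  item {v = v} back = back v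

  itemAt-injective : ∀ {i v w a a′} → ItemAt i v a → ItemAt i w a′ → a ≡ a′ → v ≡ w
  itemAt-injective out  out  eq = X-injective (cong hd eq)
  itemAt-injective back back eq = X-injective (cong tl eq)
  itemAt-injective out  back eq with () ← cong (hd ∘ hd) eq
  itemAt-injective back out  eq with () ← cong (hd ∘ hd) eq

  module Sound (V ts : Tree) (S : Rounds.Separates arcs (encodeℕ n) toks V ts) where

    open Rounds.Separates S

    token-item : ∀ {a} → a ∈∈ ts → ∃[ i ] Item i a
    token-item {a} (A , A∈ , a∈) with pointwise-∈ (subst (Pointwise _⊆ₜ_ ts) toks-tab tokens⊆) A∈
    ... | B , B∈ , A⊆B with flat-tab-∈⁻ copies B∈
    ...   | i , B∈′ = i , itemsOf-∈⁻ (subst (a ∈ₜ_) (mapT-const-∈⁻ d B∈′) (A⊆B a∈))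

    -- A crossing arc is in a token, and tokens contain items only.
    fixed-closed : ∀ {i a} → FixedArc i a → Visits V (hd a) → Visits V (tl a)
    fixed-closed {i} {a} p v with visits? V (tl a)
    ... | yes v′ = v′
    ... | no ¬v′ = ⊥-elim (fixed-not-item p (proj₂ (token-item (crossing∈ (fixed-∈arcs p) v ¬v′))))

    answer : Subset n
    answer = tabulate (λ v → toBool (visited (X v) V))

    Z : ∀ i → Subset (suc (b i))
    Z i = tabulate (λ j → toBool (visited (U i (just j)) V))

    Y : Fin k → Subset n
    Y i = ⋃ᵁ (part i) (Z i)

    lookup-answer : ∀ v → lookup answer v ≡ toBool (visited (X v) V)
    lookup-answer = lookup∘tabulate (λ v → toBool (visited (X v) V))

    lookup-Z : ∀ i j → lookup (Z i) j ≡ toBool (visited (U i (just j)) V)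
    lookup-Z i = lookup∘tabulate (λ j → toBool (visited (U i (just j)) V))

    lookup-Y : ∀ i v → lookup (Y i) v ≡ toBool (visited (U i (part i v)) V)
    lookup-Y i v = trans (lookup∘tabulate (λ v → maybe (lookup (Z i)) outside (part i v)) v) (at (part i v))
      where
      at : ∀ m → maybe (lookup (Z i)) outside m ≡ toBool (visited (U i m) V)
      at (just j) = lookup-Z i j
      at nothing with visited (U i nothing) V in eq
      ... | nil      = refl
      ... | cons _ _ = ⊥-elim (sink∉ (visited-sound (U i nothing) V eq))

    visits⇒∈Z : ∀ {i} j → Visits V (U i (just j)) → j ∈ˢ Z i
    visits⇒∈Z {i} j v = lookup⇒∈ (Z i) j (trans (lookup-Z i j) (true-visited (U i (just j)) V v))

    ∈Z⇒visits : ∀ {i} j → j ∈ˢ Z i → Visits V (U i (just j))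
    ∈Z⇒visits {i} j j∈ = visited-true (U i (just j)) V (trans (sym (lookup-Z i j)) (∈⇒lookup j∈))

    Y-minimizer : ∀ i → argmin (f i) (Y i)
    Y-minimizer i = Equivalence.to (closed⇔∈𝓛 i (Z i) (visits⇒∈Z zero (fixed-closed (fromSource {i}) source∈)))
      (λ j l j∈ e → visits⇒∈Z l (fixed-closed (alongEdge j l e) (∈Z⇒visits j j∈)))

    Crossing : Tree → Set
    Crossing a = Visits V (hd a) × ¬ Visits V (tl a)

    crossing-item : ∀ i {v} → v ∈ˢ (answer △ Y i) → ∃[ a ] ItemAt i v a × Crossing a
    crossing-item i {v} v∈ with ∈-△ answer (Y i) v∈
    ... | inj₁ (p , q) = _ , out , visited-true (X v) V (trans (sym (lookup-answer v)) p)
                                 , visited-false (U i (part i v)) V (trans (sym (lookup-Y i v)) q)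
    ... | inj₂ (p , q) = _ , back , visited-true (U i (part i v)) V (trans (sym (lookup-Y i v)) q)
                                  , visited-false (X v) V (trans (sym (lookup-answer v)) p)

    -- The final tokens are split by colour again, since the budgets are counted per colour.
    segments : ∃[ seg ] ts ≡ flat (tab seg) × (∀ i → Pointwise _⊆ₜ_ (seg i) (copies i))
    segments = pointwise-flat⁻ copies (subst (Pointwise _⊆ₜ_ ts) toks-tab tokens⊆)

    seg : Fin k → Tree
    seg = proj₁ segments

    record Hit (i : Fin k) (v : Fin n) : Set where
      field
        {arc token} : Tree
        at       : ItemAt i v arc
        crossing : Crossing arc
        token∈   : token ∈ₜ seg i
        arc∈     : arc ∈ₜ token
    open Hit

    hit : ∀ i v → v ∈ˢ (answer △ Y i) → Hit i v
    hit i v v∈ with crossing-item i v∈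
    ... | a , at , c with crossing∈ (item-∈arcs (item at)) (proj₁ c) (proj₂ c)
    ...   | A , A∈ , a∈ with flat-tab-∈⁻ seg (subst (A ∈ₜ_) (proj₁ (proj₂ segments)) A∈)
    ...     | j , A∈seg with pointwise-∈ (proj₂ (proj₂ segments) j) A∈seg
    ...       | B , B∈ , A⊆B
      with refl ← item-colour (itemsOf-∈⁻ {j} (subst (a ∈ₜ_) (mapT-const-∈⁻ d B∈) (A⊆B a∈))) (item at) =
      record { at = at ; crossing = c ; token∈ = A∈seg ; arc∈ = a∈ }

    seg-len : ∀ i → len (seg i) ≡ d
    seg-len i = trans (pointwise-len (proj₂ (proj₂ segments) i)) (mapT-const-len d)

    -- The symmetric difference injects into the `d` tokens of colour `i`: each of its elements has
    -- a crossing item, which lies in such a token, and by `once` a token contains only one crossing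
    -- arc.
    close : ∀ i → ∣ answer △ Y i ∣ ≤ d
    close i = subst (∣ answer △ Y i ∣ ≤_) (seg-len i)
      (card-≤ (answer △ Y i) (λ v v∈ → place (token∈ (hit i v v∈)))
        (λ {v} {w} v∈ w∈ eq → same (hit i v v∈) (hit i w w∈) eq))
      where
      same : ∀ {v w} (g : Hit i v) (h : Hit i w) → place (token∈ g) ≡ place (token∈ h) → v ≡ w
      same g h eq with refl ← place-injective (token∈ g) (token∈ h) eq =
        itemAt-injective (at g) (at h)
          (once (subst (token g ∈ₜ_) (sym (proj₁ (proj₂ segments))) (flat-tab-∈⁺ seg i (token∈ g)))
                (arc∈ g) (arc∈ h) (item-∈arcs (item (at g))) (item-∈arcs (item (at h))) (crossing g) (crossing h))

    robust : Robust I answer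
    robust i = Y i , Y-minimizer i , close i

    readout-answer : readout (encodeℕ n) V ≡ encodeList encodeBool (toList answer)
    readout-answer = begin
      readout (encodeℕ n) V
        ≡⟨ cong (mapT (λ _ t → G (index (encodeℕ n) t))) (encodeℕ-tab n) ⟩
      mapT (λ _ t → G (index (encodeℕ n) t)) (tab {n} (λ _ → nil))
        ≡⟨ map-index n {n} G (λ _ → nil) ⟩
      tab {n} (λ v → G (position n v))
        ≡⟨ tab-cong (λ v → trans (cong G (position-suc v)) (encodeBool-toBool (visited (X v) V))) ⟩
      tab (λ v → encodeBool (toBool (visited (X v) V)))
        ≡⟨ encodeFun-tab encodeBool (λ v → toBool (visited (X v) V)) ⟨
      encodeList encodeBool (toList answer) ∎
      where
      open ≡-Reasoning
      G : Tree → Tree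
      G x = ifᵗ (visited (element x) V) tt nil

  module Complete (S : Subset n) (robust : Robust I S) where

    Y : Fin k → Subset n
    Y i = proj₁ (robust i)

    J : ∀ i → Subset (b i)
    J i = proj₁ (generated i (Y i) (proj₁ (proj₂ (robust i))))

    Z : ∀ i → Subset (suc (b i))
    Z i = inside ∷ J i

    Y≡⋃Z : ∀ i → Y i ≡ ⋃ᵁ (part i) (Z i)
    Y≡⋃Z i = trans (proj₂ (generated i (Y i) (proj₁ (proj₂ (robust i))))) (⋃ᵁ-insert-zero (part i) (J i))

    Z-closed : ∀ i → NoOutgoingEdge (edge i) (Z i)
    Z-closed i = Equivalence.from (closed⇔∈𝓛 i (Z i) here) (subst (argmin (f i)) (Y≡⋃Z i) (proj₁ (proj₂ (robust i))))

    -- The source side of the cut that belongs to the solution; the parts `U_∞` are never on it.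
    data Val : Tree → Set where
      src  : Val source
      elem : ∀ {v} → v ∈ˢ S → Val (X v)
      vert : ∀ {i j} → j ∈ˢ Z i → Val (U i (just j))

    val? : ∀ z → Dec (Val z)
    val? z = map′ to from
      ((z ≟ₜ source) ⊎-dec
       (any? (λ v → (z ≟ₜ X v) ×-dec (v ∈? S)) ⊎-dec
        any? (λ i → any? (λ j → (z ≟ₜ U i (just j)) ×-dec (j ∈? Z i)))))
      where
      Cases : Set
      Cases = z ≡ source ⊎ (∃[ v ] z ≡ X v × v ∈ˢ S) ⊎ (∃[ i ] ∃[ j ] z ≡ U i (just j) × j ∈ˢ Z i)
      to : Cases → Val z
      to (inj₁ refl)                        = src
      to (inj₂ (inj₁ (v , refl , v∈)))      = elem v∈
      to (inj₂ (inj₂ (i , j , refl , j∈)))  = vert j∈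
      from : Val z → Cases
      from src       = inj₁ refl
      from (elem v∈) = inj₂ (inj₁ (_ , refl , v∈))
      from (vert j∈) = inj₂ (inj₂ (_ , _ , refl , j∈))

    val-sink : ∀ z → tl z ≡ nil → ¬ Val z
    val-sink _ () src
    val-sink _ () (elem _)
    val-sink _ () (vert _)

    val-X⁻ : ∀ {v} → Val (X v) → v ∈ˢ S
    val-X⁻ {v} = go refl
      where
      go : ∀ {z} → z ≡ X v → Val z → v ∈ˢ S
      go eq src       with () ← cong (tl ∘ tl) eq
      go eq (elem v∈) = subst (_∈ˢ S) (X-injective eq) v∈
      go eq (vert _)  with () ← cong hd eq

    val-U⁻ : ∀ {i} m → Val (U i m) → ∃[ j ] m ≡ just j × j ∈ˢ Z i
    val-U⁻ {i} m = go m refl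
      where
      go : ∀ m {z} → z ≡ U i m → Val z → ∃[ j ] m ≡ just j × j ∈ˢ Z i
      go m        eq src      with () ← cong hd eq
      go m        eq (elem _) with () ← cong hd eq
      go nothing  eq (vert _) with () ← cong tl eq
      go (just j) eq (vert {i′} {j′} j∈) with refl ← colour-injective (cong hd eq) =
        j , refl , subst (_∈ˢ Z i) (U-injective {i} eq) j∈

    lookup-Y : ∀ i v → lookup (Y i) v ≡ maybe (lookup (Z i)) outside (part i v)
    lookup-Y i v = trans (cong (λ p → lookup p v) (Y≡⋃Z i))
      (lookup∘tabulate (λ v → maybe (lookup (Z i)) outside (part i v)) v)

    val-U : ∀ i v → Val (U i (part i v)) → lookup (Y i) v ≡ true
    val-U i v x with val-U⁻ (part i v) x
    ... | j , eq , j∈ = trans (lookup-Y i v) (trans (cong (maybe (lookup (Z i)) outside) eq) (∈⇒lookup j∈))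

    ¬val-U : ∀ i v → ¬ Val (U i (part i v)) → lookup (Y i) v ≡ false
    ¬val-U i v ¬x = trans (lookup-Y i v) (at (part i v) ¬x)
      where
      at : ∀ m → ¬ Val (U i m) → maybe (lookup (Z i)) outside m ≡ false
      at nothing  _  = refl
      at (just j) ¬x = ∉⇒lookup (Z i) j (λ j∈ → ¬x (vert j∈))

    -- Of the two arcs between `v` and its part only one can leave the source side, and membership
    -- of `v` in `S` decides which.
    cutItem : ∀ i → Fin n → Tree
    cutItem i v = if lookup S v then cons (X v) (U i (part i v)) else cons (U i (part i v)) (X v)

    cutItem-item : ∀ i v → Item i (cutItem i v)
    cutItem-item i v with lookup S v
    ... | true  = out v
    ... | false = back v

    cutItems : Fin k → Tree
    cutItems i = pad d (elements (S △ Y i) (cutItem i))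

    cs : Tree
    cs = flat (tab cutItems)

    cs-len : len cs ≡ k * d
    cs-len = flat-len d cutItems (λ i → pad-len d _)

    ∈-cs : ∀ i v → lookup S v xor lookup (Y i) v ≡ true → cutItem i v ∈ₜ cs
    ∈-cs i v eq = flat-tab-∈⁺ cutItems i (pad-∈⁺ (elements (S △ Y i) (cutItem i))
      (≤-trans (≤-reflexive (elements-len (S △ Y i) (cutItem i))) (proj₂ (proj₂ (robust i))))
      (elements-∈⁺ (S △ Y i) (cutItem i) (△-∈ S (Y i) v eq)))

    cutArc-∈cs : ∀ {i a} → FixedArc i a ⊎ Item i a → Val (hd a) → ¬ Val (tl a) → a ∈ₜ cs
    cutArc-∈cs (inj₁ fromSource) p ¬q = ⊥-elim (¬q (vert here))
    cutArc-∈cs {i} (inj₁ (alongEdge j l e)) p ¬q with val-U⁻ (just j) p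
    ... | .j , refl , j∈ = ⊥-elim (¬q (vert (Z-closed i j l j∈ e)))
    cutArc-∈cs {i} (inj₂ (out v)) p ¬q =
      subst (λ s → (if s then cons (X v) (U i (part i v)) else cons (U i (part i v)) (X v)) ∈ₜ cs) S-v
            (∈-cs i v (cong₂ _xor_ S-v (¬val-U i v ¬q)))
      where
      S-v : lookup S v ≡ true
      S-v = ∈⇒lookup (val-X⁻ p)
    cutArc-∈cs {i} (inj₂ (back v)) p ¬q =
      subst (λ s → (if s then cons (X v) (U i (part i v)) else cons (U i (part i v)) (X v)) ∈ₜ cs) S-v
            (∈-cs i v (cong₂ _xor_ S-v (val-U i v p)))
      where
      S-v : lookup S v ≡ false
      S-v = ∉⇒lookup S v (λ v∈ → ¬q (elem v∈))

    cut∈cs : ∀ {a} → a ∈ₜ arcs → Val (hd a) → ¬ Val (tl a) → a ∈ₜ cs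
    cut∈cs a∈ = cutArc-∈cs (proj₂ (arcs-∈⁻ a∈))

    module Sol = Solution arcs (encodeℕ n) toks cs Val val? src val-sink cut∈cs

    hosts : Pointwise Sol.Hosts cs toks
    hosts = subst (Pointwise Sol.Hosts cs) (sym toks-tab)
      (pointwise-flat (λ i → mapT-const-pointwise {Sol.Hosts} d (host i) (pad-len d (elements (S △ Y i) (cutItem i)))))
      where
      host : ∀ i {x} → x ∈ₜ cutItems i → Sol.Hosts x (itemsOf i)
      host i {x} x∈ cut with pad-∈⁻ d (elements (S △ Y i) (cutItem i)) x∈
      ... | inj₁ refl = ⊥-elim (val-sink nil refl (proj₁ cut))
      ... | inj₂ x∈′ with elements-∈⁻ (S △ Y i) (cutItem i) x∈′
      ...   | v , refl = itemsOf-∈⁺ (cutItem-item i v)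

    enough-bits : suc (len cs) * (len cs * len cs) ≤ bits k d
    enough-bits = *-mono-≤ l≤ (*-mono-≤ (≤-trans (n≤1+n _) l≤) (≤-trans (n≤1+n _) l≤))
      where
      open ≤-Reasoning
      l≤ : suc (len cs) ≤ suc k * suc d
      l≤ = begin
        suc (len cs)  ≡⟨ cong suc cs-len ⟩
        suc (k * d)  ≤⟨ s≤s (*-monoʳ-≤ k (n≤1+n d)) ⟩
        suc (k * suc d)  ≤⟨ s≤s (m≤n+m _ d) ⟩
        suc k * suc d  ∎

    word-found : (∃[ w ] IsWord w × len w ≤ suc (len cs) * (len cs * len cs) × Sol.Success w) →
      GoodGuess
    word-found (w , word , l , success) =
      -- Success does not depend on what follows `w`, so zero bits fill it up to the length of the
      -- listed words.
      append w v , allWords-∈ (encodeℕ (bits k d)) (append-isWord word (encodeℕ-isWord _)) full , success v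
      where
      v : Tree
      v = encodeℕ (bits k d ∸ len w)
      full : len (append w v) ≡ len (encodeℕ (bits k d))
      full = begin
        len (append w v)  ≡⟨ append-len w v ⟩
        len w + len v  ≡⟨ cong (len w +_) (len-encodeℕ (bits k d ∸ len w)) ⟩
        len w + (bits k d ∸ len w)  ≡⟨ m+[n∸m]≡n (≤-trans l enough-bits) ⟩
        bits k d  ≡⟨ len-encodeℕ (bits k d) ⟨
        len (encodeℕ (bits k d))  ∎
        where open ≡-Reasoning

    success : GoodGuess
    success = word-found (Sol.attempt-complete hosts)

  output : Tree
  output = attempts arcs (encodeℕ n) toks (allWords (encodeℕ (bits k d)))

  output-correct : ∀ t → output ≡ t → ∃[ A ] t ≡ encodeAnswer I A × Correct I A
  output-correct nil eq = nothing , refl , λ { (S , robust) → fail (Complete.success S robust) }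
    where
    fail : ¬ GoodGuess
    fail (w , w∈ , p , q , eq′) = nil≢cons
      (trans (sym (firstT-nil (λ w → attempt arcs (encodeℕ n) toks w) (allWords (encodeℕ (bits k d))) eq w∈)) eq′)
  output-correct (cons x y) eq =
    found (firstT-cons (λ w → attempt arcs (encodeℕ n) toks w) (allWords (encodeℕ (bits k d))) eq)
    where
    found : (∃[ w ] w ∈ₜ allWords (encodeℕ (bits k d)) × attempt arcs (encodeℕ n) toks w ≡ cons x y) →
            ∃[ A ] cons x y ≡ encodeAnswer I A × Correct I A
    found (w , _ , eq′) = answered (Rounds.attempt-sound arcs (encodeℕ n) toks w eq′)
      where
      answered : (y ≡ nil × ∃[ V ] ∃[ ts ] x ≡ readout (encodeℕ n) V × Rounds.Separates arcs (encodeℕ n) toks V ts) →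
                 ∃[ A ] cons x y ≡ encodeAnswer I A × Correct I A
      answered (refl , V , ts , refl , sep) =
        just (Sound.answer V ts sep) , cong (λ x → cons x nil) (Sound.readout-answer V ts sep) , Sound.robust V ts sep

-- The bound is computable

doubleP : PolyTime (λ x → append (hd (tl (tl x))) (hd (tl (tl x))))
doubleP = appendP arg2 arg2

exp₂U : Tree → Tree
exp₂U m = para (λ _ _ a → append a a) tt m

exp₂U-encodeℕ : ∀ m → exp₂U (encodeℕ m) ≡ encodeℕ (2 ^ m)
exp₂U-encodeℕ zero    = refl
exp₂U-encodeℕ (suc m) = begin
  append (exp₂U (encodeℕ m)) (exp₂U (encodeℕ m))  ≡⟨ cong (λ a → append a a) (exp₂U-encodeℕ m) ⟩
  append (encodeℕ (2 ^ m)) (encodeℕ (2 ^ m))  ≡⟨ append-encodeℕ (2 ^ m) (2 ^ m) ⟩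
  encodeℕ (2 ^ m + 2 ^ m)  ≡⟨ cong (λ a → encodeℕ (2 ^ m + a)) (+-identityʳ (2 ^ m)) ⟨
  encodeℕ (2 ^ suc m)  ∎
  where open ≡-Reasoning

powU : ℕ → Tree → Tree
powU zero    x = tt
powU (suc e) x = mulU x (powU e x)

powP : ∀ e → PolyTime (powU e)
powP zero    = ttP
powP (suc e) = call2 mulUP idP (powP e)

powU-encodeℕ : ∀ e m → powU e (encodeℕ m) ≡ encodeℕ (m ^ e)
powU-encodeℕ zero    m = refl
powU-encodeℕ (suc e) m = trans (cong (mulU (encodeℕ m)) (powU-encodeℕ e m)) (mulU-encodeℕ m (m ^ e))

pairBitsP : PolyTime (λ x → bitsU (hd x) (tl x))
pairBitsP = call2 bitsUP (hdP idP) (tlP idP)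

-- `exp₂U` has exponentially large values and enters as a bare code; computability asks for halting
-- only.
guessesC : ℕ → Code
guessesC e = code (powP e) ∘C (paraCode idP ttP doubleP ∘C code pairBitsP)

∘C-computes : ∀ {f g : Tree → Tree} c c′ → (∀ x → ⟦ c ⟧ x ≡ f x) → (∀ x → ⟦ c′ ⟧ x ≡ g x) →
              ∀ x → ⟦ c ∘C c′ ⟧ x ≡ f (g x)
∘C-computes {g = g} c c′ h h′ x = trans (cong ⟦ c ⟧ (h′ x)) (h (g x))

guessesC-computes : ∀ e x → ⟦ guessesC e ⟧ x ≡ powU e (exp₂U (bitsU (hd x) (tl x)))
guessesC-computes e = ∘C-computes {powU e} {λ x → exp₂U (bitsU (hd x) (tl x))} (code (powP e)) (paraCode idP ttP doubleP ∘C code pairBitsP) (computes (powP e))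
  (∘C-computes {exp₂U} {λ x → bitsU (hd x) (tl x)} (paraCode idP ttP doubleP) (code pairBitsP) (paraCode-computes idP ttP doubleP) (computes pairBitsP))

guessesU-encodeℕ : ∀ e k d → powU e (exp₂U (bitsU (encodeℕ k) (encodeℕ d))) ≡ encodeℕ (guesses k d ^ e)
guessesU-encodeℕ e k d =
  trans (cong (powU e) (trans (cong exp₂U (bitsU-encodeℕ k d)) (exp₂U-encodeℕ (bits k d))))
        (powU-encodeℕ e (guesses k d))

guesses-computable : ∀ e → Computable (λ k d → guesses k d ^ e)
guesses-computable e = program (guessesC e) , λ k d → _ ,
  subst (program (guessesC e) ⟨ cons (encodeℕ k) (encodeℕ d) ⟩⇓_∥ time (guessesC e) (cons (encodeℕ k) (encodeℕ d)))
        (trans (guessesC-computes e (cons (encodeℕ k) (encodeℕ d))) (guessesU-encodeℕ e k d))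
        (program-correct (guessesC e) (cons (encodeℕ k) (encodeℕ d)))

+≤* : ∀ {m n} → 2 ≤ m → 2 ≤ n → m + n ≤ m * n
+≤* {suc (suc m)} {n} (s≤s (s≤s _)) 2≤n = begin
  2 + m + n  ≡⟨ +-comm (2 + m) n ⟩
  n + (2 + m)  ≤⟨ +-monoʳ-≤ n (+-mono-≤ 2≤n (≤-trans (≤-reflexive (sym (*-identityʳ m)))
                             (*-monoʳ-≤ m (≤-trans (n≤1+n 1) 2≤n)))) ⟩
  n + (n + m * n)  ∎
  where open ≤-Reasoning

2≤guesses : ∀ k d → 2 ≤ guesses k d
2≤guesses k d = ^-monoʳ-≤ 2 {1} {bits k d} (s≤s z≤n)

β-bound : ∀ e I → β I ^ e ≤ guesses (Instance.k I) (Instance.d I) ^ e * length I ^ e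
β-bound e I = begin
  (length I + G) ^ e  ≤⟨ ^-monoˡ-≤ e (+≤* (2≤length I) (2≤guesses (Instance.k I) (Instance.d I))) ⟩
  (length I * G) ^ e  ≡⟨ *-^-distrib (length I) G e ⟨
  length I ^ e * G ^ e  ≡⟨ *-comm (length I ^ e) (G ^ e) ⟩
  G ^ e * length I ^ e  ∎
  where
  open ≤-Reasoning
  G : ℕ
  G = guesses (Instance.k I) (Instance.d I)

answers : ∀ c → (∀ I → ⟦ c ⟧ (encodeInstance I) ≡ Decoding.output I) → ∀ I →
  ∃[ A ] (program c ⟨ encodeInstance I ⟩⇓ encodeAnswer I A ∥ time c (encodeInstance I)) × Correct I A
answers c output≡ I = run (Decoding.output-correct I (⟦ c ⟧ (encodeInstance I)) (sym (output≡ I)))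
  where
  run : (∃[ A ] ⟦ c ⟧ (encodeInstance I) ≡ encodeAnswer I A × Correct I A) →
        ∃[ A ] (program c ⟨ encodeInstance I ⟩⇓ encodeAnswer I A ∥ time c (encodeInstance I)) × Correct I A
  run (A , eq , correct) = A
    , subst (program c ⟨ encodeInstance I ⟩⇓_∥ time c (encodeInstance I)) eq (program-correct c (encodeInstance I))
    , correct

theorem3p5 : ∃[ g ] Computable g ×
    ∃[ P ] ∃[ c ] (∀ (I : Instance) →
    ∃[ A ] ∃[ t ]
    ((P ⟨ encodeInstance I ⟩⇓ encodeAnswer I A ∥ t) ×
    Correct I A ×
    t ≤ g (Instance.k I) (Instance.d I) * length I ^ c))
theorem3p5 =
  -- The exponent of the time bound in `β` serves both for `g` and for the power of the length.
  (λ k d → guesses k d ^ e) , guesses-computable e , program c , e , λ I →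
    let A , halts , correct = answers c (proj₁ (proj₂ mainCode)) I
    in  A , time c (encodeInstance I) , halts , correct , ≤-trans (proj₂ (proj₂ (proj₂ mainCode)) I) (β-bound e I)
  where
  c : Code
  c = proj₁ mainCode
  e : ℕ
  e = proj₁ (proj₂ (proj₂ mainCode))
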